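{- Let $n\ge 1$ and let $\phi=B^{ -1}\circ A:\mathfrak{S}_n\to\mathfrak{S}_n$. Then: (1) For every $\sigma\in\mathfrak{S}_n$, $$(\mathsf{Inv}(\sigma),\mathsf{Rmil}(\sigma),\mathsf{Lmap}(\sigma),\mathsf{Lmil}(\sigma))=(\mathsf{Sor}(\phi(\sigma)),\mathsf{Cyc}(\phi(\sigma)),\mathsf{Lmap}(\phi(\sigma)),\mathsf{Lmic}_1(\phi(\sigma))).$$ (2) The quadruples of statistics $(\mathsf{inv},\mathsf{rmin},\mathsf{lmax},\mathsf{lmin})$ and $(\mathsf{sor},\mathsf{cyc},\mathsf{lmax},\mathsf{lmic}_1)$ have the same joint distribution over $\mathfrak{S}_n$, and $$\sum_{\sigma\in\mathfrak{S}_n}q^{\mathsf{inv}(\sigma)}x^{\mathsf{rmin}(\sigma)}y^{\mathsf{lmin}(\sigma)}=\sum_{\sigma\in\mathfrak{S}_n}q^{\mathsf{sor}(\sigma)}x^{\mathsf{cyc}(\sigma)}y^{\mathsf{lmic}_1(\sigma)}=xy\prod_{r=2}^{n}\bigl(x+[r]_q+yq^{r-1}-1-q^{r-1}\bigr),$$ where $[r]_q=1+q+\dots+q^{r-1}$.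
   Context: $\mathfrak{S}_n$ is the symmetric group on $[n]=\{1,\dots,n\}$; a permutation is written in one-line notation $\sigma=\sigma_1\cdots\sigma_n$ with $\sigma_i=\sigma(i)$, and products of permutations are composed as functions from right to left. Lehmer code: $\mathsf{Leh}(\sigma)=(\ell_1,\dots,\ell_n)$ with $\ell_i=\#\{j:1\le j\le i,\ \sigma_j\le\sigma_i\}$; it is a bijection from $\mathfrak{S}_n$ onto $\mathcal{L}_n=\{(\ell_1,\dots,\ell_n):1\le \ell_i\le i\}$. The $A$-code is $A(\sigma)=\mathsf{Leh}(\sigma^{ -1})$. The $B$-code is $B(\sigma)=(b_1,\dots,b_n)$ where $b_i=\sigma^{ -k_i}(i)$ and $k_i\ge1$ is the smallest integer with $\sigma^{ -k_i}(i)\le i$; $B:\mathfrak{S}_n\to\mathcal{L}_n$ is a bijection. For $(\ell_1,\dots,\ell_n)\in\mathcal{L}_n$ let $O((\ell_1,\dots,\ell_n))=\{i:\ell_i=1\}$. Induced set $\langle(\ell_1,\dots,\ell_n)\rangle$ of $(\ell_1,\dots,\ell_n)\in\mathcal{L}_n$: start with $S=[n]$, $U=\emptyset$; for $i=n,n-1,\dots,1$: let $\ell_i'$ be the $\ell_i$-th smallest element of $S$, add to $U$ all ordered pairs $(\ell_i',j)$ with $j\in S$, $j>\ell_i'$, then delete $\ell_i'$ from $S$. The final $U$ is the induced set. Set-valued statistics: $\mathsf{Inv}(\sigma)=\{(i,j):i<j,\ \sigma_i>\sigma_j\}$; $\mathsf{Sor}(\sigma)=\langle B(\sigma)\rangle$;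 $\mathsf{Rmil}(\sigma)=\{\sigma_i:\sigma_i<\sigma_j\text{ for all }j>i\}$; $\mathsf{Lmap}(\sigma)=\{i:\sigma_i>\sigma_j\text{ for all }j<i\}$; $\mathsf{Lmil}(\sigma)=\{\sigma_i:\sigma_i<\sigma_j\text{ for all }j<i\}$; $\mathsf{Cyc}(\sigma)$ = the set of smallest elements of the cycles of $\sigma$; $\mathsf{Lmic}_1(\sigma)=O(B(\sigma))$. Ordinary statistics: $\mathsf{inv}=\#\mathsf{Inv}$, $\mathsf{rmin}=\#\mathsf{Rmil}$, $\mathsf{lmax}=\#\mathsf{Lmap}$, $\mathsf{lmin}=\#\mathsf{Lmil}$, $\mathsf{cyc}=\#\mathsf{Cyc}$ (number of cycles), $\mathsf{lmic}_1=\#\mathsf{Lmic}_1$. The sorting index: write $\sigma$ uniquely as a product of transpositions $\sigma=(i_1\,j_1)(i_2\,j_2)\cdots(i_k\,j_k)$ with $j_1<j_2<\dots<j_k$ and $i_r<j_r$ for all $r$; then $\mathsf{sor}(\sigma)=\sum_{r=1}^k(j_r-i_r)$. -}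

module Defs where

open import Data.Bool using (Bool; true; false; _∧_; _∨_; not; if_then_else_)
open import Data.Nat as ℕ using (ℕ; zero; suc; _+_; _∸_; _≤ᵇ_; _<ᵇ_; _≡ᵇ_)
open import Data.List using (List; []; _∷_; _++_; map; concatMap; filterᵇ; length; reverse; upTo; foldr)
open import Data.List.Relation.Binary.Permutation.Propositional using (_↭_)
open import Data.List.Membership.Propositional using (_∈_)
open import Data.Product using (_×_; _,_)
open import Function.Bundles using (_⇔_)
open import Data.Integer as ℤ using (ℤ)

-- Permutations in one-line notation: σ = σ₁ ⋯ σₙ is the list
-- (σ₁ ∷ … ∷ σₙ ∷ []) of natural numbers; positions and values are 1-based.

allᵇ : {A : Set} → (A → Bool) → List A → Bool
allᵇ p []       = true
allᵇ p (x ∷ xs) = p x ∧ allᵇ p xs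

range : ℕ → List ℕ
range n = map suc (upTo n)

IsPerm : ℕ → List ℕ → Set
IsPerm n σ = σ ↭ range n

insertAll : ℕ → List ℕ → List (List ℕ)
insertAll x []       = (x ∷ []) ∷ []
insertAll x (y ∷ ys) = (x ∷ y ∷ ys) ∷ map (y ∷_) (insertAll x ys)

perms : ℕ → List (List ℕ)
perms zero    = [] ∷ []
perms (suc n) = concatMap (insertAll (suc n)) (perms n)

-- σ(i) for a 1-based position i (0 outside [n])
at : List ℕ → ℕ → ℕ
at []       _             = 0
at (x ∷ xs) zero          = 0
at (x ∷ xs) (suc zero)    = x
at (x ∷ xs) (suc (suc i)) = at xs (suc i)

-- σ⁻¹(v): the 1-based position of value v (0 if absent)
pos : List ℕ → ℕ → ℕ
pos []       v = 0
pos (x ∷ xs) v = if x ≡ᵇ v then 1 else (if pos xs v ≡ᵇ 0 then 0 else suc (pos xs v))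

inverse : List ℕ → List ℕ
inverse σ = map (pos σ) (range (length σ))

Leh : List ℕ → List ℕ
Leh σ = map (λ i → length (filterᵇ (λ j → at σ j ≤ᵇ at σ i) (range i))) (range (length σ))

Acode : List ℕ → List ℕ
Acode σ = Leh (inverse σ)

-- iterate σ⁻¹ starting at x, returning the first value σ⁻ᵏ(i) ≤ i (k ≥ 1);
-- fuel n suffices since the orbit of i returns to i within n steps
bIter : List ℕ → ℕ → ℕ → ℕ → ℕ
bIter σ zero     i x = 0
bIter σ (suc f)  i x = let y = pos σ x in if y ≤ᵇ i then y else bIter σ f i y

-- B-code: bᵢ = σ^{-kᵢ}(i), kᵢ ≥ 1 minimal with σ^{-kᵢ}(i) ≤ i
Bcode : List ℕ → List ℕ
Bcode σ = map (λ i → bIter σ (length σ) i i) (range (length σ))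

O : List ℕ → List ℕ
O ℓ = filterᵇ (λ i → at ℓ i ≡ᵇ 1) (range (length ℓ))

-- ℓ-th smallest element (1-based) of a list sorted increasingly
nth : ℕ → List ℕ → ℕ
nth _             []       = 0
nth zero          (x ∷ xs) = 0
nth (suc zero)    (x ∷ xs) = x
nth (suc (suc k)) (x ∷ xs) = nth (suc k) xs

remove : ℕ → List ℕ → List ℕ
remove e = filterᵇ (λ j → not (j ≡ᵇ e))

-- the induced-set procedure, processing ℓₙ, ℓₙ₋₁, …, ℓ₁ with current (sorted) set S
inducedGo : List ℕ → List ℕ → List (ℕ × ℕ)
inducedGo []       S = []
inducedGo (l ∷ ls) S =
  let e = nth l S in
  map (e ,_) (filterᵇ (λ j → e <ᵇ j) S) ++ inducedGo ls (remove e S)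

induced : List ℕ → List (ℕ × ℕ)
induced ℓ = inducedGo (reverse ℓ) (range (length ℓ))

-- Set-valued statistics (finite sets as lists; compared by membership)

pairsLt : ℕ → List (ℕ × ℕ)
pairsLt n = concatMap (λ i → map (i ,_) (filterᵇ (λ j → i <ᵇ j) (range n))) (range n)

Inv : List ℕ → List (ℕ × ℕ)
Inv σ = filterᵇ (λ { (i , j) → at σ j <ᵇ at σ i }) (pairsLt (length σ))

Sor : List ℕ → List (ℕ × ℕ)
Sor σ = induced (Bcode σ)

-- positions i with σᵢ < σⱼ for all j > i ; we collect the values σᵢ
Rmil : List ℕ → List ℕ
Rmil σ = map (at σ)
  (filterᵇ (λ i → allᵇ (λ j → not (i <ᵇ j) ∨ (at σ i <ᵇ at σ j)) (range (length σ)))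
           (range (length σ)))

Lmap : List ℕ → List ℕ
Lmap σ = filterᵇ (λ i → allᵇ (λ j → not (j <ᵇ i) ∨ (at σ j <ᵇ at σ i)) (range (length σ)))
                 (range (length σ))

Lmil : List ℕ → List ℕ
Lmil σ = map (at σ)
  (filterᵇ (λ i → allᵇ (λ j → not (j <ᵇ i) ∨ (at σ i <ᵇ at σ j)) (range (length σ)))
           (range (length σ)))

iter : List ℕ → ℕ → ℕ → ℕ
iter σ zero    i = i
iter σ (suc k) i = at σ (iter σ k i)

-- smallest elements of the cycles: i such that i ≤ σᵏ(i) for all k = 1 … n
-- (the orbit of i is {σᵏ(i) : 1 ≤ k ≤ n})
Cyc : List ℕ → List ℕ
Cyc σ = filterᵇ (λ i → allᵇ (λ k → i ≤ᵇ iter σ k i) (range (length σ))) (range (length σ))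

Lmic₁ : List ℕ → List ℕ
Lmic₁ σ = O (Bcode σ)

inv rmin lmax lmin cyc lmic₁ : List ℕ → ℕ
inv   σ = length (Inv σ)
rmin  σ = length (Rmil σ)
lmax  σ = length (Lmap σ)
lmin  σ = length (Lmil σ)
cyc   σ = length (Cyc σ)
lmic₁ σ = length (Lmic₁ σ)

-- swap the entries at positions p and m of a one-line word
-- (i.e. σ ↦ σ ∘ (p m))
swapPos : ℕ → ℕ → List ℕ → List ℕ
swapPos p m σ = map (λ k → if k ≡ᵇ p then at σ m else (if k ≡ᵇ m then at σ p else at σ k))
                    (range (length σ))

-- The unique factorisation σ = (i₁ j₁)(i₂ j₂)⋯(iₖ jₖ), j₁ < ⋯ < jₖ, iᵣ < jᵣ.
-- Since all factors but the last fix the largest point m, the last factor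
-- (if jₖ = m) is (σ⁻¹(m) m); then σ ∘ (σ⁻¹(m) m) fixes m and we recurse on m-1.
-- decompGo m σ lists the transpositions (i , j) with j ≤ m (in reverse order).
decompGo : ℕ → List ℕ → List (ℕ × ℕ)
decompGo zero    σ = []
decompGo (suc m) σ =
  let p = pos σ (suc m) in
  if p ≡ᵇ suc m then decompGo m σ
  else (p , suc m) ∷ decompGo m (swapPos p (suc m) σ)

transpositionFactorisation : List ℕ → List (ℕ × ℕ)
transpositionFactorisation σ = reverse (decompGo (length σ) σ)

sor : List ℕ → ℕ
sor σ = foldr (λ { (i , j) acc → (j ∸ i) + acc }) 0 (transpositionFactorisation σ)

_≐_ : {A : Set} → List A → List A → Set
xs ≐ ys = ∀ z → (z ∈ xs) ⇔ (z ∈ ys)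
infix 4 _≐_

count4 : ℕ → (List ℕ → ℕ) → (List ℕ → ℕ) → (List ℕ → ℕ) → (List ℕ → ℕ)
       → ℕ → ℕ → ℕ → ℕ → ℕ
count4 n f₁ f₂ f₃ f₄ a b c d =
  length (filterᵇ (λ σ → (f₁ σ ≡ᵇ a) ∧ (f₂ σ ≡ᵇ b) ∧ (f₃ σ ≡ᵇ c) ∧ (f₄ σ ≡ᵇ d)) (perms n))

-- Generating functions, evaluated at integers q x y

sumℤ : List ℤ → ℤ
sumℤ = foldr ℤ._+_ (ℤ.+ 0)

prodℤ : List ℤ → ℤ
prodℤ = foldr ℤ._*_ (ℤ.+ 1)

_^ℤ_ : ℤ → ℕ → ℤ
z ^ℤ zero  = ℤ.+ 1
z ^ℤ suc k = z ℤ.* (z ^ℤ k)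

qInt : ℤ → ℕ → ℤ
qInt q r = sumℤ (map (q ^ℤ_) (upTo r))

genfun : ℕ → (List ℕ → ℕ) → (List ℕ → ℕ) → (List ℕ → ℕ) → ℤ → ℤ → ℤ → ℤ
genfun n f g h q x y = sumℤ (map (λ σ → (q ^ℤ f σ) ℤ.* ((x ^ℤ g σ) ℤ.* (y ^ℤ h σ))) (perms n))

rhsProduct : ℕ → ℤ → ℤ → ℤ → ℤ
rhsProduct n q x y =
  x ℤ.* (y ℤ.* prodℤ (map (λ r → x ℤ.+ qInt q r ℤ.+ y ℤ.* (q ^ℤ (r ∸ 1)) ℤ.- ℤ.+ 1 ℤ.- (q ^ℤ (r ∸ 1)))
                          (filterᵇ (λ r → 2 ≤ᵇ r) (range n))))

-- Both codes grow one letter at a time. Every σ ∈ 𝔖ₙ₊₁ arises from a unique σ′ ∈ 𝔖ₙ by inserting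
-- the value n + 1 at some position p, and then A(σ) = A(σ′) p; every τ ∈ 𝔖ₙ₊₁ arises from a unique
-- τ′ ∈ 𝔖ₙ by inserting n + 1 after p in the cycle of p, and then B(τ) = B(τ′) p. Under these two
-- insertions each statistic of σ changes exactly like its partner for τ, through the letter p alone:
-- Inv and Sor gain the pairs (p, j) with j > p and relabel the rest by the order embedding that skips p,
-- Rmil and Cyc gain n + 1 iff p = n + 1, Lmap keeps its positions below p and adds p, and Lmil and
-- Lmic₁ gain a point iff p = 1. By induction both quadruples are the same functions of the code, so
-- φ = B⁻¹ ∘ A carries one onto the other. As A and B enumerate the codes, the joint distributions agree,
-- and the weight of a code factors letter by letter, giving the product formula.

module Submission where

open import Defs
open import Algebra.Bundles using (CommutativeMonoid)
open import Data.Bool using (Bool; true; false; T; _∧_; _∨_; not; if_then_else_)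
open import Data.Bool.Properties using (∧-identityʳ; ∧-zeroʳ; ∧-comm; T-≡)
open import Data.Empty using (⊥-elim)
open import Data.Fin using (Fin; toℕ; fromℕ<)
import Data.Fin.Properties as Fin
open import Data.Integer as ℤ using (ℤ)
import Data.Integer.Properties as ℤ
open import Data.Integer.Tactic.RingSolver using (solve-∀)
open import Data.List using (List; []; _∷_; _++_; [_]; map; concat; concatMap; filterᵇ; length; reverse; upTo; foldr; take)
open import Data.List.Properties
open import Data.List.Membership.Propositional using (_∈_)
open import Data.List.Membership.Propositional.Properties
open import Data.List.Relation.Binary.Permutation.Propositional using (_↭_; ↭-refl; ↭-sym; ↭-trans; prep; swap; ↭-reflexive; ↭⇒↭ₛ)
import Data.List.Relation.Binary.Permutation.Propositional.Properties as ↭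
import Data.List.Relation.Binary.Permutation.Setoid.Properties as ↭ₛ
open import Data.List.Relation.Binary.Subset.Propositional using (_⊆_)
open import Data.List.Relation.Unary.All as All using (All)
open import Data.List.Relation.Unary.AllPairs using ([]; _∷_)
open import Data.List.Relation.Unary.Any using (here; there)
open import Data.List.Relation.Unary.Unique.Propositional using (Unique)
import Data.List.Relation.Unary.Unique.Propositional.Properties as Unique
open import Data.Nat using (ℕ; zero; suc; _+_; _∸_; >-nonZero; _≤ᵇ_; _<ᵇ_; _≡ᵇ_; _≤_; _<_; _≥_; z≤n; s≤s)
open import Data.Nat.ListAction using (sum)
open import Data.Nat.ListAction.Properties using (sum-↭)
open import Data.Nat.Properties
open import Data.Product using (Σ-syntax; _×_; _,_; proj₁; proj₂)
open import Data.Product.Properties using (,-injectiveˡ; ,-injectiveʳ)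
open import Data.Sum using (_⊎_; inj₁; inj₂)
open import Function.Base using (_∘_)
open import Function.Bundles using (mk⇔; Equivalence)
open import Relation.Binary.Definitions using (tri<; tri≈; tri>)
open import Relation.Binary.PropositionalEquality hiding ([_])
open import Relation.Nullary using (¬_; yes; no)
open import Relation.Nullary.Decidable using (T?)

¬T⇒≡false : ∀ {b} → ¬ T b → b ≡ false
¬T⇒≡false {false} _  = refl
¬T⇒≡false {true}  ¬T = ⊥-elim (¬T _)

<ᵇ-true : ∀ {m n} → m < n → (m <ᵇ n) ≡ true
<ᵇ-true = Equivalence.to T-≡ ∘ <⇒<ᵇ

<ᵇ-false : ∀ {m n} → n ≤ m → (m <ᵇ n) ≡ false
<ᵇ-false n≤m = ¬T⇒≡false (≤⇒≯ n≤m ∘ <ᵇ⇒< _ _)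

≤ᵇ-true : ∀ {m n} → m ≤ n → (m ≤ᵇ n) ≡ true
≤ᵇ-true = Equivalence.to T-≡ ∘ ≤⇒≤ᵇ

≤ᵇ-false : ∀ {m n} → n < m → (m ≤ᵇ n) ≡ false
≤ᵇ-false n<m = ¬T⇒≡false (<⇒≱ n<m ∘ ≤ᵇ⇒≤ _ _)

≡ᵇ-true : ∀ {m n} → m ≡ n → (m ≡ᵇ n) ≡ true
≡ᵇ-true {m} {n} = Equivalence.to T-≡ ∘ ≡⇒≡ᵇ m n

≡ᵇ-false : ∀ {m n} → m ≢ n → (m ≡ᵇ n) ≡ false
≡ᵇ-false m≢n = ¬T⇒≡false (m≢n ∘ ≡ᵇ⇒≡ _ _)

<ᵇ-true⁻ : ∀ m n → (m <ᵇ n) ≡ true → m < n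
<ᵇ-true⁻ m n = <ᵇ⇒< m n ∘ Equivalence.from T-≡

<ᵇ-false⁻ : ∀ m n → (m <ᵇ n) ≡ false → n ≤ m
<ᵇ-false⁻ m n m≮ᵇn = ≮⇒≥ (λ m<n → subst T m≮ᵇn (<⇒<ᵇ m<n))

≤ᵇ-true⁻ : ∀ m n → (m ≤ᵇ n) ≡ true → m ≤ n
≤ᵇ-true⁻ m n = ≤ᵇ⇒≤ m n ∘ Equivalence.from T-≡

≤ᵇ-false⁻ : ∀ m n → (m ≤ᵇ n) ≡ false → n < m
≤ᵇ-false⁻ m n m≰ᵇn = ≰⇒> (λ m≤n → subst T m≰ᵇn (≤⇒≤ᵇ m≤n))

≡ᵇ-true⁻ : ∀ m n → (m ≡ᵇ n) ≡ true → m ≡ n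
≡ᵇ-true⁻ m n = ≡ᵇ⇒≡ m n ∘ Equivalence.from T-≡

≡ᵇ-false⁻ : ∀ m n → (m ≡ᵇ n) ≡ false → m ≢ n
≡ᵇ-false⁻ m n m≢ᵇn m≡n = subst T m≢ᵇn (≡⇒≡ᵇ m n m≡n)

InRange : ℕ → ℕ → Set
InRange n x = 1 ≤ x × x ≤ n

≤-pred-≢ : ∀ {p n} → p ≤ suc n → p ≢ suc n → p ≤ n
≤-pred-≢ p≤1+n p≢1+n = ≤-pred (≤∧≢⇒< p≤1+n p≢1+n)

range-suc : ∀ n → range (suc n) ≡ range n ++ [ suc n ]
range-suc n = trans (cong (map suc) (sym (upTo-∷ʳ n))) (map-++ suc (upTo n) [ n ])

range-cons : ∀ n → range (suc n) ≡ 1 ∷ map suc (range n)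
range-cons n = cong (λ xs → 1 ∷ map suc xs) (sym (map-upTo suc n))

length-range : ∀ n → length (range n) ≡ n
length-range n = trans (length-map suc (upTo n)) (length-upTo n)

Unique-range : ∀ n → Unique (range n)
Unique-range n = Unique.map⁺ suc-injective (Unique.upTo⁺ n)

∈-range⁺ : ∀ n {x} → InRange n x → x ∈ range n
∈-range⁺ zero    (1≤x , x≤0) with () ← ≤-trans 1≤x x≤0
∈-range⁺ (suc n) (1≤x , x≤1+n) rewrite range-suc n with m≤n⇒m<n∨m≡n x≤1+n
... | inj₁ x<1+n = ∈-++⁺ˡ (∈-range⁺ n (1≤x , ≤-pred x<1+n))
... | inj₂ refl  = ∈-++⁺ʳ (range n) (here refl)

∈-range⁻ : ∀ n {x} → x ∈ range n → InRange n x
∈-range⁻ (suc n) x∈ rewrite range-suc n with ∈-++⁻ (range n) x∈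
... | inj₁ x∈′        = let (1≤x , x≤n) = ∈-range⁻ n x∈′ in 1≤x , m≤n⇒m≤1+n x≤n
... | inj₂ (here refl) = s≤s z≤n , ≤-refl

map-cong-∈ : ∀ {A B : Set} {f g : A → B} (xs : List A) → (∀ {x} → x ∈ xs → f x ≡ g x) → map f xs ≡ map g xs
map-cong-∈ xs f≗g = map-cong-local (All.tabulate f≗g)

cong₃ : ∀ {A B C D : Set} (f : A → B → C → D) {a a′ b b′ c c′} → a ≡ a′ → b ≡ b′ → c ≡ c′ → f a b c ≡ f a′ b′ c′
cong₃ f refl refl refl = refl

map-cong-range : ∀ {A : Set} {f g : ℕ → A} n → (∀ {x} → InRange n x → f x ≡ g x) → map f (range n) ≡ map g (range n)
map-cong-range n f≗g = map-cong-∈ (range n) (f≗g ∘ ∈-range⁻ n)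

at-map-range : ∀ (f : ℕ → ℕ) n {k} → InRange n k → at (map f (range n)) k ≡ f k
at-map-range f zero    (1≤k , k≤0) with () ← ≤-trans 1≤k k≤0
at-map-range f (suc n) {suc zero}    _ = cong (λ xs → at (map f xs) 1) (range-cons n)
at-map-range f (suc n) {suc (suc k)} (_ , s≤s k≤n) = begin
  at (map f (range (suc n))) (2 + k)       ≡⟨ cong (λ xs → at (map f xs) (2 + k)) (range-cons n) ⟩
  at (map f (map suc (range n))) (suc k)   ≡⟨ cong (λ xs → at xs (suc k)) (sym (map-∘ (range n))) ⟩
  at (map (f ∘ suc) (range n)) (suc k)     ≡⟨ at-map-range (f ∘ suc) n (s≤s z≤n , k≤n) ⟩
  f (2 + k)                                ∎
  where open ≡-Reasoning

at-++ˡ : ∀ xs ys {k} → k ≤ length xs → at (xs ++ ys) k ≡ at xs k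
at-++ˡ []       []       {zero}        _       = refl
at-++ˡ []       (y ∷ ys) {zero}        _       = refl
at-++ˡ (x ∷ xs) ys       {zero}        _       = refl
at-++ˡ (x ∷ xs) ys       {suc zero}    _       = refl
at-++ˡ (x ∷ xs) ys       {suc (suc k)} (s≤s p) = at-++ˡ xs ys p

at-++ʳ : ∀ xs ys {k} → 1 ≤ k → at (xs ++ ys) (length xs + k) ≡ at ys k
at-++ʳ []       ys _ = refl
at-++ʳ (x ∷ xs) ys {suc k} _ = begin
  at (x ∷ xs ++ ys) (suc (length xs + suc k))   ≡⟨ cong (at (x ∷ xs ++ ys) ∘ suc) (+-suc (length xs) k) ⟩
  at (xs ++ ys) (suc (length xs + k))           ≡⟨ cong (at (xs ++ ys)) (sym (+-suc (length xs) k)) ⟩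
  at (xs ++ ys) (length xs + suc k)             ≡⟨ at-++ʳ xs ys (s≤s z≤n) ⟩
  at ys (suc k)                                 ∎
  where open ≡-Reasoning

at-∷ʳ : ∀ xs y → at (xs ++ [ y ]) (suc (length xs)) ≡ y
at-∷ʳ []           y = refl
at-∷ʳ (x ∷ [])     y = refl
at-∷ʳ (x ∷ x′ ∷ xs) y = at-∷ʳ (x′ ∷ xs) y

at-∈ : ∀ xs {k} → InRange (length xs) k → at xs k ∈ xs
at-∈ (x ∷ xs) {suc zero}    _             = here refl
at-∈ (x ∷ xs) {suc (suc k)} (_ , s≤s k≤n) = there (at-∈ xs (s≤s z≤n , k≤n))

∈⇒at : ∀ xs {x} → x ∈ xs → Σ[ k ∈ ℕ ] InRange (length xs) k × at xs k ≡ x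
∈⇒at (y ∷ xs) (here refl) = 1 , (s≤s z≤n , s≤s z≤n) , refl
∈⇒at (y ∷ xs) (there x∈) with ∈⇒at xs x∈
... | suc k , (_ , k≤n) , e = suc (suc k) , (s≤s z≤n , s≤s k≤n) , e

at-out : ∀ xs {k} → length xs < k → at xs k ≡ 0
at-out []       _                     = refl
at-out (x ∷ xs) {suc (suc k)} (s≤s p) = at-out xs p

map-at-range : ∀ xs → map (at xs) (range (length xs)) ≡ xs
map-at-range []       = refl
map-at-range (x ∷ xs) = begin
  map (at (x ∷ xs)) (range (suc (length xs)))           ≡⟨ cong (map (at (x ∷ xs))) (range-cons (length xs)) ⟩
  x ∷ map (at (x ∷ xs)) (map suc (range (length xs)))   ≡⟨ cong (x ∷_) (sym (map-∘ (range (length xs)))) ⟩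
  x ∷ map (at (x ∷ xs) ∘ suc) (range (length xs))       ≡⟨ cong (x ∷_) (map-cong-range (length xs) shift) ⟩
  x ∷ map (at xs) (range (length xs))                   ≡⟨ cong (x ∷_) (map-at-range xs) ⟩
  x ∷ xs                                                ∎
  where
  open ≡-Reasoning
  shift : ∀ {k} → InRange (length xs) k → at (x ∷ xs) (suc k) ≡ at xs k
  shift {suc k} _ = refl

at-extensionality : ∀ xs ys → length xs ≡ length ys →
  (∀ {k} → InRange (length xs) k → at xs k ≡ at ys k) → xs ≡ ys
at-extensionality xs ys |xs|≡|ys| xs≗ys = begin
  xs                                ≡⟨ sym (map-at-range xs) ⟩
  map (at xs) (range (length xs))   ≡⟨ map-cong-range (length xs) xs≗ys ⟩
  map (at ys) (range (length xs))   ≡⟨ cong (map (at ys) ∘ range) |xs|≡|ys| ⟩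
  map (at ys) (range (length ys))   ≡⟨ map-at-range ys ⟩
  ys                                ∎
  where open ≡-Reasoning

split-last : ∀ xs n → length xs ≡ suc n → xs ≡ take n xs ++ [ at xs (suc n) ]
split-last (x ∷ [])     zero    _ = refl
split-last (x ∷ y ∷ xs) (suc n) e = cong (x ∷_) (split-last (y ∷ xs) n (suc-injective e))

pos-at : ∀ xs {k} → Unique xs → InRange (length xs) k → pos xs (at xs k) ≡ k
pos-at (x ∷ xs) {suc zero} _ _ rewrite ≡ᵇ-true {x} refl = refl
pos-at (x ∷ xs) {suc (suc k)} (x∉xs ∷ u) (_ , s≤s k≤n)
  rewrite ≡ᵇ-false (All.lookup x∉xs (at-∈ xs (s≤s z≤n , k≤n)))
        | pos-at xs u (s≤s z≤n , k≤n) = refl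

pos-∈ : ∀ xs {v} → Unique xs → v ∈ xs → InRange (length xs) (pos xs v) × at xs (pos xs v) ≡ v
pos-∈ xs u v∈ with ∈⇒at xs v∈
... | k , k∈ , refl rewrite pos-at xs u k∈ = k∈ , refl

length-insert : ∀ {A : Set} (us : List A) x vs → length (us ++ x ∷ vs) ≡ suc (length (us ++ vs))
length-insert []       x vs = refl
length-insert (u ∷ us) x vs = cong suc (length-insert us x vs)

⊆-remove : ∀ {A : Set} {x : A} {xs} us vs → All (x ≢_) xs → (x ∷ xs) ⊆ (us ++ x ∷ vs) → xs ⊆ (us ++ vs)
⊆-remove us vs x∉xs sub {z} z∈xs with ∈-++⁻ us (sub (there z∈xs))
... | inj₁ z∈us         = ∈-++⁺ˡ z∈us
... | inj₂ (here refl)  = ⊥-elim (All.lookup x∉xs z∈xs refl)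
... | inj₂ (there z∈vs) = ∈-++⁺ʳ us z∈vs

⊆⇒length≤ : ∀ {A : Set} (xs ys : List A) → Unique xs → xs ⊆ ys → length xs ≤ length ys
⊆⇒length≤ []       ys _           _  = z≤n
⊆⇒length≤ (x ∷ xs) ys (x∉xs ∷ u) xs⊆ys with ∈-∃++ (xs⊆ys (here refl))
... | us , vs , refl = subst (suc (length xs) ≤_) (sym (length-insert us x vs))
  (s≤s (⊆⇒length≤ xs (us ++ vs) u (⊆-remove us vs x∉xs xs⊆ys)))

⊆∧length≤⇒↭ : ∀ {A : Set} (xs ys : List A) → Unique xs → xs ⊆ ys → length ys ≤ length xs → xs ↭ ys
⊆∧length≤⇒↭ []       []      _ _ _ = ↭-refl
⊆∧length≤⇒↭ (x ∷ xs) ys (x∉xs ∷ u) xs⊆ys |ys|≤ with ∈-∃++ (xs⊆ys (here refl))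
... | us , vs , refl =
  ↭-trans (prep x (⊆∧length≤⇒↭ xs (us ++ vs) u (⊆-remove us vs x∉xs xs⊆ys) |us++vs|≤)) (↭-sym (↭.shift x us vs))
  where
  |us++vs|≤ : length (us ++ vs) ≤ length xs
  |us++vs|≤ = ≤-pred (subst (_≤ suc (length xs)) (length-insert us x vs) |ys|≤)

module _ {A : Set} (p : A → Bool) where

  ∈-filterᵇ⁺ : ∀ {x xs} → x ∈ xs → p x ≡ true → x ∈ filterᵇ p xs
  ∈-filterᵇ⁺ x∈ px = ∈-filter⁺ (T? ∘ p) x∈ (Equivalence.from T-≡ px)

  ∈-filterᵇ⁻ : ∀ {x} xs → x ∈ filterᵇ p xs → x ∈ xs × p x ≡ true
  ∈-filterᵇ⁻ xs x∈ = let (x∈xs , px) = ∈-filter⁻ (T? ∘ p) {xs = xs} x∈ in x∈xs , Equivalence.to T-≡ px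

  filterᵇ-all : ∀ xs → (∀ {x} → x ∈ xs → p x ≡ true) → filterᵇ p xs ≡ xs
  filterᵇ-all xs h = filter-all (T? ∘ p) (All.tabulate (Equivalence.from T-≡ ∘ h))

  filterᵇ-[_] : ∀ x → filterᵇ p [ x ] ≡ (if p x then [ x ] else [])
  filterᵇ-[ x ] with p x
  ... | true  = refl
  ... | false = refl

  allᵇ-++ : ∀ xs ys → allᵇ p (xs ++ ys) ≡ allᵇ p xs ∧ allᵇ p ys
  allᵇ-++ []       ys = refl
  allᵇ-++ (x ∷ xs) ys with p x
  ... | true  = allᵇ-++ xs ys
  ... | false = refl

  allᵇ-true⁻ : ∀ xs → allᵇ p xs ≡ true → ∀ {x} → x ∈ xs → p x ≡ true
  allᵇ-true⁻ (y ∷ xs) all≡ x∈ with p y in py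
  allᵇ-true⁻ (y ∷ xs) all≡ (here refl) | true = py
  allᵇ-true⁻ (y ∷ xs) all≡ (there x∈)  | true = allᵇ-true⁻ xs all≡ x∈

  allᵇ-true : ∀ xs → (∀ {x} → x ∈ xs → p x ≡ true) → allᵇ p xs ≡ true
  allᵇ-true []       h = refl
  allᵇ-true (x ∷ xs) h rewrite h (here refl) = allᵇ-true xs (h ∘ there)

  allᵇ-false : ∀ xs {x} → x ∈ xs → p x ≡ false → allᵇ p xs ≡ false
  allᵇ-false (y ∷ xs) (here refl) px rewrite px = refl
  allᵇ-false (y ∷ xs) (there x∈) px with p y
  ... | true  = allᵇ-false xs x∈ px
  ... | false = refl

module _ {A : Set} {p q : A → Bool} where

  filterᵇ-cong-∈ : ∀ xs → (∀ {x} → x ∈ xs → p x ≡ q x) → filterᵇ p xs ≡ filterᵇ q xs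
  filterᵇ-cong-∈ []       h = refl
  filterᵇ-cong-∈ (x ∷ xs) h with p x | q x | h (here refl)
  ... | true  | true  | _ = cong (x ∷_) (filterᵇ-cong-∈ xs (h ∘ there))
  ... | false | false | _ = filterᵇ-cong-∈ xs (h ∘ there)

  allᵇ-cong-∈ : ∀ xs → (∀ {x} → x ∈ xs → p x ≡ q x) → allᵇ p xs ≡ allᵇ q xs
  allᵇ-cong-∈ []       h = refl
  allᵇ-cong-∈ (x ∷ xs) h = cong₂ _∧_ (h (here refl)) (allᵇ-cong-∈ xs (h ∘ there))

  filterᵇ-filterᵇ : ∀ xs → filterᵇ p (filterᵇ q xs) ≡ filterᵇ (λ x → q x ∧ p x) xs
  filterᵇ-filterᵇ []       = refl
  filterᵇ-filterᵇ (x ∷ xs) with q x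
  ... | false = filterᵇ-filterᵇ xs
  ... | true with p x
  ...   | true  = cong (x ∷_) (filterᵇ-filterᵇ xs)
  ...   | false = filterᵇ-filterᵇ xs

module _ {A B : Set} (p : B → Bool) (f : A → B) where

  filterᵇ-map : ∀ xs → filterᵇ p (map f xs) ≡ map f (filterᵇ (p ∘ f) xs)
  filterᵇ-map []       = refl
  filterᵇ-map (x ∷ xs) with p (f x)
  ... | true  = cong (f x ∷_) (filterᵇ-map xs)
  ... | false = filterᵇ-map xs

  allᵇ-map : ∀ xs → allᵇ p (map f xs) ≡ allᵇ (p ∘ f) xs
  allᵇ-map []       = refl
  allᵇ-map (x ∷ xs) = cong (p (f x) ∧_) (allᵇ-map xs)

filterᵇ-range-upTo : ∀ (p : ℕ → Bool) {n} m → m ≤ n → (∀ {i} → m < i → i ≤ n → p i ≡ false) →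
  filterᵇ p (range n) ≡ filterᵇ p (range m)
filterᵇ-range-upTo p {n} m m≤n h with m≤n⇒m<n∨m≡n m≤n
... | inj₂ refl = refl
filterᵇ-range-upTo p {suc n} m _ h | inj₁ (s≤s m≤n) = begin
  filterᵇ p (range (suc n))                      ≡⟨ cong (filterᵇ p) (range-suc n) ⟩
  filterᵇ p (range n ++ [ suc n ])               ≡⟨ filter-++ (T? ∘ p) (range n) [ suc n ] ⟩
  filterᵇ p (range n) ++ filterᵇ p [ suc n ]     ≡⟨ cong (filterᵇ p (range n) ++_) (filter-reject (T? ∘ p) (subst T (h (s≤s m≤n) ≤-refl))) ⟩
  filterᵇ p (range n) ++ []                      ≡⟨ ++-identityʳ _ ⟩
  filterᵇ p (range n)                            ≡⟨ filterᵇ-range-upTo p m m≤n (λ m<i i≤n → h m<i (m≤n⇒m≤1+n i≤n)) ⟩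
  filterᵇ p (range m)                            ∎
  where open ≡-Reasoning

allᵇ-range-upTo : ∀ (p : ℕ → Bool) {n} m → m ≤ n → (∀ {i} → m < i → i ≤ n → p i ≡ true) →
  allᵇ p (range n) ≡ allᵇ p (range m)
allᵇ-range-upTo p {n} m m≤n h with m≤n⇒m<n∨m≡n m≤n
... | inj₂ refl = refl
allᵇ-range-upTo p {suc n} m _ h | inj₁ (s≤s m≤n) = begin
  allᵇ p (range (suc n))                 ≡⟨ cong (allᵇ p) (range-suc n) ⟩
  allᵇ p (range n ++ [ suc n ])          ≡⟨ allᵇ-++ p (range n) [ suc n ] ⟩
  allᵇ p (range n) ∧ (p (suc n) ∧ true)  ≡⟨ cong (λ b → allᵇ p (range n) ∧ (b ∧ true)) (h (s≤s m≤n) ≤-refl) ⟩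
  allᵇ p (range n) ∧ true                ≡⟨ ∧-identityʳ _ ⟩
  allᵇ p (range n)                       ≡⟨ allᵇ-range-upTo p m m≤n (λ m<i i≤n → h m<i (m≤n⇒m≤1+n i≤n)) ⟩
  allᵇ p (range m)                       ∎
  where open ≡-Reasoning

length-filter-< : ∀ p n → length (filterᵇ (p <ᵇ_) (range n)) ≡ n ∸ p
length-filter-< p zero    = sym (0∸n≡0 p)
length-filter-< p (suc n) = begin
  length (filterᵇ (p <ᵇ_) (range (suc n)))                                  ≡⟨ cong (length ∘ filterᵇ (p <ᵇ_)) (range-suc n) ⟩
  length (filterᵇ (p <ᵇ_) (range n ++ [ suc n ]))                           ≡⟨ cong length (filter-++ (T? ∘ (p <ᵇ_)) (range n) [ suc n ]) ⟩
  length (filterᵇ (p <ᵇ_) (range n) ++ filterᵇ (p <ᵇ_) [ suc n ])           ≡⟨ length-++ (filterᵇ (p <ᵇ_) (range n)) ⟩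
  length (filterᵇ (p <ᵇ_) (range n)) + length (filterᵇ (p <ᵇ_) [ suc n ])   ≡⟨ cong (_+ length (filterᵇ (p <ᵇ_) [ suc n ])) (length-filter-< p n) ⟩
  (n ∸ p) + length (filterᵇ (p <ᵇ_) [ suc n ])                              ≡⟨ last ⟩
  suc n ∸ p                                                                 ∎
  where
  open ≡-Reasoning
  last : (n ∸ p) + length (filterᵇ (p <ᵇ_) [ suc n ]) ≡ suc n ∸ p
  last with p <ᵇ suc n in p<1+n
  ... | true  = trans (+-comm (n ∸ p) 1) (sym (+-∸-assoc 1 (≤-pred (<ᵇ-true⁻ p (suc n) p<1+n))))
  ... | false = let 1+n≤p = <ᵇ-false⁻ p (suc n) p<1+n in
                trans (+-identityʳ _) (trans (m≤n⇒m∸n≡0 (≤-trans (n≤1+n n) 1+n≤p)) (sym (m≤n⇒m∸n≡0 1+n≤p)))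

length-filter-≤ : ∀ v n → v ≤ n → length (filterᵇ (_≤ᵇ v) (range n)) ≡ v
length-filter-≤ v n v≤n = begin
  length (filterᵇ (_≤ᵇ v) (range n))   ≡⟨ cong length (filterᵇ-range-upTo (_≤ᵇ v) v v≤n (λ v<i _ → ≤ᵇ-false v<i)) ⟩
  length (filterᵇ (_≤ᵇ v) (range v))   ≡⟨ cong length (filterᵇ-all (_≤ᵇ v) (range v) (≤ᵇ-true ∘ proj₂ ∘ ∈-range⁻ v)) ⟩
  length (range v)                     ≡⟨ length-range v ⟩
  v                                    ∎
  where open ≡-Reasoning

module _ {A : Set} where

  ≐-refl : ∀ {xs : List A} → xs ≐ xs
  ≐-refl z = mk⇔ (λ z∈ → z∈) (λ z∈ → z∈)

  ≐-reflexive : ∀ {xs ys : List A} → xs ≡ ys → xs ≐ ys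
  ≐-reflexive refl = ≐-refl

  ≐-trans : ∀ {xs ys zs : List A} → xs ≐ ys → ys ≐ zs → xs ≐ zs
  ≐-trans e f z = mk⇔ (Equivalence.to (f z) ∘ Equivalence.to (e z)) (Equivalence.from (e z) ∘ Equivalence.from (f z))

  ≐-++ : ∀ {xs ys us vs : List A} → xs ≐ ys → us ≐ vs → (xs ++ us) ≐ (ys ++ vs)
  ≐-++ {xs} {ys} e f z = mk⇔ (++-mono xs ys (Equivalence.to (e z)) (Equivalence.to (f z)))
                              (++-mono ys xs (Equivalence.from (e z)) (Equivalence.from (f z)))
    where
    ++-mono : ∀ as bs {cs ds} → (z ∈ as → z ∈ bs) → (z ∈ cs → z ∈ ds) → z ∈ as ++ cs → z ∈ bs ++ ds
    ++-mono as bs h k z∈ with ∈-++⁻ as z∈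
    ... | inj₁ z∈as = ∈-++⁺ˡ (h z∈as)
    ... | inj₂ z∈cs = ∈-++⁺ʳ bs (k z∈cs)

  ≐-reverse : ∀ (xs : List A) → reverse xs ≐ xs
  ≐-reverse xs z = mk⇔ (↭.∈-resp-↭ (↭.↭-reverse xs)) (↭.∈-resp-↭ (↭-sym (↭.↭-reverse xs)))

  ≐⇒length≡ : ∀ {xs ys : List A} → Unique xs → Unique ys → xs ≐ ys → length xs ≡ length ys
  ≐⇒length≡ {xs} {ys} u v e =
    ≤-antisym (⊆⇒length≤ xs ys u (Equivalence.to (e _))) (⊆⇒length≤ ys xs v (Equivalence.from (e _)))

≐-map : ∀ {A B : Set} (f : A → B) {xs ys : List A} → xs ≐ ys → map f xs ≐ map f ys
≐-map f {xs} {ys} e z = mk⇔ (map-mono xs ys (Equivalence.to (e _))) (map-mono ys xs (Equivalence.from (e _)))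
  where
  map-mono : ∀ as bs → as ⊆ bs → z ∈ map f as → z ∈ map f bs
  map-mono as bs as⊆bs z∈ with ∈-map⁻ f z∈
  ... | w , w∈ , refl = ∈-map⁺ f (as⊆bs w∈)

Unique-resp-↭ : ∀ {xs ys : List ℕ} → xs ↭ ys → Unique xs → Unique ys
Unique-resp-↭ xs↭ys = ↭ₛ.Unique-resp-↭ (setoid ℕ) (↭⇒↭ₛ xs↭ys)

perm-empty : ∀ {σ} → IsPerm 0 σ → σ ≡ []
perm-empty = ↭.↭-empty-inv

module _ {n : ℕ} {σ : List ℕ} (P : IsPerm n σ) where

  perm-length : length σ ≡ n
  perm-length = trans (↭.↭-length P) (length-range n)

  perm-unique : Unique σ
  perm-unique = Unique-resp-↭ (↭-sym P) (Unique-range n)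

  perm-∈⁻ : ∀ {v} → v ∈ σ → InRange n v
  perm-∈⁻ = ∈-range⁻ n ∘ ↭.∈-resp-↭ P

  perm-∈⁺ : ∀ {v} → InRange n v → v ∈ σ
  perm-∈⁺ = ↭.∈-resp-↭ (↭-sym P) ∘ ∈-range⁺ n

  InRange-length : ∀ {k} → InRange n k → InRange (length σ) k
  InRange-length = subst (λ m → InRange m _) (sym perm-length)

  at-perm : ∀ {k} → InRange n k → InRange n (at σ k)
  at-perm = perm-∈⁻ ∘ at-∈ σ ∘ InRange-length

  pos-at-perm : ∀ {k} → InRange n k → pos σ (at σ k) ≡ k
  pos-at-perm = pos-at σ perm-unique ∘ InRange-length

  at-injective : ∀ {k k′} → InRange n k → InRange n k′ → at σ k ≡ at σ k′ → k ≡ k′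
  at-injective k∈ k′∈ e = trans (sym (pos-at-perm k∈)) (trans (cong (pos σ) e) (pos-at-perm k′∈))

  pos-perm : ∀ {v} → InRange n v → InRange n (pos σ v) × at σ (pos σ v) ≡ v
  pos-perm v∈ with pos-∈ σ perm-unique (perm-∈⁺ v∈)
  ... | k∈ , e = subst (λ m → InRange m _) perm-length k∈ , e

  pos-at≡ : ∀ {k v} → InRange n k → at σ k ≡ v → pos σ v ≡ k
  pos-at≡ k∈ refl = pos-at-perm k∈

  pos-injective : ∀ {v v′} → InRange n v → InRange n v′ → pos σ v ≡ pos σ v′ → v ≡ v′
  pos-injective v∈ v′∈ e = trans (sym (proj₂ (pos-perm v∈))) (trans (cong (at σ) e) (proj₂ (pos-perm v′∈)))

  at<max : ∀ {p k} → InRange n p → at σ p ≡ n → InRange n k → k ≢ p → at σ k < n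
  at<max p∈ σp≡n k∈ k≢p with m≤n⇒m<n∨m≡n (proj₂ (at-perm k∈))
  ... | inj₁ σk<n = σk<n
  ... | inj₂ σk≡n = ⊥-elim (k≢p (at-injective k∈ p∈ (trans σk≡n (sym σp≡n))))

perm-intro : ∀ n σ → length σ ≡ n → (∀ {v} → InRange n v → v ∈ σ) → IsPerm n σ
perm-intro n σ |σ|≡n onto = ↭-sym (⊆∧length≤⇒↭ (range n) σ (Unique-range n) (onto ∘ ∈-range⁻ n)
  (≤-reflexive (trans |σ|≡n (sym (length-range n)))))

iterate : (ℕ → ℕ) → ℕ → ℕ → ℕ
iterate g zero    x = x
iterate g (suc k) x = g (iterate g k x)

iterate-suc : ∀ g k x → iterate g (suc k) x ≡ iterate g k (g x)
iterate-suc g zero    x = refl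
iterate-suc g (suc k) x = cong g (iterate-suc g k x)

iterate-+ : ∀ g a b x → iterate g (a + b) x ≡ iterate g a (iterate g b x)
iterate-+ g zero    b x = refl
iterate-+ g (suc a) b x = cong g (iterate-+ g a b x)

iter≡iterate : ∀ σ k x → iter σ k x ≡ iterate (at σ) k x
iter≡iterate σ zero    x = refl
iter≡iterate σ (suc k) x = cong (at σ) (iter≡iterate σ k x)

record IsInjectionOn (n : ℕ) (g : ℕ → ℕ) : Set where
  field
    closed    : ∀ {x} → InRange n x → InRange n (g x)
    injective : ∀ {x y} → InRange n x → InRange n y → g x ≡ g y → x ≡ y

module _ {n : ℕ} {g : ℕ → ℕ} (G : IsInjectionOn n g) where
  open IsInjectionOn G

  iterate-closed : ∀ k {x} → InRange n x → InRange n (iterate g k x)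
  iterate-closed zero    x∈ = x∈
  iterate-closed (suc k) x∈ = closed (iterate-closed k x∈)

  iterate-cancel : ∀ a c {x} → InRange n x → iterate g a x ≡ iterate g (a + c) x → x ≡ iterate g c x
  iterate-cancel zero    c x∈ e = e
  iterate-cancel (suc a) c x∈ e = iterate-cancel a c x∈ (injective (iterate-closed a x∈) (iterate-closed (a + c) x∈) e)

  -- Pigeonhole on x, g x, …, gⁿ x gives gᵃ x = gᵇ x with a < b ≤ n; injectivity then cancels gᵃ.
  orbit-period : ∀ {x} → InRange n x → Σ[ c ∈ ℕ ] InRange n c × iterate g c x ≡ x
  orbit-period {x} x∈ with Fin.pigeonhole (n<1+n n) code
    where
    code : Fin (suc n) → Fin n
    code j = fromℕ< (InRange⇒pred< (iterate-closed (toℕ j) x∈))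
      where
      InRange⇒pred< : ∀ {u} → InRange n u → u ∸ 1 < n
      InRange⇒pred< {suc u} (_ , u<n) = u<n
  ... | a , b , a<b , code≡ = toℕ b ∸ toℕ a , (m<n⇒0<n∸m a<b , c≤n) , sym (iterate-cancel (toℕ a) _ x∈ gᵃ≡gᵃ⁺ᶜ)
    where
    c≤n : toℕ b ∸ toℕ a ≤ n
    c≤n = ≤-trans (m∸n≤m (toℕ b) (toℕ a)) (≤-pred (Fin.toℕ<n b))
    gᵃ≡gᵇ : iterate g (toℕ a) x ≡ iterate g (toℕ b) x
    gᵃ≡gᵇ = pred-injective ⦃ >-nonZero (proj₁ (iterate-closed (toℕ a) x∈)) ⦄ ⦃ >-nonZero (proj₁ (iterate-closed (toℕ b) x∈)) ⦄
      (trans (sym (Fin.toℕ-fromℕ< _)) (trans (cong toℕ code≡) (Fin.toℕ-fromℕ< _)))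
    gᵃ≡gᵃ⁺ᶜ : iterate g (toℕ a) x ≡ iterate g (toℕ a + (toℕ b ∸ toℕ a)) x
    gᵃ≡gᵃ⁺ᶜ = trans gᵃ≡gᵇ (cong (λ k → iterate g k x) (sym (m+[n∸m]≡n (<⇒≤ a<b))))

module _ {n : ℕ} {σ : List ℕ} (P : IsPerm n σ) where

  at-isInjectionOn : IsInjectionOn n (at σ)
  at-isInjectionOn = record { closed = at-perm P ; injective = at-injective P }

  pos-isInjectionOn : IsInjectionOn n (pos σ)
  pos-isInjectionOn = record { closed = proj₁ ∘ pos-perm P ; injective = pos-injective P }

insertAt : ℕ → ℕ → List ℕ → List ℕ
insertAt x zero          ys       = x ∷ ys
insertAt x (suc zero)    ys       = x ∷ ys
insertAt x (suc (suc p)) []       = x ∷ []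
insertAt x (suc (suc p)) (y ∷ ys) = y ∷ insertAt x (suc p) ys

insertAt-↭ : ∀ x p ys → insertAt x p ys ↭ x ∷ ys
insertAt-↭ x zero          ys       = ↭-refl
insertAt-↭ x (suc zero)    ys       = ↭-refl
insertAt-↭ x (suc (suc p)) []       = ↭-refl
insertAt-↭ x (suc (suc p)) (y ∷ ys) = ↭-trans (prep y (insertAt-↭ x (suc p) ys)) (swap y x ↭-refl)

insertAt-++ : ∀ x us vs → insertAt x (suc (length us)) (us ++ vs) ≡ us ++ x ∷ vs
insertAt-++ x []       vs = refl
insertAt-++ x (u ∷ us) vs = cong (u ∷_) (insertAt-++ x us vs)

insertAll≡map-insertAt : ∀ x ys → insertAll x ys ≡ map (λ p → insertAt x p ys) (range (suc (length ys)))
insertAll≡map-insertAt x []       = refl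
insertAll≡map-insertAt x (y ∷ ys) = sym (begin
  map (insertAt′ (y ∷ ys)) (range (2 + m))                        ≡⟨ cong (map (insertAt′ (y ∷ ys))) (range-cons (suc m)) ⟩
  (x ∷ y ∷ ys) ∷ map (insertAt′ (y ∷ ys)) (map suc (range (suc m))) ≡⟨ cong ((x ∷ y ∷ ys) ∷_) (sym (map-∘ (range (suc m)))) ⟩
  (x ∷ y ∷ ys) ∷ map (insertAt′ (y ∷ ys) ∘ suc) (range (suc m))     ≡⟨ cong ((x ∷ y ∷ ys) ∷_) (map-cong-range (suc m) step) ⟩
  (x ∷ y ∷ ys) ∷ map ((y ∷_) ∘ insertAt′ ys) (range (suc m))        ≡⟨ cong ((x ∷ y ∷ ys) ∷_) (map-∘ (range (suc m))) ⟩
  (x ∷ y ∷ ys) ∷ map (y ∷_) (map (insertAt′ ys) (range (suc m)))    ≡⟨ cong (((x ∷ y ∷ ys) ∷_) ∘ map (y ∷_)) (sym (insertAll≡map-insertAt x ys)) ⟩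
  (x ∷ y ∷ ys) ∷ map (y ∷_) (insertAll x ys)                        ∎)
  where
  open ≡-Reasoning
  m = length ys
  insertAt′ : List ℕ → ℕ → List ℕ
  insertAt′ zs p = insertAt x p zs
  step : ∀ {p} → InRange (suc m) p → insertAt x (suc p) (y ∷ ys) ≡ y ∷ insertAt x p ys
  step {suc p} _ = refl

at-insertAt-< : ∀ x p ys {k} → 1 ≤ k → k < p → p ≤ suc (length ys) → at (insertAt x p ys) k ≡ at ys k
at-insertAt-< x (suc (suc p)) (y ∷ ys) {suc zero}    _ _         _         = refl
at-insertAt-< x (suc (suc p)) (y ∷ ys) {suc (suc k)} _ (s≤s k<p) (s≤s p≤n) = at-insertAt-< x (suc p) ys (s≤s z≤n) k<p p≤n
at-insertAt-< x (suc (suc p)) []       {suc k}       _ _         (s≤s ())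
at-insertAt-< x (suc zero)    ys       {suc k}       _ (s≤s ()) _

at-insertAt-≡ : ∀ x p ys → InRange (suc (length ys)) p → at (insertAt x p ys) p ≡ x
at-insertAt-≡ x (suc zero)    ys       _             = refl
at-insertAt-≡ x (suc (suc p)) (y ∷ ys) (_ , s≤s p≤n) = at-insertAt-≡ x (suc p) ys (s≤s z≤n , p≤n)
at-insertAt-≡ x (suc (suc p)) []       (_ , s≤s ())

at-insertAt-> : ∀ x p ys {k} → 1 ≤ p → p ≤ k → k ≤ length ys → at (insertAt x p ys) (suc k) ≡ at ys k
at-insertAt-> x (suc zero)    ys       {suc k}       _ _         _         = refl
at-insertAt-> x (suc (suc p)) (y ∷ ys) {suc (suc k)} _ (s≤s p≤k) (s≤s k≤n) = at-insertAt-> x (suc p) ys (s≤s z≤n) p≤k k≤n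

punchIn : ℕ → ℕ → ℕ
punchIn p k = if k <ᵇ p then k else suc k

punchIn-< : ∀ {p k} → k < p → punchIn p k ≡ k
punchIn-< k<p rewrite <ᵇ-true k<p = refl

punchIn-≥ : ∀ {p k} → p ≤ k → punchIn p k ≡ suc k
punchIn-≥ p≤k rewrite <ᵇ-false p≤k = refl

punchIn-≢ : ∀ p k → punchIn p k ≢ p
punchIn-≢ p k with k <? p
... | yes k<p = λ e → <⇒≢ k<p (trans (sym (punchIn-< k<p)) e)
... | no  k≮p = λ e → <⇒≢ (s≤s (≮⇒≥ k≮p)) (trans (sym e) (punchIn-≥ (≮⇒≥ k≮p)))

punchIn-mono-< : ∀ p {a b} → a < b → punchIn p a < punchIn p b
punchIn-mono-< p {a} {b} a<b with a <? p | b <? p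
... | yes a<p | yes b<p rewrite punchIn-< a<p | punchIn-< b<p = a<b
... | yes a<p | no  b≮p rewrite punchIn-< a<p | punchIn-≥ (≮⇒≥ b≮p) = m≤n⇒m≤1+n a<b
... | no  a≮p | yes b<p = ⊥-elim (a≮p (<-trans a<b b<p))
... | no  a≮p | no  b≮p rewrite punchIn-≥ (≮⇒≥ a≮p) | punchIn-≥ (≮⇒≥ b≮p) = s≤s a<b

punchIn-mono-≤ : ∀ p {a b} → a ≤ b → punchIn p a ≤ punchIn p b
punchIn-mono-≤ p a≤b with m≤n⇒m<n∨m≡n a≤b
... | inj₁ a<b  = <⇒≤ (punchIn-mono-< p a<b)
... | inj₂ refl = ≤-refl

punchIn-injective : ∀ p {a b} → punchIn p a ≡ punchIn p b → a ≡ b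
punchIn-injective p {a} {b} e with <-cmp a b
... | tri< a<b _ _ = ⊥-elim (<⇒≢ (punchIn-mono-< p a<b) e)
... | tri≈ _ a≡b _ = a≡b
... | tri> _ _ b<a = ⊥-elim (<⇒≢ (punchIn-mono-< p b<a) (sym e))

punchIn-<ᵇ : ∀ p a b → (punchIn p a <ᵇ punchIn p b) ≡ (a <ᵇ b)
punchIn-<ᵇ p a b with a <? b
... | yes a<b = trans (<ᵇ-true (punchIn-mono-< p a<b)) (sym (<ᵇ-true a<b))
... | no  a≮b = trans (<ᵇ-false (punchIn-mono-≤ p (≮⇒≥ a≮b))) (sym (<ᵇ-false (≮⇒≥ a≮b)))

punchIn-≤ᵇ : ∀ p a b → (punchIn p a ≤ᵇ punchIn p b) ≡ (a ≤ᵇ b)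
punchIn-≤ᵇ p a b with a ≤? b
... | yes a≤b = trans (≤ᵇ-true (punchIn-mono-≤ p a≤b)) (sym (≤ᵇ-true a≤b))
... | no  a≰b = trans (≤ᵇ-false (punchIn-mono-< p (≰⇒> a≰b))) (sym (≤ᵇ-false (≰⇒> a≰b)))

punchIn-≡ᵇ : ∀ p a b → (punchIn p a ≡ᵇ punchIn p b) ≡ (a ≡ᵇ b)
punchIn-≡ᵇ p a b with a ≟ b
... | yes refl = trans (≡ᵇ-true {punchIn p a} refl) (sym (≡ᵇ-true {a} refl))
... | no  a≢b  = trans (≡ᵇ-false (a≢b ∘ punchIn-injective p)) (sym (≡ᵇ-false a≢b))

punchIn-InRange : ∀ n p {k} → InRange n k → InRange (suc n) (punchIn p k)
punchIn-InRange n p {k} (1≤k , k≤n) with k <? p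
... | yes k<p rewrite punchIn-< k<p = 1≤k , m≤n⇒m≤1+n k≤n
... | no  k≮p rewrite punchIn-≥ (≮⇒≥ k≮p) = s≤s z≤n , s≤s k≤n

punchIn-onto : ∀ n {p k} → InRange (suc n) p → InRange (suc n) k → k ≢ p → Σ[ k′ ∈ ℕ ] InRange n k′ × punchIn p k′ ≡ k
punchIn-onto n {p} {k} (1≤p , p≤1+n) (1≤k , k≤1+n) k≢p with k <? p
... | yes k<p = k , (1≤k , ≤-pred (≤-trans k<p p≤1+n)) , punchIn-< k<p
punchIn-onto n {p} {suc k} (1≤p , _) (_ , s≤s k≤n) k≢p | no k≮p =
  k , (≤-trans 1≤p p≤k , k≤n) , punchIn-≥ p≤k
  where
  p≤k : p ≤ k
  p≤k = ≤-pred (≤∧≢⇒< (≮⇒≥ k≮p) (k≢p ∘ sym))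

at-insertAt-punchIn : ∀ x p ys {k} → InRange (suc (length ys)) p → InRange (length ys) k →
  at (insertAt x p ys) (punchIn p k) ≡ at ys k
at-insertAt-punchIn x p ys {k} (1≤p , p≤) (1≤k , k≤) with k <? p
... | yes k<p rewrite punchIn-< k<p = at-insertAt-< x p ys 1≤k k<p p≤
... | no  k≮p rewrite punchIn-≥ (≮⇒≥ k≮p) = at-insertAt-> x p ys 1≤p (≮⇒≥ k≮p) k≤

insertAt-perm : ∀ n σ′ p → IsPerm n σ′ → IsPerm (suc n) (insertAt (suc n) p σ′)
insertAt-perm n σ′ p P′ = ↭-trans (insertAt-↭ (suc n) p σ′) (↭-trans (prep (suc n) P′)
  (↭-trans (↭.∷↭∷ʳ (suc n) (range n)) (↭-reflexive (sym (range-suc n)))))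

insertAt-decomposition : ∀ n σ → IsPerm (suc n) σ →
  Σ[ p ∈ ℕ ] Σ[ σ′ ∈ List ℕ ] InRange (suc n) p × IsPerm n σ′ × σ ≡ insertAt (suc n) p σ′
insertAt-decomposition n σ P with ∈-∃++ (perm-∈⁺ P (s≤s z≤n , ≤-refl))
... | us , vs , refl = suc (length us) , us ++ vs , (s≤s z≤n , p≤1+n) , P′ , sym (insertAt-++ (suc n) us vs)
  where
  p≤1+n : suc (length us) ≤ suc n
  p≤1+n = begin
    suc (length us)          ≤⟨ s≤s (m≤m+n (length us) (length vs)) ⟩
    suc (length us + length vs) ≡⟨ sym (+-suc (length us) (length vs)) ⟩
    length us + length (suc n ∷ vs) ≡⟨ sym (length-++ us) ⟩
    length (us ++ suc n ∷ vs) ≡⟨ perm-length P ⟩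
    suc n                    ∎
    where open ≤-Reasoning
  P′ : IsPerm n (us ++ vs)
  P′ = ↭.drop-∷ (↭-trans (↭-trans (↭-sym (↭.shift (suc n) us vs)) P)
         (↭-trans (↭-reflexive (range-suc n)) (↭-sym (↭.∷↭∷ʳ (suc n) (range n)))))

lehmerEntry : List ℕ → ℕ → ℕ
lehmerEntry ρ i = length (filterᵇ (λ j → at ρ j ≤ᵇ at ρ i) (range i))

length-∷ʳ : ∀ {A : Set} (xs : List A) x → length (xs ++ [ x ]) ≡ suc (length xs)
length-∷ʳ xs x = trans (length-++ xs) (+-comm (length xs) 1)

Leh-∷ʳ : ∀ xs y → Leh (xs ++ [ y ]) ≡ Leh xs ++ [ lehmerEntry (xs ++ [ y ]) (suc (length xs)) ]
Leh-∷ʳ xs y = begin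
  map (lehmerEntry ρ) (range (length ρ))                           ≡⟨ cong (map (lehmerEntry ρ) ∘ range) (length-∷ʳ xs y) ⟩
  map (lehmerEntry ρ) (range (suc L))                              ≡⟨ cong (map (lehmerEntry ρ)) (range-suc L) ⟩
  map (lehmerEntry ρ) (range L ++ [ suc L ])                       ≡⟨ map-++ (lehmerEntry ρ) (range L) _ ⟩
  map (lehmerEntry ρ) (range L) ++ [ lehmerEntry ρ (suc L) ]       ≡⟨ cong (_++ [ lehmerEntry ρ (suc L) ]) (map-cong-range L prefix) ⟩
  map (lehmerEntry xs) (range L) ++ [ lehmerEntry ρ (suc L) ]      ∎
  where
  open ≡-Reasoning
  ρ = xs ++ [ y ]
  L = length xs
  prefix : ∀ {i} → InRange L i → lehmerEntry ρ i ≡ lehmerEntry xs i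
  prefix (_ , i≤L) = cong length (filterᵇ-cong-∈ (range _) (λ j∈ →
    cong₂ _≤ᵇ_ (at-++ˡ xs [ y ] (≤-trans (proj₂ (∈-range⁻ _ j∈)) i≤L)) (at-++ˡ xs [ y ] i≤L)))

at-map : ∀ (f : ℕ → ℕ) → f 0 ≡ 0 → ∀ xs k → at (map f xs) k ≡ f (at xs k)
at-map f f0≡0 []       k             = sym f0≡0
at-map f f0≡0 (x ∷ xs) zero          = sym f0≡0
at-map f f0≡0 (x ∷ xs) (suc zero)    = refl
at-map f f0≡0 (x ∷ xs) (suc (suc k)) = at-map f f0≡0 xs (suc k)

Leh-map-monotone : ∀ (f : ℕ → ℕ) xs → f 0 ≡ 0 → (∀ a b → (f a ≤ᵇ f b) ≡ (a ≤ᵇ b)) → Leh (map f xs) ≡ Leh xs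
Leh-map-monotone f xs f0≡0 f-≤ᵇ = trans (cong (λ L → map (lehmerEntry (map f xs)) (range L)) (length-map f xs))
  (map-cong-range (length xs) (λ {i} _ → cong length (filterᵇ-cong-∈ (range i)
    (λ {j} _ → trans (cong₂ _≤ᵇ_ (at-map f f0≡0 xs j) (at-map f f0≡0 xs i)) (f-≤ᵇ (at xs j) (at xs i))))))

length-inverse : ∀ σ → length (inverse σ) ≡ length σ
length-inverse σ = trans (length-map (pos σ) (range (length σ))) (length-range _)

at-inverse : ∀ {n σ} → IsPerm n σ → ∀ {k} → InRange n k → at (inverse σ) k ≡ pos σ k
at-inverse {σ = σ} P k∈ = at-map-range (pos σ) (length σ) (InRange-length P k∈)

inverse-perm : ∀ {n σ} → IsPerm n σ → IsPerm n (inverse σ)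
inverse-perm {n} {σ} P = perm-intro n (inverse σ) (trans (length-inverse σ) (perm-length P)) onto
  where
  onto : ∀ {v} → InRange n v → v ∈ inverse σ
  onto {v} v∈ = subst (_∈ inverse σ) (trans (at-inverse P (at-perm P v∈)) (pos-at-perm P v∈))
    (at-∈ (inverse σ) (subst (λ m → InRange m _) (sym (trans (length-inverse σ) (perm-length P))) (at-perm P v∈)))

length-Acode : ∀ {n σ} → IsPerm n σ → length (Acode σ) ≡ n
length-Acode {σ = σ} P = trans (length-map _ (range (length (inverse σ)))) (trans (length-range _) (perm-length (inverse-perm P)))

count-≤ : ∀ {n ρ} v → IsPerm n ρ → v ≤ n → length (filterᵇ (λ j → at ρ j ≤ᵇ v) (range n)) ≡ v
count-≤ {n} {ρ} v P v≤n = begin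
  length (filterᵇ ((_≤ᵇ v) ∘ at ρ) (range n))                   ≡⟨ sym (length-map (at ρ) (filterᵇ ((_≤ᵇ v) ∘ at ρ) (range n))) ⟩
  length (map (at ρ) (filterᵇ ((_≤ᵇ v) ∘ at ρ) (range n)))      ≡⟨ cong length (sym (filterᵇ-map (_≤ᵇ v) (at ρ) (range n))) ⟩
  length (filterᵇ (_≤ᵇ v) (map (at ρ) (range n)))               ≡⟨ cong (λ L → length (filterᵇ (_≤ᵇ v) (map (at ρ) (range L)))) (sym (perm-length P)) ⟩
  length (filterᵇ (_≤ᵇ v) (map (at ρ) (range (length ρ))))      ≡⟨ cong (length ∘ filterᵇ (_≤ᵇ v)) (map-at-range ρ) ⟩
  length (filterᵇ (_≤ᵇ v) ρ)                                    ≡⟨ ↭.↭-length (↭.filter-↭ (T? ∘ (_≤ᵇ v)) P) ⟩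
  length (filterᵇ (_≤ᵇ v) (range n))                            ≡⟨ length-filter-≤ v n v≤n ⟩
  v                                                             ∎
  where open ≡-Reasoning

module ValueInsertion {n : ℕ} {σ′ : List ℕ} (P′ : IsPerm n σ′) {p : ℕ} (p∈ : InRange (suc n) p) where

  N = suc n
  σ = insertAt N p σ′

  Pσ : IsPerm N σ
  Pσ = insertAt-perm n σ′ p P′

  p∈′ : InRange (suc (length σ′)) p
  p∈′ = subst (λ m → InRange (suc m) p) (sym (perm-length P′)) p∈

  σp≡N : at σ p ≡ N
  σp≡N = at-insertAt-≡ N p σ′ p∈′

  σk≡σ′k : ∀ {k} → 1 ≤ k → k < p → at σ k ≡ at σ′ k
  σk≡σ′k 1≤k k<p = at-insertAt-< N p σ′ 1≤k k<p (proj₂ p∈′)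

  σ∘punchIn≡σ′ : ∀ {k} → InRange n k → at σ (punchIn p k) ≡ at σ′ k
  σ∘punchIn≡σ′ k∈ = at-insertAt-punchIn N p σ′ p∈′ (InRange-length P′ k∈)

  σ⁻¹N≡p : pos σ N ≡ p
  σ⁻¹N≡p = pos-at≡ Pσ p∈ σp≡N

  σ⁻¹≡punchIn∘σ′⁻¹ : ∀ {v} → InRange n v → pos σ v ≡ punchIn p (pos σ′ v)
  σ⁻¹≡punchIn∘σ′⁻¹ v∈ with pos-perm P′ v∈
  ... | k∈ , σ′k≡v = pos-at≡ Pσ (punchIn-InRange n p k∈) (trans (σ∘punchIn≡σ′ k∈) σ′k≡v)

  inverse-insertAt : inverse σ ≡ map (punchIn p) (inverse σ′) ++ [ p ]
  inverse-insertAt = begin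
    map (pos σ) (range (length σ))                       ≡⟨ cong (map (pos σ) ∘ range) (perm-length Pσ) ⟩
    map (pos σ) (range N)                                ≡⟨ cong (map (pos σ)) (range-suc n) ⟩
    map (pos σ) (range n ++ [ N ])                       ≡⟨ map-++ (pos σ) (range n) [ N ] ⟩
    map (pos σ) (range n) ++ [ pos σ N ]                 ≡⟨ cong₂ (λ xs v → xs ++ [ v ]) (map-cong-range n σ⁻¹≡punchIn∘σ′⁻¹) σ⁻¹N≡p ⟩
    map (punchIn p ∘ pos σ′) (range n) ++ [ p ]          ≡⟨ cong (_++ [ p ]) (map-∘ (range n)) ⟩
    map (punchIn p) (map (pos σ′) (range n)) ++ [ p ]    ≡⟨ cong (λ L → map (punchIn p) (map (pos σ′) (range L)) ++ [ p ]) (sym (perm-length P′)) ⟩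
    map (punchIn p) (inverse σ′) ++ [ p ]                ∎
    where open ≡-Reasoning

  -- The last Lehmer entry of σ⁻¹ counts the positions j ≤ N with σ⁻¹(j) ≤ p, which is p.
  Acode-insertAt : Acode σ ≡ Acode σ′ ++ [ p ]
  Acode-insertAt = begin
    Leh (inverse σ)                                                        ≡⟨ cong Leh inverse-insertAt ⟩
    Leh (xs ++ [ p ])                                                      ≡⟨ Leh-∷ʳ xs p ⟩
    Leh xs ++ [ lehmerEntry (xs ++ [ p ]) (suc (length xs)) ]              ≡⟨ cong₂ (λ c ℓ → c ++ [ ℓ ]) relabel last ⟩
    Leh (inverse σ′) ++ [ p ]                                              ∎
    where
    open ≡-Reasoning
    xs = map (punchIn p) (inverse σ′)
    relabel : Leh xs ≡ Leh (inverse σ′)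
    relabel = Leh-map-monotone (punchIn p) (inverse σ′) (punchIn-< (proj₁ p∈)) (punchIn-≤ᵇ p)
    |xs|≡n : length xs ≡ n
    |xs|≡n = trans (length-map (punchIn p) (inverse σ′)) (trans (length-inverse σ′) (perm-length P′))
    last : lehmerEntry (xs ++ [ p ]) (suc (length xs)) ≡ p
    last = begin
      lehmerEntry (xs ++ [ p ]) (suc (length xs))                  ≡⟨ cong₂ lehmerEntry (sym inverse-insertAt) (cong suc |xs|≡n) ⟩
      lehmerEntry (inverse σ) N                                    ≡⟨ cong (λ v → length (filterᵇ (λ j → at (inverse σ) j ≤ᵇ v) (range N))) (trans (at-inverse Pσ (s≤s z≤n , ≤-refl)) σ⁻¹N≡p) ⟩
      length (filterᵇ (λ j → at (inverse σ) j ≤ᵇ p) (range N))     ≡⟨ count-≤ p (inverse-perm Pσ) (proj₂ p∈) ⟩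
      p                                                            ∎

map-filterᵇ-∷ : ∀ {A B : Set} (f : A → B) (F : A → Bool) y ys →
  map f (filterᵇ F (y ∷ ys)) ≡ (if F y then [ f y ] else []) ++ map f (filterᵇ F ys)
map-filterᵇ-∷ f F y ys with F y
... | true  = refl
... | false = refl

select : List ℕ → (ℕ → Bool) → List ℕ
select s F = map (at s) (filterᵇ F (range (length s)))

allᵇ-range-suc : ∀ (h : ℕ → Bool) L → allᵇ h (range (suc L)) ≡ h 1 ∧ allᵇ (h ∘ suc) (range L)
allᵇ-range-suc h L = trans (cong (allᵇ h) (range-cons L)) (cong (h 1 ∧_) (allᵇ-map h suc (range L)))

filterᵇ-range-∷ʳ : ∀ {F G : ℕ → Bool} L → (∀ {i} → InRange L i → F i ≡ G i) →
  filterᵇ F (range (suc L)) ≡ filterᵇ G (range L) ++ (if F (suc L) then [ suc L ] else [])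
filterᵇ-range-∷ʳ {F} {G} L F≗G = begin
  filterᵇ F (range (suc L))                     ≡⟨ cong (filterᵇ F) (range-suc L) ⟩
  filterᵇ F (range L ++ [ suc L ])              ≡⟨ filter-++ (T? ∘ F) (range L) [ suc L ] ⟩
  filterᵇ F (range L) ++ filterᵇ F [ suc L ]    ≡⟨ cong₂ _++_ (filterᵇ-cong-∈ (range L) (F≗G ∘ ∈-range⁻ L)) (filterᵇ-[_] F (suc L)) ⟩
  filterᵇ G (range L) ++ (if F (suc L) then [ suc L ] else []) ∎
  where open ≡-Reasoning

select-∷ : ∀ x xs {F G : ℕ → Bool} → (∀ {i} → InRange (length xs) i → F (suc i) ≡ G i) →
  select (x ∷ xs) F ≡ (if F 1 then [ x ] else []) ++ select xs G
select-∷ x xs {F} {G} F∘suc≗G = begin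
  map (at (x ∷ xs)) (filterᵇ F (range (suc L)))                                  ≡⟨ cong (map (at (x ∷ xs)) ∘ filterᵇ F) (range-cons L) ⟩
  map (at (x ∷ xs)) (filterᵇ F (1 ∷ map suc (range L)))                          ≡⟨ map-filterᵇ-∷ (at (x ∷ xs)) F 1 _ ⟩
  (if F 1 then [ x ] else []) ++ map (at (x ∷ xs)) (filterᵇ F (map suc (range L))) ≡⟨ cong ((if F 1 then [ x ] else []) ++_) tail ⟩
  (if F 1 then [ x ] else []) ++ select xs G                                       ∎
  where
  open ≡-Reasoning
  L = length xs
  shift : ∀ {i} → i ∈ filterᵇ (F ∘ suc) (range L) → at (x ∷ xs) (suc i) ≡ at xs i
  shift {i} i∈ with ∈-range⁻ L (proj₁ (∈-filterᵇ⁻ (F ∘ suc) (range L) i∈))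
  shift {suc i} _ | _ = refl
  tail : map (at (x ∷ xs)) (filterᵇ F (map suc (range L))) ≡ select xs G
  tail = begin
    map (at (x ∷ xs)) (filterᵇ F (map suc (range L)))          ≡⟨ cong (map (at (x ∷ xs))) (filterᵇ-map F suc (range L)) ⟩
    map (at (x ∷ xs)) (map suc (filterᵇ (F ∘ suc) (range L)))  ≡⟨ sym (map-∘ (filterᵇ (F ∘ suc) (range L))) ⟩
    map (at (x ∷ xs) ∘ suc) (filterᵇ (F ∘ suc) (range L))      ≡⟨ map-cong-∈ (filterᵇ (F ∘ suc) (range L)) shift ⟩
    map (at xs) (filterᵇ (F ∘ suc) (range L))                  ≡⟨ cong (map (at xs)) (filterᵇ-cong-∈ (range L) (F∘suc≗G ∘ ∈-range⁻ L)) ⟩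
    map (at xs) (filterᵇ G (range L))                          ∎

-- With these, Rmil s = select s (RminPos s), Lmil s = select s (LminPos s) and
-- Lmap s = filterᵇ (LmaxPos s) (range (length s)) hold by definition.
RminTest LminTest LmaxTest : List ℕ → ℕ → ℕ → Bool
RminTest s i j = not (i <ᵇ j) ∨ (at s i <ᵇ at s j)
LminTest s i j = not (j <ᵇ i) ∨ (at s i <ᵇ at s j)
LmaxTest s i j = not (j <ᵇ i) ∨ (at s j <ᵇ at s i)

RminPos LminPos LmaxPos : List ℕ → ℕ → Bool
RminPos s i = allᵇ (RminTest s i) (range (length s))
LminPos s i = allᵇ (LminTest s i) (range (length s))
LmaxPos s i = allᵇ (LmaxTest s i) (range (length s))

Rmil-∷ : ∀ x xs → Rmil (x ∷ xs) ≡ (if allᵇ (x <ᵇ_) xs then [ x ] else []) ++ Rmil xs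
Rmil-∷ x xs = trans (select-∷ x xs {RminPos (x ∷ xs)} later) (cong (λ b → (if b then [ x ] else []) ++ Rmil xs) first)
  where
  L = length xs
  first : RminPos (x ∷ xs) 1 ≡ allᵇ (x <ᵇ_) xs
  first = begin
    RminPos (x ∷ xs) 1                                   ≡⟨ allᵇ-range-suc (RminTest (x ∷ xs) 1) L ⟩
    allᵇ (λ j → not (1 <ᵇ suc j) ∨ (x <ᵇ at (x ∷ xs) (suc j))) (range L)
                                                         ≡⟨ allᵇ-cong-∈ (range L) (λ j∈ → pointwise (∈-range⁻ L j∈)) ⟩
    allᵇ ((x <ᵇ_) ∘ at xs) (range L)                     ≡⟨ sym (allᵇ-map (x <ᵇ_) (at xs) (range L)) ⟩
    allᵇ (x <ᵇ_) (map (at xs) (range L))                 ≡⟨ cong (allᵇ (x <ᵇ_)) (map-at-range xs) ⟩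
    allᵇ (x <ᵇ_) xs                                      ∎
    where
    open ≡-Reasoning
    pointwise : ∀ {j} → InRange L j → (not (1 <ᵇ suc j) ∨ (x <ᵇ at (x ∷ xs) (suc j))) ≡ (x <ᵇ at xs j)
    pointwise {suc j} _ = refl
  later : ∀ {i} → InRange L i → RminPos (x ∷ xs) (suc i) ≡ RminPos xs i
  later {suc i} _ = trans (allᵇ-range-suc (RminTest (x ∷ xs) (2 + i)) L) (allᵇ-cong-∈ (range L) (λ j∈ → pointwise (∈-range⁻ L j∈)))
    where
    pointwise : ∀ {j} → InRange L j →
      (not (suc (suc i) <ᵇ suc j) ∨ (at xs (suc i) <ᵇ at (x ∷ xs) (suc j))) ≡ (not (suc i <ᵇ j) ∨ (at xs (suc i) <ᵇ at xs j))
    pointwise {suc j} _ = refl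

Lmil-∷ : ∀ x xs → Lmil (x ∷ xs) ≡ x ∷ filterᵇ (_<ᵇ x) (Lmil xs)
Lmil-∷ x xs = begin
  Lmil (x ∷ xs)                                                   ≡⟨ select-∷ x xs {LminPos (x ∷ xs)} later ⟩
  (if LminPos (x ∷ xs) 1 then [ x ] else []) ++ select xs smaller  ≡⟨ cong (λ b → (if b then [ x ] else []) ++ select xs smaller) first ⟩
  x ∷ map (at xs) (filterᵇ smaller (range L))                      ≡⟨ cong ((x ∷_) ∘ map (at xs)) (sym (filterᵇ-filterᵇ (range L))) ⟩
  x ∷ map (at xs) (filterᵇ ((_<ᵇ x) ∘ at xs) (filterᵇ (LminPos xs) (range L)))
                                                                   ≡⟨ cong (x ∷_) (sym (filterᵇ-map (_<ᵇ x) (at xs) (filterᵇ (LminPos xs) (range L)))) ⟩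
  x ∷ filterᵇ (_<ᵇ x) (Lmil xs)                                    ∎
  where
  open ≡-Reasoning
  L = length xs
  smaller : ℕ → Bool
  smaller i = LminPos xs i ∧ (at xs i <ᵇ x)
  first : LminPos (x ∷ xs) 1 ≡ true
  first = allᵇ-true _ (range (suc L)) (λ j∈ → pointwise (∈-range⁻ (suc L) j∈))
    where
    pointwise : ∀ {j} → InRange (suc L) j → (not (j <ᵇ 1) ∨ (x <ᵇ at (x ∷ xs) j)) ≡ true
    pointwise {suc j} _ = refl
  later : ∀ {i} → InRange L i → LminPos (x ∷ xs) (suc i) ≡ smaller i
  later {suc i} _ = begin
    LminPos (x ∷ xs) (2 + i)
      ≡⟨ allᵇ-range-suc (LminTest (x ∷ xs) (2 + i)) L ⟩
    (at xs (suc i) <ᵇ x) ∧ allᵇ (LminTest (x ∷ xs) (2 + i) ∘ suc) (range L)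
      ≡⟨ cong ((at xs (suc i) <ᵇ x) ∧_) (allᵇ-cong-∈ (range L) (λ j∈ → pointwise (∈-range⁻ L j∈))) ⟩
    (at xs (suc i) <ᵇ x) ∧ LminPos xs (suc i)
      ≡⟨ ∧-comm (at xs (suc i) <ᵇ x) _ ⟩
    smaller (suc i) ∎
    where
    pointwise : ∀ {j} → InRange L j →
      (not (suc j <ᵇ 2 + i) ∨ (at xs (suc i) <ᵇ at (x ∷ xs) (suc j))) ≡ (not (j <ᵇ suc i) ∨ (at xs (suc i) <ᵇ at xs j))
    pointwise {suc j} _ = refl

positions-∷ʳ : ∀ (t : ℕ → ℕ → Bool) c p →
  filterᵇ (λ i → t i (at (c ++ [ p ]) i)) (range (length (c ++ [ p ])))
    ≡ filterᵇ (λ i → t i (at c i)) (range (length c)) ++ (if t (suc (length c)) p then [ suc (length c) ] else [])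
positions-∷ʳ t c p = begin
  filterᵇ (test (c ++ [ p ])) (range (length (c ++ [ p ])))        ≡⟨ cong (filterᵇ (test (c ++ [ p ])) ∘ range) (length-∷ʳ c p) ⟩
  filterᵇ (test (c ++ [ p ])) (range (suc (length c)))             ≡⟨ filterᵇ-range-∷ʳ (length c) (λ i∈ → cong (t _) (at-++ˡ c [ p ] (proj₂ i∈))) ⟩
  filterᵇ (test c) (range (length c)) ++ (if test (c ++ [ p ]) (suc (length c)) then _ else [])
                                                                   ≡⟨ cong (λ v → filterᵇ (test c) (range (length c)) ++ (if t (suc (length c)) v then [ suc (length c) ] else [])) (at-∷ʳ c p) ⟩
  filterᵇ (test c) (range (length c)) ++ (if t (suc (length c)) p then [ suc (length c) ] else []) ∎
  where
  open ≡-Reasoning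
  test : List ℕ → ℕ → Bool
  test c i = t i (at c i)

Fix : List ℕ → List ℕ
Fix c = filterᵇ (λ i → at c i ≡ᵇ i) (range (length c))

Fix-∷ʳ : ∀ c p → Fix (c ++ [ p ]) ≡ Fix c ++ (if p ≡ᵇ suc (length c) then [ suc (length c) ] else [])
Fix-∷ʳ = positions-∷ʳ (λ i v → v ≡ᵇ i)

O-∷ʳ : ∀ c p → O (c ++ [ p ]) ≡ O c ++ (if p ≡ᵇ 1 then [ suc (length c) ] else [])
O-∷ʳ = positions-∷ʳ (λ _ v → v ≡ᵇ 1)

Rmil-∷ʳ : ∀ c p → Rmil (c ++ [ p ]) ≡ filterᵇ (_<ᵇ p) (Rmil c) ++ [ p ]
Rmil-∷ʳ []      p = refl
Rmil-∷ʳ (x ∷ c) p = begin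
  Rmil (x ∷ (c ++ [ p ]))                                          ≡⟨ Rmil-∷ x (c ++ [ p ]) ⟩
  [x]? (c ++ [ p ]) ++ Rmil (c ++ [ p ])                           ≡⟨ cong₂ _++_ head (Rmil-∷ʳ c p) ⟩
  filterᵇ (_<ᵇ p) ([x]? c) ++ (filterᵇ (_<ᵇ p) (Rmil c) ++ [ p ])  ≡⟨ sym (++-assoc (filterᵇ (_<ᵇ p) ([x]? c)) _ _) ⟩
  (filterᵇ (_<ᵇ p) ([x]? c) ++ filterᵇ (_<ᵇ p) (Rmil c)) ++ [ p ]  ≡⟨ cong (_++ [ p ]) (sym (filter-++ (T? ∘ (_<ᵇ p)) ([x]? c) (Rmil c))) ⟩
  filterᵇ (_<ᵇ p) ([x]? c ++ Rmil c) ++ [ p ]                      ≡⟨ cong (λ w → filterᵇ (_<ᵇ p) w ++ [ p ]) (sym (Rmil-∷ x c)) ⟩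
  filterᵇ (_<ᵇ p) (Rmil (x ∷ c)) ++ [ p ]                          ∎
  where
  open ≡-Reasoning
  [x]? : List ℕ → List ℕ
  [x]? w = if allᵇ (x <ᵇ_) w then [ x ] else []
  head : [x]? (c ++ [ p ]) ≡ filterᵇ (_<ᵇ p) ([x]? c)
  head rewrite allᵇ-++ (x <ᵇ_) c [ p ] with allᵇ (x <ᵇ_) c
  ... | true  = trans (cong (λ b → if b then [ x ] else []) (∧-identityʳ (x <ᵇ p))) (sym (filterᵇ-[_] (_<ᵇ p) x))
  ... | false = refl

allᵇ-insertAt : ∀ (q : ℕ → Bool) x p ys → allᵇ q (insertAt x p ys) ≡ q x ∧ allᵇ q ys
allᵇ-insertAt q x zero          ys       = refl
allᵇ-insertAt q x (suc zero)    ys       = refl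
allᵇ-insertAt q x (suc (suc p)) []       = refl
allᵇ-insertAt q x (suc (suc p)) (y ∷ ys) rewrite allᵇ-insertAt q x (suc p) ys with q x | q y
... | true  | _     = refl
... | false | true  = refl
... | false | false = refl

Rmil-insertAt : ∀ x p ys → (∀ {y} → y ∈ ys → y < x) → InRange (suc (length ys)) p →
  Rmil (insertAt x p ys) ≡ Rmil ys ++ (if p ≡ᵇ suc (length ys) then [ x ] else [])
Rmil-insertAt x (suc zero) []       _   _ = refl
Rmil-insertAt x (suc zero) (y ∷ ys) ys<x _ = begin
  Rmil (x ∷ y ∷ ys)                                             ≡⟨ Rmil-∷ x (y ∷ ys) ⟩
  (if (x <ᵇ y) ∧ allᵇ (x <ᵇ_) ys then [ x ] else []) ++ Rmil (y ∷ ys) ≡⟨ cong (λ b → (if b ∧ allᵇ (x <ᵇ_) ys then [ x ] else []) ++ Rmil (y ∷ ys)) (<ᵇ-false (<⇒≤ (ys<x (here refl)))) ⟩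
  Rmil (y ∷ ys)                                                 ≡⟨ sym (++-identityʳ _) ⟩
  Rmil (y ∷ ys) ++ []                                           ∎
  where open ≡-Reasoning
Rmil-insertAt x (suc (suc p)) (y ∷ ys) ys<x (_ , s≤s p≤) = begin
  Rmil (y ∷ insertAt x (suc p) ys)                              ≡⟨ Rmil-∷ y (insertAt x (suc p) ys) ⟩
  [y]? (insertAt x (suc p) ys) ++ Rmil (insertAt x (suc p) ys)  ≡⟨ cong₂ _++_ head (Rmil-insertAt x (suc p) ys (ys<x ∘ there) (s≤s z≤n , p≤)) ⟩
  [y]? ys ++ (Rmil ys ++ last)                                  ≡⟨ sym (++-assoc ([y]? ys) (Rmil ys) last) ⟩
  ([y]? ys ++ Rmil ys) ++ last                                  ≡⟨ cong (_++ last) (sym (Rmil-∷ y ys)) ⟩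
  Rmil (y ∷ ys) ++ last                                         ∎
  where
  open ≡-Reasoning
  last = if suc p ≡ᵇ suc (length ys) then [ x ] else []
  [y]? : List ℕ → List ℕ
  [y]? w = if allᵇ (y <ᵇ_) w then [ y ] else []
  head : [y]? (insertAt x (suc p) ys) ≡ [y]? ys
  head = cong (λ b → if b then [ y ] else [])
    (trans (allᵇ-insertAt (y <ᵇ_) x (suc p) ys) (cong (_∧ allᵇ (y <ᵇ_) ys) (<ᵇ-true (ys<x (here refl)))))
Rmil-insertAt x (suc (suc p)) [] _ (_ , s≤s ())

Lmil⊆ : ∀ ys → Lmil ys ⊆ ys
Lmil⊆ ys z∈ with ∈-map⁻ (at ys) z∈
... | i , i∈ , refl = at-∈ ys (∈-range⁻ _ (proj₁ (∈-filterᵇ⁻ _ (range (length ys)) i∈)))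

Lmil-insertAt : ∀ x p ys → (∀ {y} → y ∈ ys → y < x) → InRange (suc (length ys)) p →
  Lmil (insertAt x p ys) ≡ (if p ≡ᵇ 1 then x ∷ Lmil ys else Lmil ys)
Lmil-insertAt x (suc zero) ys ys<x _ =
  trans (Lmil-∷ x ys) (cong (x ∷_) (filterᵇ-all (_<ᵇ x) (Lmil ys) (<ᵇ-true ∘ ys<x ∘ Lmil⊆ ys)))
Lmil-insertAt x (suc (suc p)) (y ∷ ys) ys<x (_ , s≤s p≤) = begin
  Lmil (y ∷ insertAt x (suc p) ys)                                  ≡⟨ Lmil-∷ y (insertAt x (suc p) ys) ⟩
  y ∷ filterᵇ (_<ᵇ y) (Lmil (insertAt x (suc p) ys))                ≡⟨ cong (λ w → y ∷ filterᵇ (_<ᵇ y) w) (Lmil-insertAt x (suc p) ys (ys<x ∘ there) (s≤s z≤n , p≤)) ⟩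
  y ∷ filterᵇ (_<ᵇ y) (if suc p ≡ᵇ 1 then x ∷ Lmil ys else Lmil ys) ≡⟨ cong (y ∷_) (x-filtered p) ⟩
  y ∷ filterᵇ (_<ᵇ y) (Lmil ys)                                     ≡⟨ sym (Lmil-∷ y ys) ⟩
  Lmil (y ∷ ys)                                                     ∎
  where
  open ≡-Reasoning
  x-filtered : ∀ p → filterᵇ (_<ᵇ y) (if suc p ≡ᵇ 1 then x ∷ Lmil ys else Lmil ys) ≡ filterᵇ (_<ᵇ y) (Lmil ys)
  x-filtered zero    rewrite <ᵇ-false {x} {y} (<⇒≤ (ys<x (here refl))) = refl
  x-filtered (suc p) = refl
Lmil-insertAt x (suc (suc p)) [] _ (_ , s≤s ())

LmaxPos-upTo : ∀ s {i} → i ≤ length s → LmaxPos s i ≡ allᵇ (LmaxTest s i) (range i)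
LmaxPos-upTo s {i} i≤ = allᵇ-range-upTo (LmaxTest s i) i i≤ (λ {j} i<j _ → cong (λ b → not b ∨ (at s j <ᵇ at s i)) (<ᵇ-false (<⇒≤ i<j)))

-- Positions after p are dominated by the maximum at p; positions before p only see the prefix shared with s′.
Lmap-max : ∀ {n} s s′ {p} → length s ≡ suc n → length s′ ≡ n → InRange (suc n) p →
  (∀ {k} → 1 ≤ k → k < p → at s k ≡ at s′ k) → (∀ {k} → InRange (suc n) k → k ≢ p → at s k < at s p) →
  Lmap s ≡ filterᵇ (_<ᵇ p) (Lmap s′) ++ [ p ]
Lmap-max {n} s s′ {suc p₀} |s|≡ |s′|≡ (1≤p , p≤N) same-prefix p-max = begin
  filterᵇ (LmaxPos s) (range (length s))                 ≡⟨ cong (filterᵇ (LmaxPos s) ∘ range) |s|≡ ⟩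
  filterᵇ (LmaxPos s) (range N)                          ≡⟨ filterᵇ-range-upTo (LmaxPos s) p p≤N after-p ⟩
  filterᵇ (LmaxPos s) (range p)                          ≡⟨ filterᵇ-range-∷ʳ p₀ before-p ⟩
  filterᵇ (LmaxPos s′) (range p₀) ++ (if LmaxPos s p then [ p ] else [])
                                                         ≡⟨ cong (λ b → filterᵇ (LmaxPos s′) (range p₀) ++ (if b then [ p ] else [])) at-p ⟩
  filterᵇ (LmaxPos s′) (range p₀) ++ [ p ]               ≡⟨ cong (_++ [ p ]) (sym truncate) ⟩
  filterᵇ (_<ᵇ p) (filterᵇ (LmaxPos s′) (range (length s′))) ++ [ p ] ∎
  where
  open ≡-Reasoning
  N = suc n
  p = suc p₀
  p∈s : p ∈ range (length s)
  p∈s = ∈-range⁺ (length s) (1≤p , subst (p ≤_) (sym |s|≡) p≤N)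
  after-p : ∀ {i} → p < i → i ≤ N → LmaxPos s i ≡ false
  after-p {i} p<i i≤N = allᵇ-false (LmaxTest s i) (range (length s)) p∈s
    (cong₂ (λ b c → not b ∨ c) (<ᵇ-true p<i) (<ᵇ-false (<⇒≤ (p-max (≤-trans 1≤p (<⇒≤ p<i) , i≤N) (≢-sym (<⇒≢ p<i))))))
  at-p : LmaxPos s p ≡ true
  at-p = allᵇ-true (LmaxTest s p) (range (length s)) test
    where
    test : ∀ {j} → j ∈ range (length s) → LmaxTest s p j ≡ true
    test {j} j∈ with j <ᵇ p in j<p
    ... | false = refl
    ... | true  = let (1≤j , j≤) = ∈-range⁻ (length s) j∈ in
      <ᵇ-true (p-max (1≤j , subst (j ≤_) |s|≡ j≤) (<⇒≢ (<ᵇ-true⁻ j p j<p)))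
  before-p : ∀ {i} → InRange p₀ i → LmaxPos s i ≡ LmaxPos s′ i
  before-p {i} (1≤i , i≤p₀) = begin
    LmaxPos s i                          ≡⟨ LmaxPos-upTo s (≤-trans i≤p₀ (≤-trans (n≤1+n p₀) (subst (p ≤_) (sym |s|≡) p≤N))) ⟩
    allᵇ (LmaxTest s i) (range i)        ≡⟨ allᵇ-cong-∈ (range i) (λ j∈ → cong₂ (λ a b → not _ ∨ (a <ᵇ b))
                                              (same-prefix (proj₁ (∈-range⁻ i j∈)) (s≤s (≤-trans (proj₂ (∈-range⁻ i j∈)) i≤p₀)))
                                              (same-prefix 1≤i (s≤s i≤p₀))) ⟩
    allᵇ (LmaxTest s′ i) (range i)       ≡⟨ sym (LmaxPos-upTo s′ (subst (i ≤_) (sym |s′|≡) (≤-trans i≤p₀ (≤-pred p≤N)))) ⟩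
    LmaxPos s′ i                         ∎
  truncate : filterᵇ (_<ᵇ p) (filterᵇ (LmaxPos s′) (range (length s′))) ≡ filterᵇ (LmaxPos s′) (range p₀)
  truncate = begin
    filterᵇ (_<ᵇ p) (filterᵇ (LmaxPos s′) (range (length s′)))  ≡⟨ filterᵇ-filterᵇ (range (length s′)) ⟩
    filterᵇ (λ i → LmaxPos s′ i ∧ (i <ᵇ p)) (range (length s′))  ≡⟨ cong (filterᵇ (λ i → LmaxPos s′ i ∧ (i <ᵇ p)) ∘ range) |s′|≡ ⟩
    filterᵇ (λ i → LmaxPos s′ i ∧ (i <ᵇ p)) (range n)            ≡⟨ filterᵇ-range-upTo _ p₀ (≤-pred p≤N) (λ {i} p₀<i _ → trans (cong (LmaxPos s′ i ∧_) (<ᵇ-false p₀<i)) (∧-zeroʳ _)) ⟩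
    filterᵇ (λ i → LmaxPos s′ i ∧ (i <ᵇ p)) (range p₀)           ≡⟨ filterᵇ-cong-∈ (range p₀) (λ {i} i∈ → trans (cong (LmaxPos s′ i ∧_) (<ᵇ-true (s≤s (proj₂ (∈-range⁻ p₀ i∈))))) (∧-identityʳ _)) ⟩
    filterᵇ (LmaxPos s′) (range p₀)                             ∎

mapPair : (ℕ → ℕ) → ℕ × ℕ → ℕ × ℕ
mapPair f (a , b) = f a , f b

mapPair-injective : ∀ {f} → (∀ {a b} → f a ≡ f b → a ≡ b) → ∀ {x y} → mapPair f x ≡ mapPair f y → x ≡ y
mapPair-injective f-inj {a , b} {c , d} e = cong₂ _,_ (f-inj (,-injectiveˡ e)) (f-inj (,-injectiveʳ e))

nth-map : ∀ (f : ℕ → ℕ) → f 0 ≡ 0 → ∀ l S → nth l (map f S) ≡ f (nth l S)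
nth-map f f0≡0 l             []      = sym f0≡0
nth-map f f0≡0 zero          (x ∷ S) = sym f0≡0
nth-map f f0≡0 (suc zero)    (x ∷ S) = refl
nth-map f f0≡0 (suc (suc l)) (x ∷ S) = nth-map f f0≡0 (suc l) S

nth-map-InRange : ∀ (f : ℕ → ℕ) S {l} → InRange (length S) l → nth l (map f S) ≡ f (nth l S)
nth-map-InRange f (x ∷ S) {suc zero}    _             = refl
nth-map-InRange f (x ∷ S) {suc (suc l)} (_ , s≤s l≤n) = nth-map-InRange f S (s≤s z≤n , l≤n)

nth-range : ∀ n {p} → InRange n p → nth p (range n) ≡ p
nth-range (suc n) {suc zero}    _             = cong (nth 1) (range-cons n)
nth-range (suc n) {suc (suc p)} (_ , s≤s p≤n) = begin
  nth (2 + p) (range (suc n))        ≡⟨ cong (nth (2 + p)) (range-cons n) ⟩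
  nth (suc p) (map suc (range n))    ≡⟨ nth-map-InRange suc (range n) (s≤s z≤n , subst (suc p ≤_) (sym (length-range n)) p≤n) ⟩
  suc (nth (suc p) (range n))        ≡⟨ cong suc (nth-range n (s≤s z≤n , p≤n)) ⟩
  2 + p                              ∎
  where open ≡-Reasoning

inducedGo-map : ∀ (f : ℕ → ℕ) → f 0 ≡ 0 → (∀ a b → (f a <ᵇ f b) ≡ (a <ᵇ b)) → (∀ a b → (f a ≡ᵇ f b) ≡ (a ≡ᵇ b)) →
  ∀ ls S → inducedGo ls (map f S) ≡ map (mapPair f) (inducedGo ls S)
inducedGo-map f f0≡0 f-<ᵇ f-≡ᵇ []       S = refl
inducedGo-map f f0≡0 f-<ᵇ f-≡ᵇ (l ∷ ls) S = begin
  map (e ,_) (filterᵇ (e <ᵇ_) (map f S)) ++ inducedGo ls (remove e (map f S))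
      ≡⟨ cong (λ x → map (x ,_) (filterᵇ (x <ᵇ_) (map f S)) ++ inducedGo ls (remove x (map f S))) (nth-map f f0≡0 l S) ⟩
  map (f e′ ,_) (filterᵇ (f e′ <ᵇ_) (map f S)) ++ inducedGo ls (remove (f e′) (map f S))
      ≡⟨ cong₂ _++_ row (trans (cong (inducedGo ls) removed) (inducedGo-map f f0≡0 f-<ᵇ f-≡ᵇ ls (remove e′ S))) ⟩
  map (mapPair f) (map (e′ ,_) (filterᵇ (e′ <ᵇ_) S)) ++ map (mapPair f) (inducedGo ls (remove e′ S))
      ≡⟨ sym (map-++ (mapPair f) (map (e′ ,_) (filterᵇ (e′ <ᵇ_) S)) _) ⟩
  map (mapPair f) (map (e′ ,_) (filterᵇ (e′ <ᵇ_) S) ++ inducedGo ls (remove e′ S)) ∎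
  where
  open ≡-Reasoning
  e = nth l (map f S)
  e′ = nth l S
  row : map (f e′ ,_) (filterᵇ (f e′ <ᵇ_) (map f S)) ≡ map (mapPair f) (map (e′ ,_) (filterᵇ (e′ <ᵇ_) S))
  row = begin
    map (f e′ ,_) (filterᵇ (f e′ <ᵇ_) (map f S))          ≡⟨ cong (map (f e′ ,_)) (filterᵇ-map (f e′ <ᵇ_) f S) ⟩
    map (f e′ ,_) (map f (filterᵇ ((f e′ <ᵇ_) ∘ f) S))   ≡⟨ cong (map (f e′ ,_) ∘ map f) (filterᵇ-cong-∈ S (λ {j} _ → f-<ᵇ e′ j)) ⟩
    map (f e′ ,_) (map f (filterᵇ (e′ <ᵇ_) S))           ≡⟨ sym (map-∘ (filterᵇ (e′ <ᵇ_) S)) ⟩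
    map (λ j → f e′ , f j) (filterᵇ (e′ <ᵇ_) S)           ≡⟨ map-∘ (filterᵇ (e′ <ᵇ_) S) ⟩
    map (mapPair f) (map (e′ ,_) (filterᵇ (e′ <ᵇ_) S))            ∎
  removed : remove (f e′) (map f S) ≡ map f (remove e′ S)
  removed = trans (filterᵇ-map (λ j → not (j ≡ᵇ f e′)) f S) (cong (map f) (filterᵇ-cong-∈ S (λ {j} _ → cong not (f-≡ᵇ j e′))))

remove-range : ∀ n {p} → InRange (suc n) p → remove p (range (suc n)) ≡ map (punchIn p) (range n)
remove-range n {p} (1≤p , p≤1+n) with m≤n⇒m<n∨m≡n p≤1+n
... | inj₂ refl = begin
  remove p (range (suc n))   ≡⟨ filterᵇ-range-∷ʳ {λ j → not (j ≡ᵇ p)} n (λ _ → refl) ⟩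
  remove p (range n) ++ (if not (p ≡ᵇ p) then [ p ] else [])  ≡⟨ cong (λ b → remove p (range n) ++ (if not b then [ p ] else [])) (≡ᵇ-true {p} refl) ⟩
  remove p (range n) ++ []   ≡⟨ ++-identityʳ _ ⟩
  remove p (range n)         ≡⟨ filterᵇ-all _ (range n) (λ i∈ → cong not (≡ᵇ-false (<⇒≢ (s≤s (proj₂ (∈-range⁻ n i∈)))))) ⟩
  range n                    ≡⟨ sym (map-id (range n)) ⟩
  map (λ i → i) (range n)    ≡⟨ map-cong-range n (λ i∈ → sym (punchIn-< (s≤s (proj₂ i∈)))) ⟩
  map (punchIn p) (range n)  ∎
  where open ≡-Reasoning
remove-range zero    (1≤p , _) | inj₁ (s≤s p≤0) = ⊥-elim (<⇒≱ 1≤p p≤0)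
remove-range (suc m) {p} (1≤p , _) | inj₁ (s≤s p≤n) = begin
  remove p (range (2 + m))                                  ≡⟨ filterᵇ-range-∷ʳ {λ j → not (j ≡ᵇ p)} (suc m) (λ _ → refl) ⟩
  remove p (range (suc m)) ++ (if not (2 + m ≡ᵇ p) then [ 2 + m ] else [])
                                                            ≡⟨ cong (λ b → remove p (range (suc m)) ++ (if not b then [ 2 + m ] else [])) (≡ᵇ-false (<⇒≢ (s≤s p≤n) ∘ sym)) ⟩
  remove p (range (suc m)) ++ [ 2 + m ]                     ≡⟨ cong₂ _++_ (remove-range m (1≤p , p≤n)) (cong [_] (sym (punchIn-≥ p≤n))) ⟩
  map (punchIn p) (range m) ++ map (punchIn p) [ suc m ]    ≡⟨ sym (map-++ (punchIn p) (range m) [ suc m ]) ⟩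
  map (punchIn p) (range m ++ [ suc m ])                    ≡⟨ cong (map (punchIn p)) (sym (range-suc m)) ⟩
  map (punchIn p) (range (suc m))                           ∎
  where open ≡-Reasoning

-- Processing ℓ_N first removes the ℓ_N-th smallest element p of [1, N] (contributing the pairs (p, j), j > p);
-- the rest of the procedure runs on [1, N] ∖ {p}, the image of [1, N - 1] under punchIn p.
induced-∷ʳ : ∀ c {p} → InRange (suc (length c)) p →
  induced (c ++ [ p ]) ≡ map (p ,_) (filterᵇ (p <ᵇ_) (range (suc (length c)))) ++ map (mapPair (punchIn p)) (induced c)
induced-∷ʳ c {p} p∈ = begin
  inducedGo (reverse (c ++ [ p ])) (range (length (c ++ [ p ])))
      ≡⟨ cong₂ inducedGo (reverse-++ c [ p ]) (cong range (length-∷ʳ c p)) ⟩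
  inducedGo (p ∷ reverse c) (range N)
      ≡⟨ cong (λ e → map (e ,_) (filterᵇ (e <ᵇ_) (range N)) ++ inducedGo (reverse c) (remove e (range N))) (nth-range N p∈) ⟩
  row ++ inducedGo (reverse c) (remove p (range N))
      ≡⟨ cong ((row ++_) ∘ inducedGo (reverse c)) (remove-range (length c) p∈) ⟩
  row ++ inducedGo (reverse c) (map (punchIn p) (range (length c)))
      ≡⟨ cong (row ++_) (inducedGo-map (punchIn p) (punchIn-< (proj₁ p∈)) (punchIn-<ᵇ p) (punchIn-≡ᵇ p) (reverse c) (range (length c))) ⟩
  row ++ map (mapPair (punchIn p)) (induced c) ∎
  where
  open ≡-Reasoning
  N = suc (length c)
  row = map (p ,_) (filterᵇ (p <ᵇ_) (range N))

length-induced-∷ʳ : ∀ c {p} → InRange (suc (length c)) p → length (induced (c ++ [ p ])) ≡ (suc (length c) ∸ p) + length (induced c)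
length-induced-∷ʳ c {p} p∈ = begin
  length (induced (c ++ [ p ]))                          ≡⟨ cong length (induced-∷ʳ c p∈) ⟩
  length (row ++ map (mapPair (punchIn p)) (induced c))  ≡⟨ length-++ row ⟩
  length row + length (map (mapPair (punchIn p)) (induced c))
                                                         ≡⟨ cong₂ _+_ (trans (length-map (p ,_) (filterᵇ (p <ᵇ_) (range N))) (length-filter-< p N))
                                                                      (length-map (mapPair (punchIn p)) (induced c)) ⟩
  (N ∸ p) + length (induced c)                           ∎
  where
  open ≡-Reasoning
  N = suc (length c)
  row = map (p ,_) (filterᵇ (p <ᵇ_) (range N))

pairsFrom : ℕ → ℕ → List (ℕ × ℕ)
pairsFrom L i = map (i ,_) (filterᵇ (i <ᵇ_) (range L))

∈-pairsLt⁻ : ∀ L {i j} → (i , j) ∈ pairsLt L → InRange L i × InRange L j × i < j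
∈-pairsLt⁻ L ij∈ with ∈-concat⁻′ (map (pairsFrom L) (range L)) ij∈
... | xs , ij∈xs , xs∈ with ∈-map⁻ (pairsFrom L) xs∈
... | i , i∈ , refl with ∈-map⁻ (i ,_) ij∈xs
... | j , j∈ , refl with ∈-filterᵇ⁻ (i <ᵇ_) (range L) j∈
... | j∈L , i<j = ∈-range⁻ L i∈ , ∈-range⁻ L j∈L , <ᵇ-true⁻ i j i<j

∈-pairsLt⁺ : ∀ L {i j} → InRange L i → InRange L j → i < j → (i , j) ∈ pairsLt L
∈-pairsLt⁺ L {i} i∈ j∈ i<j = ∈-concat⁺′
  (∈-map⁺ (i ,_) (∈-filterᵇ⁺ (i <ᵇ_) (∈-range⁺ L j∈) (<ᵇ-true i<j)))
  (∈-map⁺ (pairsFrom L) (∈-range⁺ L i∈))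

Unique-concatMap-pairsFrom : ∀ L xs → Unique xs → Unique (concatMap (pairsFrom L) xs)
Unique-concatMap-pairsFrom L []       _          = []
Unique-concatMap-pairsFrom L (x ∷ xs) (x∉xs ∷ u) =
  Unique.++⁺ (Unique.map⁺ ,-injectiveʳ (Unique.filter⁺ (T? ∘ (x <ᵇ_)) (Unique-range L))) (Unique-concatMap-pairsFrom L xs u) disjoint
  where
  disjoint : ∀ {v} → ¬ (v ∈ pairsFrom L x × v ∈ concatMap (pairsFrom L) xs)
  disjoint (v∈row , v∈rest) with ∈-map⁻ (x ,_) v∈row
  ... | _ , _ , refl with ∈-concat⁻′ (map (pairsFrom L) xs) v∈rest
  ... | ys , v∈ys , ys∈ with ∈-map⁻ (pairsFrom L) ys∈
  ... | i , i∈xs , refl with ∈-map⁻ (i ,_) v∈ys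
  ... | _ , _ , e = All.lookup x∉xs i∈xs (,-injectiveˡ e)

Unique-Inv : ∀ s → Unique (Inv s)
Unique-Inv s = Unique.filter⁺ _ (Unique-concatMap-pairsFrom (length s) (range (length s)) (Unique-range (length s)))

∈-Inv⁻ : ∀ s {i j} → (i , j) ∈ Inv s → InRange (length s) i × InRange (length s) j × i < j × at s j < at s i
∈-Inv⁻ s ij∈ with ∈-filterᵇ⁻ _ (pairsLt (length s)) ij∈
... | ij∈pairs , sj<si with ∈-pairsLt⁻ (length s) ij∈pairs
... | i∈ , j∈ , i<j = i∈ , j∈ , i<j , <ᵇ-true⁻ _ _ sj<si

∈-Inv⁺ : ∀ s {i j} → InRange (length s) i → InRange (length s) j → i < j → at s j < at s i → (i , j) ∈ Inv s
∈-Inv⁺ s i∈ j∈ i<j sj<si = ∈-filterᵇ⁺ _ (∈-pairsLt⁺ (length s) i∈ j∈ i<j) (<ᵇ-true sj<si)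

module InversionsOfInsertAt {n : ℕ} {σ′ : List ℕ} (P′ : IsPerm n σ′) {p : ℕ} (p∈ : InRange (suc n) p) where
  open ValueInsertion P′ p∈

  row : List (ℕ × ℕ)
  row = map (p ,_) (filterᵇ (p <ᵇ_) (range N))

  InRange-σ : ∀ {k} → InRange N k → InRange (length σ) k
  InRange-σ = InRange-length Pσ

  InRange-σ⁻ : ∀ {k} → InRange (length σ) k → InRange N k
  InRange-σ⁻ = subst (λ m → InRange m _) (perm-length Pσ)

  σk<N : ∀ {k} → InRange N k → k ≢ p → at σ k < N
  σk<N = at<max Pσ p∈ σp≡N

  Inv-insertAt⊆ : Inv σ ⊆ row ++ map (mapPair (punchIn p)) (Inv σ′)
  Inv-insertAt⊆ {i , j} ij∈ with ∈-Inv⁻ σ ij∈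
  ... | i∈ , j∈ , i<j , σj<σi with i ≟ p | j ≟ p
  ... | yes refl | _ = ∈-++⁺ˡ (∈-map⁺ (i ,_) (∈-filterᵇ⁺ (i <ᵇ_) (∈-range⁺ N (InRange-σ⁻ j∈)) (<ᵇ-true i<j)))
  ... | no i≢p | yes refl = ⊥-elim (<-asym (subst (_< at σ i) σp≡N σj<σi) (σk<N (InRange-σ⁻ i∈) i≢p))
  ... | no i≢p | no j≢p with punchIn-onto n p∈ (InRange-σ⁻ i∈) i≢p | punchIn-onto n p∈ (InRange-σ⁻ j∈) j≢p
  ... | i′ , i′∈ , refl | j′ , j′∈ , refl = ∈-++⁺ʳ row (∈-map⁺ (mapPair (punchIn p))
        (∈-Inv⁺ σ′ (InRange-length P′ i′∈) (InRange-length P′ j′∈) i′<j′ (subst₂ _<_ (σ∘punchIn≡σ′ j′∈) (σ∘punchIn≡σ′ i′∈) σj<σi)))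
    where
    i′<j′ : i′ < j′
    i′<j′ with <-cmp i′ j′
    ... | tri< i′<j′ _ _ = i′<j′
    ... | tri≈ _ refl _  = ⊥-elim (<-irrefl refl i<j)
    ... | tri> _ _ j′<i′ = ⊥-elim (<-asym i<j (punchIn-mono-< p j′<i′))

  Inv-insertAt⊇ : row ++ map (mapPair (punchIn p)) (Inv σ′) ⊆ Inv σ
  Inv-insertAt⊇ ij∈ with ∈-++⁻ row ij∈
  ... | inj₁ ij∈row with ∈-map⁻ (p ,_) ij∈row
  ...   | j , j∈ , refl with ∈-filterᵇ⁻ (p <ᵇ_) (range N) j∈
  ...     | j∈N , p<j = ∈-Inv⁺ σ (InRange-σ p∈) (InRange-σ (∈-range⁻ N j∈N)) (<ᵇ-true⁻ p j p<j)
                          (subst (at σ j <_) (sym σp≡N) (σk<N (∈-range⁻ N j∈N) (≢-sym (<⇒≢ (<ᵇ-true⁻ p j p<j)))))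
  Inv-insertAt⊇ ij∈ | inj₂ ij∈rest with ∈-map⁻ (mapPair (punchIn p)) ij∈rest
  ... | (i′ , j′) , ij′∈ , refl with ∈-Inv⁻ σ′ ij′∈
  ... | i′∈ , j′∈ , i′<j′ , σ′j′<σ′i′ =
    ∈-Inv⁺ σ (InRange-σ (punchIn-InRange n p (toN i′∈))) (InRange-σ (punchIn-InRange n p (toN j′∈)))
      (punchIn-mono-< p i′<j′) (subst₂ _<_ (sym (σ∘punchIn≡σ′ (toN j′∈))) (sym (σ∘punchIn≡σ′ (toN i′∈))) σ′j′<σ′i′)
    where
    toN : ∀ {k} → InRange (length σ′) k → InRange n k
    toN = subst (λ m → InRange m _) (perm-length P′)

  Unique-row++ : Unique (row ++ map (mapPair (punchIn p)) (Inv σ′))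
  Unique-row++ = Unique.++⁺ (Unique.map⁺ ,-injectiveʳ (Unique.filter⁺ (T? ∘ (p <ᵇ_)) (Unique-range N)))
    (Unique.map⁺ (mapPair-injective (punchIn-injective p)) (Unique-Inv σ′)) disjoint
    where
    disjoint : ∀ {v} → ¬ (v ∈ row × v ∈ map (mapPair (punchIn p)) (Inv σ′))
    disjoint (v∈row , v∈rest) with ∈-map⁻ (p ,_) v∈row
    ... | _ , _ , refl with ∈-map⁻ (mapPair (punchIn p)) v∈rest
    ... | (a , _) , _ , e = punchIn-≢ p a (sym (,-injectiveˡ e))

  Inv-insertAt : Inv σ ≐ row ++ map (mapPair (punchIn p)) (Inv σ′)
  Inv-insertAt _ = mk⇔ Inv-insertAt⊆ Inv-insertAt⊇

  inv-insertAt : inv σ ≡ (N ∸ p) + inv σ′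
  inv-insertAt = begin
    inv σ                                                        ≡⟨ ≐⇒length≡ (Unique-Inv σ) Unique-row++ Inv-insertAt ⟩
    length (row ++ map (mapPair (punchIn p)) (Inv σ′))           ≡⟨ length-++ row ⟩
    length row + length (map (mapPair (punchIn p)) (Inv σ′))     ≡⟨ cong₂ _+_ (trans (length-map (p ,_) (filterᵇ (p <ᵇ_) (range N))) (length-filter-< p N))
                                                                              (length-map (mapPair (punchIn p)) (Inv σ′)) ⟩
    (N ∸ p) + inv σ′                                             ∎
    where open ≡-Reasoning

  p∈-Acode : InRange (suc (length (Acode σ′))) p
  p∈-Acode = subst (λ m → InRange (suc m) p) (sym (length-Acode P′)) p∈

  induced-Acode-insertAt : induced (Acode σ) ≡ row ++ map (mapPair (punchIn p)) (induced (Acode σ′))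
  induced-Acode-insertAt = begin
    induced (Acode σ)                 ≡⟨ cong induced Acode-insertAt ⟩
    induced (Acode σ′ ++ [ p ])       ≡⟨ induced-∷ʳ (Acode σ′) p∈-Acode ⟩
    map (p ,_) (filterᵇ (p <ᵇ_) (range (suc (length (Acode σ′))))) ++ map (mapPair (punchIn p)) (induced (Acode σ′))
                                      ≡⟨ cong (λ m → map (p ,_) (filterᵇ (p <ᵇ_) (range (suc m))) ++ map (mapPair (punchIn p)) (induced (Acode σ′))) (length-Acode P′) ⟩
    row ++ map (mapPair (punchIn p)) (induced (Acode σ′)) ∎
    where open ≡-Reasoning

swapAt : ℕ → ℕ → List ℕ → ℕ → ℕ
swapAt p m σ k = if k ≡ᵇ p then at σ m else (if k ≡ᵇ m then at σ p else at σ k)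

length-swapPos : ∀ p m σ → length (swapPos p m σ) ≡ length σ
length-swapPos p m σ = trans (length-map _ (range (length σ))) (length-range _)

module _ (p m : ℕ) (σ : List ℕ) where

  private
    InRange-swapPos : ∀ {k} → InRange (length σ) k → InRange (length (swapPos p m σ)) k
    InRange-swapPos = subst (λ L → InRange L _) (sym (length-swapPos p m σ))

  at-swapPos : ∀ {k} → InRange (length σ) k → at (swapPos p m σ) k ≡ swapAt p m σ k
  at-swapPos = at-map-range (swapAt p m σ) (length σ)

  at-swapPos-first : InRange (length σ) p → at (swapPos p m σ) p ≡ at σ m
  at-swapPos-first p∈ rewrite at-swapPos p∈ | ≡ᵇ-true {p} refl = refl

  at-swapPos-second : InRange (length σ) m → at (swapPos p m σ) m ≡ at σ p
  at-swapPos-second m∈ rewrite at-swapPos m∈ with m ≡ᵇ p in m≡ᵇp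
  ... | true  rewrite ≡ᵇ-true⁻ m p m≡ᵇp = refl
  ... | false rewrite ≡ᵇ-true {m} refl = refl

  at-swapPos-other : ∀ {k} → InRange (length σ) k → k ≢ p → k ≢ m → at (swapPos p m σ) k ≡ at σ k
  at-swapPos-other k∈ k≢p k≢m rewrite at-swapPos k∈ | ≡ᵇ-false k≢p | ≡ᵇ-false k≢m = refl

  swapPos-∈ : InRange (length σ) p → InRange (length σ) m → σ ⊆ swapPos p m σ
  swapPos-∈ p∈ m∈ v∈ with ∈⇒at σ v∈
  ... | k , k∈ , refl with k ≟ p | k ≟ m
  ... | yes refl | _        = subst (_∈ swapPos p m σ) (at-swapPos-second m∈) (at-∈ _ (InRange-swapPos m∈))
  ... | no _     | yes refl = subst (_∈ swapPos p m σ) (at-swapPos-first p∈) (at-∈ _ (InRange-swapPos p∈))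
  ... | no k≢p   | no k≢m   = subst (_∈ swapPos p m σ) (at-swapPos-other k∈ k≢p k≢m) (at-∈ _ (InRange-swapPos k∈))

swapPos-involutive : ∀ p m σ → InRange (length σ) p → InRange (length σ) m → swapPos p m (swapPos p m σ) ≡ σ
swapPos-involutive p m σ p∈ m∈ = at-extensionality _ σ (trans (length-swapPos p m (swapPos p m σ)) (length-swapPos p m σ)) pointwise
  where
  pointwise : ∀ {k} → InRange (length (swapPos p m (swapPos p m σ))) k → at (swapPos p m (swapPos p m σ)) k ≡ at σ k
  pointwise {k} k∈ with k ≟ p | k ≟ m
  ... | yes refl | _       = trans (at-swapPos-first k m (swapPos k m σ) (subst (λ L → InRange L _) (sym (length-swapPos k m σ)) p∈)) (at-swapPos-second k m σ m∈)
  ... | no k≢p   | yes refl = trans (at-swapPos-second p k (swapPos p k σ) (subst (λ L → InRange L _) (sym (length-swapPos p k σ)) m∈)) (at-swapPos-first p k σ p∈)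
  ... | no k≢p   | no k≢m  = trans (at-swapPos-other p m (swapPos p m σ) (subst (λ L → InRange L k) (length-swapPos p m (swapPos p m σ)) k∈) k≢p k≢m)
                                   (at-swapPos-other p m σ (subst (λ L → InRange L k) (trans (length-swapPos p m (swapPos p m σ)) (length-swapPos p m σ)) k∈) k≢p k≢m)

swapPos-refl : ∀ p σ → InRange (length σ) p → swapPos p p σ ≡ σ
swapPos-refl p σ p∈ = at-extensionality _ σ (length-swapPos p p σ) pointwise
  where
  pointwise : ∀ {k} → InRange (length (swapPos p p σ)) k → at (swapPos p p σ) k ≡ at σ k
  pointwise {k} k∈ with k ≟ p
  ... | yes refl = at-swapPos-first k k σ p∈
  ... | no k≢p   = at-swapPos-other p p σ (subst (λ L → InRange L k) (length-swapPos p p σ) k∈) k≢p k≢p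

swapPos-++ : ∀ p m σ ys → InRange (length σ) p → InRange (length σ) m → swapPos p m (σ ++ ys) ≡ swapPos p m σ ++ ys
swapPos-++ p m σ ys p∈ m∈ = at-extensionality _ _ same-length pointwise
  where
  σ++ys = σ ++ ys
  same-length : length (swapPos p m σ++ys) ≡ length (swapPos p m σ ++ ys)
  same-length = begin
    length (swapPos p m σ++ys)          ≡⟨ length-swapPos p m σ++ys ⟩
    length (σ ++ ys)                    ≡⟨ length-++ σ ⟩
    length σ + length ys                ≡⟨ cong (_+ length ys) (sym (length-swapPos p m σ)) ⟩
    length (swapPos p m σ) + length ys  ≡⟨ sym (length-++ (swapPos p m σ)) ⟩
    length (swapPos p m σ ++ ys)        ∎
    where open ≡-Reasoning
  ≤σ : ∀ {k} → k ≤ length σ → k ≤ length σ++ys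
  ≤σ k≤ = ≤-trans k≤ (subst (length σ ≤_) (sym (length-++ σ)) (m≤m+n (length σ) (length ys)))
  pointwise : ∀ {k} → InRange (length (swapPos p m σ++ys)) k → at (swapPos p m σ++ys) k ≡ at (swapPos p m σ ++ ys) k
  pointwise {k} (1≤k , k≤) with k ≤? length σ
  ... | yes k≤σ = begin
    at (swapPos p m σ++ys) k     ≡⟨ at-swapPos p m σ++ys (1≤k , ≤σ k≤σ) ⟩
    swapAt p m σ++ys k           ≡⟨ cong₃ (λ a b c → if k ≡ᵇ p then a else (if k ≡ᵇ m then b else c))
                                      (at-++ˡ σ ys (proj₂ m∈)) (at-++ˡ σ ys (proj₂ p∈)) (at-++ˡ σ ys k≤σ) ⟩
    swapAt p m σ k               ≡⟨ sym (at-swapPos p m σ (1≤k , k≤σ)) ⟩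
    at (swapPos p m σ) k         ≡⟨ sym (at-++ˡ (swapPos p m σ) ys (subst (k ≤_) (sym (length-swapPos p m σ)) k≤σ)) ⟩
    at (swapPos p m σ ++ ys) k   ∎
    where open ≡-Reasoning
  ... | no k≰σ = begin
    at (swapPos p m σ++ys) k                               ≡⟨ at-swapPos-other p m σ++ys (1≤k , subst (k ≤_) (length-swapPos p m σ++ys) k≤)
                                                                (λ k≡p → k≰σ (subst (_≤ length σ) (sym k≡p) (proj₂ p∈)))
                                                                (λ k≡m → k≰σ (subst (_≤ length σ) (sym k≡m) (proj₂ m∈))) ⟩
    at (σ ++ ys) k                                         ≡⟨ cong (at σ++ys) (sym σ+k′≡k) ⟩
    at (σ ++ ys) (length σ + k′)                           ≡⟨ at-++ʳ σ ys 1≤k′ ⟩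
    at ys k′                                               ≡⟨ sym (at-++ʳ (swapPos p m σ) ys 1≤k′) ⟩
    at (swapPos p m σ ++ ys) (length (swapPos p m σ) + k′) ≡⟨ cong (λ L → at (swapPos p m σ ++ ys) (L + k′)) (length-swapPos p m σ) ⟩
    at (swapPos p m σ ++ ys) (length σ + k′)               ≡⟨ cong (at (swapPos p m σ ++ ys)) σ+k′≡k ⟩
    at (swapPos p m σ ++ ys) k                             ∎
    where
    open ≡-Reasoning
    k′ = k ∸ length σ
    σ+k′≡k : length σ + k′ ≡ k
    σ+k′≡k = m+[n∸m]≡n (<⇒≤ (≰⇒> k≰σ))
    1≤k′ : 1 ≤ k′
    1≤k′ = m<n⇒0<n∸m (≰⇒> k≰σ)

-- τ(p) = n + 1 and τ(n + 1) = τ′(p): n + 1 enters the cycle of p right after p (a fixed point if p = n + 1).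
cycleInsert : ℕ → ℕ → List ℕ → List ℕ
cycleInsert n p τ′ = swapPos p (suc n) (τ′ ++ [ suc n ])

module CycleInsertion {n : ℕ} {τ′ : List ℕ} (P′ : IsPerm n τ′) {p : ℕ} (p∈ : InRange (suc n) p) where

  N = suc n
  τ = cycleInsert n p τ′
  q = at τ′ p
  τ′+N = τ′ ++ [ N ]

  |τ′+N|≡N : length τ′+N ≡ N
  |τ′+N|≡N = trans (length-∷ʳ τ′ N) (cong suc (perm-length P′))

  |τ|≡N : length τ ≡ N
  |τ|≡N = trans (length-swapPos p N τ′+N) |τ′+N|≡N

  InRange-τ′+N : ∀ {k} → InRange N k → InRange (length τ′+N) k
  InRange-τ′+N = subst (λ L → InRange L _) (sym |τ′+N|≡N)

  N∈ : InRange N N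
  N∈ = s≤s z≤n , ≤-refl

  p≤n : p ≢ N → p ≤ n
  p≤n = ≤-pred-≢ (proj₂ p∈)

  τ′+N-prefix : ∀ {k} → k ≤ n → at τ′+N k ≡ at τ′ k
  τ′+N-prefix k≤n = at-++ˡ τ′ [ N ] (subst (_ ≤_) (sym (perm-length P′)) k≤n)

  τp≡N : at τ p ≡ N
  τp≡N = trans (at-swapPos-first p N τ′+N (InRange-τ′+N p∈)) (subst (λ L → at τ′+N (suc L) ≡ N) (perm-length P′) (at-∷ʳ τ′ N))

  τN≡q : p ≢ N → at τ N ≡ q
  τN≡q p≢N = trans (at-swapPos-second p N τ′+N (InRange-τ′+N N∈)) (τ′+N-prefix (p≤n p≢N))

  τk≡τ′k : ∀ {k} → InRange n k → k ≢ p → at τ k ≡ at τ′ k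
  τk≡τ′k (1≤k , k≤n) k≢p = trans (at-swapPos-other p N τ′+N (InRange-τ′+N (1≤k , m≤n⇒m≤1+n k≤n)) k≢p (<⇒≢ (s≤s k≤n)))
                                 (τ′+N-prefix k≤n)

  q∈ : p ≢ N → InRange n q
  q∈ p≢N = at-perm P′ (proj₁ p∈ , p≤n p≢N)

  τ-perm : IsPerm N τ
  τ-perm = perm-intro N τ |τ|≡N onto
    where
    at-τ-∈ : ∀ {k} → InRange N k → at τ k ∈ τ
    at-τ-∈ = at-∈ τ ∘ subst (λ L → InRange L _) (sym |τ|≡N)
    onto : ∀ {v} → InRange N v → v ∈ τ
    onto {v} (1≤v , v≤N) with v ≟ N
    ... | yes refl = subst (_∈ τ) τp≡N (at-τ-∈ p∈)
    ... | no v≢N with pos-perm P′ (1≤v , ≤-pred-≢ v≤N v≢N)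
    ...   | (1≤k , k≤n) , τ′k≡v with pos τ′ v ≟ p
    ...     | no k≢p  = subst (_∈ τ) (trans (τk≡τ′k (1≤k , k≤n) k≢p) τ′k≡v) (at-τ-∈ (1≤k , m≤n⇒m≤1+n k≤n))
    ...     | yes k≡p = subst (_∈ τ) (trans (τN≡q p≢N) (trans (cong (at τ′) (sym k≡p)) τ′k≡v)) (at-τ-∈ N∈)
      where
      p≢N : p ≢ N
      p≢N p≡N = <⇒≢ (s≤s k≤n) (trans k≡p p≡N)

  τ⁻¹N≡p : pos τ N ≡ p
  τ⁻¹N≡p = pos-at≡ τ-perm p∈ τp≡N

  τ⁻¹q≡N : p ≢ N → pos τ q ≡ N
  τ⁻¹q≡N p≢N = pos-at≡ τ-perm N∈ (τN≡q p≢N)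

  τ′⁻¹q≡p : p ≢ N → pos τ′ q ≡ p
  τ′⁻¹q≡p p≢N = pos-at≡ P′ (proj₁ p∈ , p≤n p≢N) refl

  τ⁻¹x≡τ′⁻¹x : ∀ {x} → InRange n x → x ≢ q → pos τ x ≡ pos τ′ x
  τ⁻¹x≡τ′⁻¹x x∈ x≢q with pos-perm P′ x∈
  ... | (1≤k , k≤n) , τ′k≡x = pos-at≡ τ-perm (1≤k , m≤n⇒m≤1+n k≤n) (trans (τk≡τ′k (1≤k , k≤n) k≢p) τ′k≡x)
    where
    k≢p : pos τ′ _ ≢ p
    k≢p k≡p = x≢q (trans (sym τ′k≡x) (cong (at τ′) k≡p))

cycleInsert-decomposition : ∀ n τ → IsPerm (suc n) τ →
  Σ[ p ∈ ℕ ] Σ[ τ′ ∈ List ℕ ] InRange (suc n) p × IsPerm n τ′ × τ ≡ cycleInsert n p τ′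
cycleInsert-decomposition n τ P = p , τ′ , p∈ , P′ , τ≡
  where
  N = suc n
  p = pos τ N
  p∈ : InRange N p
  p∈ = proj₁ (pos-perm P (s≤s z≤n , ≤-refl))
  τp≡N : at τ p ≡ N
  τp≡N = proj₂ (pos-perm P (s≤s z≤n , ≤-refl))
  InRange-τ : ∀ {k} → InRange N k → InRange (length τ) k
  InRange-τ = InRange-length P
  ρ = swapPos p N τ
  |ρ|≡N : length ρ ≡ N
  |ρ|≡N = trans (length-swapPos p N τ) (perm-length P)
  τ′ = take n ρ
  ρ≡τ′+N : ρ ≡ τ′ ++ [ N ]
  ρ≡τ′+N = trans (split-last ρ n |ρ|≡N) (cong (λ v → τ′ ++ [ v ]) (trans (at-swapPos-second p N τ (InRange-τ (s≤s z≤n , ≤-refl))) τp≡N))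
  |τ′|≡n : length τ′ ≡ n
  |τ′|≡n = suc-injective (trans (sym (length-∷ʳ τ′ N)) (trans (cong length (sym ρ≡τ′+N)) |ρ|≡N))
  τ′k≡ρk : ∀ {k} → k ≤ n → at τ′ k ≡ at ρ k
  τ′k≡ρk k≤n = trans (sym (at-++ˡ τ′ [ N ] (subst (_ ≤_) (sym |τ′|≡n) k≤n))) (cong (λ w → at w _) (sym ρ≡τ′+N))
  P′ : IsPerm n τ′
  P′ = perm-intro n τ′ |τ′|≡n onto
    where
    at-τ′-∈ : ∀ {k} → InRange n k → at τ′ k ∈ τ′
    at-τ′-∈ = at-∈ τ′ ∘ subst (λ L → InRange L _) (sym |τ′|≡n)
    onto : ∀ {v} → InRange n v → v ∈ τ′
    onto {v} (1≤v , v≤n) with pos-perm P (1≤v , m≤n⇒m≤1+n v≤n)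
    ... | (1≤k , k≤N) , τk≡v with pos τ v ≟ p | pos τ v ≟ N
    ... | yes k≡p | _       = ⊥-elim (<⇒≢ (s≤s v≤n) (trans (sym τk≡v) (trans (cong (at τ) k≡p) τp≡N)))
    ... | no k≢p  | no k≢N  = subst (_∈ τ′) (trans (τ′k≡ρk (≤-pred-≢ k≤N k≢N)) (trans (at-swapPos-other p N τ (InRange-τ (1≤k , k≤N)) k≢p k≢N) τk≡v))
                                (at-τ′-∈ (1≤k , ≤-pred-≢ k≤N k≢N))
    ... | no k≢p  | yes k≡N = subst (_∈ τ′) (trans (τ′k≡ρk p≤n) (trans (at-swapPos-first p N τ (InRange-τ p∈)) (trans (cong (at τ) (sym k≡N)) τk≡v)))
                                (at-τ′-∈ (proj₁ p∈ , p≤n))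
      where
      p≤n : p ≤ n
      p≤n = ≤-pred-≢ (proj₂ p∈) (λ p≡N → k≢p (trans k≡N (sym p≡N)))
  τ≡ : τ ≡ cycleInsert n p τ′
  τ≡ = trans (sym (swapPos-involutive p N τ (InRange-τ p∈) (InRange-τ (s≤s z≤n , ≤-refl)))) (cong (swapPos p N) ρ≡τ′+N)

bIter-stop : ∀ σ f i x → (pos σ x ≤ᵇ i) ≡ true → bIter σ (suc f) i x ≡ pos σ x
bIter-stop σ f i x stop rewrite stop = refl

bIter-continue : ∀ σ f i x → (pos σ x ≤ᵇ i) ≡ false → bIter σ (suc f) i x ≡ bIter σ f i (pos σ x)
bIter-continue σ f i x go rewrite go = refl

-- bIter returns 0 only when it runs out of fuel, so any two successful searches agree.
bIter-fuel-irrelevant : ∀ σ f f′ i x → bIter σ f i x ≢ 0 → bIter σ f′ i x ≢ 0 → bIter σ f i x ≡ bIter σ f′ i x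
bIter-fuel-irrelevant σ zero    f′       i x r≢0 _    = ⊥-elim (r≢0 refl)
bIter-fuel-irrelevant σ (suc f) zero     i x _   r′≢0 = ⊥-elim (r′≢0 refl)
bIter-fuel-irrelevant σ (suc f) (suc f′) i x r≢0 r′≢0 with pos σ x ≤ᵇ i
... | true  = refl
... | false = bIter-fuel-irrelevant σ f f′ i (pos σ x) r≢0 r′≢0

module _ {M : ℕ} {σ : List ℕ} (P : IsPerm M σ) where

  bIter≡0⇒iterates> : ∀ f i {x} → InRange M x → bIter σ f i x ≡ 0 → ∀ {k} → 1 ≤ k → k ≤ f → i < iterate (pos σ) k x
  bIter≡0⇒iterates> zero    i x∈ r≡0 {suc k} _ ()
  bIter≡0⇒iterates> (suc f) i {x} x∈ r≡0 {k} 1≤k k≤f with pos σ x ≤ᵇ i in stop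
  ... | true = ⊥-elim (<⇒≢ (proj₁ (proj₁ (pos-perm P x∈))) (sym r≡0))
  bIter≡0⇒iterates> (suc f) i {x} x∈ r≡0 {suc zero}    _ _         | false = ≤ᵇ-false⁻ _ _ stop
  bIter≡0⇒iterates> (suc f) i {x} x∈ r≡0 {suc (suc k)} _ (s≤s k≤f) | false =
    subst (i <_) (sym (iterate-suc (pos σ) (suc k) x)) (bIter≡0⇒iterates> f i (proj₁ (pos-perm P x∈)) r≡0 (s≤s z≤n) k≤f)

  -- The σ⁻¹-orbit of i returns to i within M steps, so the search from i succeeds.
  bIter-nonzero : ∀ {i} → InRange M i → bIter σ M i i ≢ 0
  bIter-nonzero i∈ r≡0 with orbit-period (pos-isInjectionOn P) i∈
  ... | c , (1≤c , c≤M) , back = <-irrefl refl (subst (_ <_) back (bIter≡0⇒iterates> M _ i∈ r≡0 1≤c c≤M))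

module BcodeOfCycleInsertion {n : ℕ} {τ′ : List ℕ} (P′ : IsPerm n τ′) {p : ℕ} (p∈ : InRange (suc n) p) where
  open CycleInsertion P′ p∈

  -- The τ⁻¹-orbits agree with the τ′⁻¹-orbits, except that τ⁻¹ detours from q through N to p;
  -- N > i is skipped by the search, so every successful τ′-search is reproduced by τ.
  bIter-lift : ∀ f {i x} → i ≤ n → InRange n x → bIter τ′ f i x ≢ 0 → Σ[ f′ ∈ ℕ ] bIter τ f′ i x ≡ bIter τ′ f i x
  bIter-lift zero    i≤n x∈ r≢0 = ⊥-elim (r≢0 refl)
  bIter-lift (suc f) {i} {x} i≤n x∈ r≢0 with x ≟ q
  ... | no x≢q with pos τ′ x ≤ᵇ i in stop
  ...   | true  = 1 , trans (bIter-stop τ 0 i x (trans (cong (_≤ᵇ i) (τ⁻¹x≡τ′⁻¹x x∈ x≢q)) stop)) (τ⁻¹x≡τ′⁻¹x x∈ x≢q)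
  ...   | false with bIter-lift f i≤n (proj₁ (pos-perm P′ x∈)) r≢0
  ...     | f′ , lifted = suc f′ , (begin
    bIter τ (suc f′) i x                    ≡⟨ bIter-continue τ f′ i x (trans (cong (_≤ᵇ i) (τ⁻¹x≡τ′⁻¹x x∈ x≢q)) stop) ⟩
    bIter τ f′ i (pos τ x)                  ≡⟨ cong (bIter τ f′ i) (τ⁻¹x≡τ′⁻¹x x∈ x≢q) ⟩
    bIter τ f′ i (pos τ′ x)                 ≡⟨ lifted ⟩
    bIter τ′ f i (pos τ′ x)                 ∎)
    where open ≡-Reasoning
  bIter-lift (suc f) {i} {x} i≤n x∈ r≢0 | yes refl = detour
    where
    p≢N : p ≢ N
    p≢N p≡N = <⇒≢ (proj₁ x∈) (sym (trans (cong (at τ′) p≡N) (at-out τ′ (subst (_< N) (sym (perm-length P′)) ≤-refl))))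
    N-skipped : (pos τ q ≤ᵇ i) ≡ false
    N-skipped = trans (cong (_≤ᵇ i) (τ⁻¹q≡N p≢N)) (≤ᵇ-false (s≤s i≤n))
    via-N : ∀ f′ → bIter τ (suc f′) i q ≡ bIter τ f′ i N
    via-N f′ = trans (bIter-continue τ f′ i q N-skipped) (cong (bIter τ f′ i) (τ⁻¹q≡N p≢N))
    τ′-step : ∀ b → (p ≤ᵇ i) ≡ b → bIter τ′ (suc f) i q ≡ (if b then p else bIter τ′ f i p)
    τ′-step b p≤ᵇi rewrite τ′⁻¹q≡p p≢N | p≤ᵇi = refl
    detour : Σ[ f′ ∈ ℕ ] bIter τ f′ i q ≡ bIter τ′ (suc f) i q
    detour with p ≤ᵇ i in stop
    ... | true  = 2 , trans (via-N 1) (trans (cong (λ y → if y ≤ᵇ i then y else 0) τ⁻¹N≡p) (trans (cong (λ b → if b then p else 0) stop) (sym (τ′-step true stop))))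
    ... | false with bIter-lift f i≤n (proj₁ p∈ , p≤n p≢N) (λ r≡0 → r≢0 (trans (τ′-step false stop) r≡0))
    ...   | f′ , lifted = suc (suc f′) , (begin
      bIter τ (2 + f′) i q        ≡⟨ via-N (suc f′) ⟩
      bIter τ (suc f′) i N        ≡⟨ bIter-continue τ f′ i N (trans (cong (_≤ᵇ i) τ⁻¹N≡p) stop) ⟩
      bIter τ f′ i (pos τ N)      ≡⟨ cong (bIter τ f′ i) τ⁻¹N≡p ⟩
      bIter τ f′ i p              ≡⟨ lifted ⟩
      bIter τ′ f i p              ≡⟨ sym (τ′-step false stop) ⟩
      bIter τ′ (suc f) i q        ∎)
      where open ≡-Reasoning

  Bcode-entry-below : ∀ {i} → InRange n i → bIter τ N i i ≡ bIter τ′ n i i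
  Bcode-entry-below {i} i∈ with bIter-lift n (proj₂ i∈) i∈ (bIter-nonzero P′ i∈)
  ... | f′ , lifted = trans (bIter-fuel-irrelevant τ N f′ i i (bIter-nonzero τ-perm (proj₁ i∈ , m≤n⇒m≤1+n (proj₂ i∈)))
                                                   (λ r≡0 → bIter-nonzero P′ i∈ (trans (sym lifted) r≡0)))
                            lifted

  Bcode-entry-N : bIter τ N N N ≡ p
  Bcode-entry-N = trans (bIter-stop τ n N N (trans (cong (_≤ᵇ N) τ⁻¹N≡p) (≤ᵇ-true (proj₂ p∈)))) τ⁻¹N≡p

  Bcode-cycleInsert : Bcode τ ≡ Bcode τ′ ++ [ p ]
  Bcode-cycleInsert = begin
    map (λ i → bIter τ (length τ) i i) (range (length τ))  ≡⟨ cong (λ L → map (λ i → bIter τ L i i) (range L)) |τ|≡N ⟩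
    map (λ i → bIter τ N i i) (range N)                    ≡⟨ cong (map (λ i → bIter τ N i i)) (range-suc n) ⟩
    map (λ i → bIter τ N i i) (range n ++ [ N ])           ≡⟨ map-++ (λ i → bIter τ N i i) (range n) [ N ] ⟩
    map (λ i → bIter τ N i i) (range n) ++ [ bIter τ N N N ] ≡⟨ cong₂ (λ c ℓ → c ++ [ ℓ ]) (map-cong-range n Bcode-entry-below) Bcode-entry-N ⟩
    map (λ i → bIter τ′ n i i) (range n) ++ [ p ]          ≡⟨ cong (λ L → map (λ i → bIter τ′ L i i) (range L) ++ [ p ]) (sym (perm-length P′)) ⟩
    Bcode τ′ ++ [ p ]                                       ∎
    where open ≡-Reasoning

isCycleMin : List ℕ → ℕ → ℕ → Bool
isCycleMin σ M i = allᵇ (λ k → i ≤ᵇ iter σ k i) (range M)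

Bool-ext : ∀ {b c : Bool} → (b ≡ true → c ≡ true) → (c ≡ true → b ≡ true) → b ≡ c
Bool-ext {true}  {true}  _  _  = refl
Bool-ext {true}  {false} b⇒c _ = sym (b⇒c refl)
Bool-ext {false} {true}  _ c⇒b = c⇒b refl
Bool-ext {false} {false} _  _  = refl

module _ {M : ℕ} {σ : List ℕ} (P : IsPerm M σ) where

  -- The orbit of i is periodic with period c ≤ M, so checking the first M iterates suffices.
  isCycleMin⇒≤iter : ∀ {i} → InRange M i → isCycleMin σ M i ≡ true → ∀ k → i ≤ iter σ k i
  isCycleMin⇒≤iter {i} i∈ min k with orbit-period (at-isInjectionOn P) i∈
  ... | c , (1≤c , c≤M) , back = subst (i ≤_) (sym (iter≡iterate σ k i)) (bounded k k ≤-refl)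
    where
    bounded : ∀ b k → k ≤ b → i ≤ iterate (at σ) k i
    bounded b zero _ = ≤-refl
    bounded b (suc k) k<b with suc k ≤? c
    ... | yes k<c = subst (i ≤_) (iter≡iterate σ (suc k) i)
                      (≤ᵇ-true⁻ i _ (allᵇ-true⁻ _ (range M) min (∈-range⁺ M (s≤s z≤n , ≤-trans k<c c≤M))))
    bounded (suc b) (suc k) (s≤s k≤b) | no k≮c = subst (i ≤_) (sym period) (bounded b (suc k ∸ c) (≤-trans (∸-monoʳ-≤ (suc k) 1≤c) k≤b))
      where
      c≤k : c ≤ suc k
      c≤k = <⇒≤ (≰⇒> k≮c)
      period : iterate (at σ) (suc k) i ≡ iterate (at σ) (suc k ∸ c) i
      period = trans (cong (λ m → iterate (at σ) m i) (sym (m∸n+n≡m c≤k)))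
                     (trans (iterate-+ (at σ) (suc k ∸ c) c i) (cong (iterate (at σ) (suc k ∸ c)) back))

  ≤iter⇒isCycleMin : ∀ {i} → (∀ k → i ≤ iter σ k i) → isCycleMin σ M i ≡ true
  ≤iter⇒isCycleMin i≤ = allᵇ-true _ (range M) (λ {k} _ → ≤ᵇ-true (i≤ k))

module CycOfCycleInsertion {n : ℕ} {τ′ : List ℕ} (P′ : IsPerm n τ′) {p : ℕ} (p∈ : InRange (suc n) p) where
  open CycleInsertion P′ p∈

  iter-τ′-closed : ∀ k {i} → InRange n i → InRange n (iter τ′ k i)
  iter-τ′-closed k {i} i∈ = subst (InRange n) (sym (iter≡iterate τ′ k i)) (iterate-closed (at-isInjectionOn P′) k i∈)

  ≡p⇒p≢N : ∀ {x} → InRange n x → x ≡ p → p ≢ N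
  ≡p⇒p≢N (_ , x≤n) x≡p p≡N = <⇒≢ (s≤s x≤n) (trans x≡p p≡N)

  τ-orbit⊆τ′-orbit∪N : ∀ {i} → InRange n i → ∀ k → Σ[ k′ ∈ ℕ ] (iter τ k i ≡ iter τ′ k′ i ⊎ (iter τ k i ≡ N × iter τ′ k′ i ≡ p))
  τ-orbit⊆τ′-orbit∪N i∈ zero = 0 , inj₁ refl
  τ-orbit⊆τ′-orbit∪N {i} i∈ (suc k) with τ-orbit⊆τ′-orbit∪N i∈ k
  ... | k′ , inj₁ same with iter τ′ k′ i ≟ p
  ...   | yes at-p = k′ , inj₂ (trans (cong (at τ) (trans same at-p)) τp≡N , at-p)
  ...   | no  ≢p   = suc k′ , inj₁ (trans (cong (at τ) same) (τk≡τ′k (iter-τ′-closed k′ i∈) ≢p))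
  τ-orbit⊆τ′-orbit∪N {i} i∈ (suc k) | k′ , inj₂ (at-N , at-p) =
    suc k′ , inj₁ (trans (cong (at τ) at-N) (trans (τN≡q (≡p⇒p≢N (iter-τ′-closed k′ i∈) at-p)) (cong (at τ′) (sym at-p))))

  τ′-orbit⊆τ-orbit : ∀ {i} → InRange n i → ∀ k′ → Σ[ k ∈ ℕ ] iter τ′ k′ i ≡ iter τ k i
  τ′-orbit⊆τ-orbit i∈ zero = 0 , refl
  τ′-orbit⊆τ-orbit {i} i∈ (suc k′) with τ′-orbit⊆τ-orbit i∈ k′
  ... | k , same with iter τ′ k′ i ≟ p
  ...   | no  ≢p   = suc k , trans (sym (τk≡τ′k (iter-τ′-closed k′ i∈) ≢p)) (cong (at τ) same)
  ...   | yes at-p = suc (suc k) , (begin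
    at τ′ (iter τ′ k′ i)       ≡⟨ cong (at τ′) at-p ⟩
    at τ′ p                    ≡⟨ sym (τN≡q (≡p⇒p≢N (iter-τ′-closed k′ i∈) at-p)) ⟩
    at τ N                     ≡⟨ cong (at τ) (sym τp≡N) ⟩
    at τ (at τ p)              ≡⟨ cong (at τ ∘ at τ) (trans (sym at-p) same) ⟩
    at τ (at τ (iter τ k i))   ∎)
    where open ≡-Reasoning

  isCycleMin-below : ∀ {i} → InRange n i → isCycleMin τ N i ≡ isCycleMin τ′ n i
  isCycleMin-below {i} i∈ = Bool-ext τ-min⇒τ′-min τ′-min⇒τ-min
    where
    i∈N : InRange N i
    i∈N = proj₁ i∈ , m≤n⇒m≤1+n (proj₂ i∈)
    τ-min⇒τ′-min : isCycleMin τ N i ≡ true → isCycleMin τ′ n i ≡ true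
    τ-min⇒τ′-min min = ≤iter⇒isCycleMin P′ λ k′ →
      let (k , same) = τ′-orbit⊆τ-orbit i∈ k′ in subst (i ≤_) (sym same) (isCycleMin⇒≤iter τ-perm i∈N min k)
    τ′-min⇒τ-min : isCycleMin τ′ n i ≡ true → isCycleMin τ N i ≡ true
    τ′-min⇒τ-min min = ≤iter⇒isCycleMin τ-perm bound
      where
      bound : ∀ k → i ≤ iter τ k i
      bound k with τ-orbit⊆τ′-orbit∪N i∈ k
      ... | k′ , inj₁ same       = subst (i ≤_) (sym same) (isCycleMin⇒≤iter P′ i∈ min k′)
      ... | k′ , inj₂ (at-N , _) = subst (i ≤_) (sym at-N) (m≤n⇒m≤1+n (proj₂ i∈))

  isCycleMin-N : isCycleMin τ N N ≡ (p ≡ᵇ N)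
  isCycleMin-N with p ≟ N
  ... | yes refl = trans (allᵇ-true _ (range N) (λ {k} _ → ≤ᵇ-true (≤-reflexive (sym (fixed k))))) (sym (≡ᵇ-true {p} refl))
    where
    fixed : ∀ k → iter τ k N ≡ N
    fixed zero    = refl
    fixed (suc k) = trans (cong (at τ) (fixed k)) τp≡N
  ... | no p≢N = trans (allᵇ-false _ (range N) (∈-range⁺ N (s≤s z≤n , s≤s z≤n))
                         (subst (λ v → (N ≤ᵇ v) ≡ false) (sym (τN≡q p≢N)) (≤ᵇ-false (s≤s (proj₂ (q∈ p≢N))))))
                       (sym (≡ᵇ-false p≢N))

  Cyc-cycleInsert : Cyc τ ≡ Cyc τ′ ++ (if p ≡ᵇ N then [ N ] else [])
  Cyc-cycleInsert = begin
    filterᵇ (isCycleMin τ (length τ)) (range (length τ))        ≡⟨ cong (λ L → filterᵇ (isCycleMin τ L) (range L)) |τ|≡N ⟩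
    filterᵇ (isCycleMin τ N) (range N)                          ≡⟨ filterᵇ-range-∷ʳ n isCycleMin-below ⟩
    filterᵇ (isCycleMin τ′ n) (range n) ++ (if isCycleMin τ N N then [ N ] else [])
                                                                ≡⟨ cong (λ b → filterᵇ (isCycleMin τ′ n) (range n) ++ (if b then [ N ] else [])) isCycleMin-N ⟩
    filterᵇ (isCycleMin τ′ n) (range n) ++ (if p ≡ᵇ N then [ N ] else [])
                                                                ≡⟨ cong (λ L → filterᵇ (isCycleMin τ′ L) (range L) ++ (if p ≡ᵇ N then [ N ] else [])) (sym (perm-length P′)) ⟩
    Cyc τ′ ++ (if p ≡ᵇ N then [ N ] else [])                    ∎
    where open ≡-Reasoning

gap : ℕ × ℕ → ℕ
gap (i , j) = j ∸ i

sor≡sum-gaps : ∀ σ → sor σ ≡ sum (map gap (decompGo (length σ) σ))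
sor≡sum-gaps σ = trans (foldr≡sum (transpositionFactorisation σ))
  (trans (cong sum (reverse-map gap (decompGo (length σ) σ))) (sum-↭ (↭.↭-reverse (map gap (decompGo (length σ) σ)))))
  where
  foldr≡sum : ∀ ts → foldr (λ { (i , j) acc → (j ∸ i) + acc }) 0 ts ≡ sum (map gap ts)
  foldr≡sum []       = refl
  foldr≡sum (t ∷ ts) = cong (gap t +_) (foldr≡sum ts)

pos-++ : ∀ σ ys {v} → v ∈ σ → pos (σ ++ ys) v ≡ pos σ v
pos-++ (x ∷ σ) ys {v} v∈ with x ≡ᵇ v in x≡ᵇv
... | true = refl
pos-++ (x ∷ σ) ys (here refl) | false = ⊥-elim (≡ᵇ-false⁻ x x x≡ᵇv refl)
pos-++ (x ∷ σ) ys (there v∈)  | false rewrite pos-++ σ ys v∈ = refl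

pos-InRange : ∀ σ {v} → v ∈ σ → InRange (length σ) (pos σ v)
pos-InRange (x ∷ σ) {v} v∈ with x ≡ᵇ v in x≡ᵇv
... | true = s≤s z≤n , s≤s z≤n
pos-InRange (x ∷ σ) (here refl) | false = ⊥-elim (≡ᵇ-false⁻ x x x≡ᵇv refl)
pos-InRange (x ∷ σ) {v} (there v∈) | false with pos-InRange σ v∈
... | 1≤k , k≤ with pos σ v
...   | suc k = s≤s z≤n , s≤s k≤

-- The factorisation only looks at the values 1 … m, all of which lie in σ.
decompGo-++ : ∀ m σ ys → m ≤ length σ → (∀ {v} → InRange m v → v ∈ σ) → decompGo m (σ ++ ys) ≡ decompGo m σ
decompGo-++ zero    σ ys _  _    = refl
decompGo-++ (suc m) σ ys m< has-1…m rewrite pos-++ σ ys (has-1…m (s≤s z≤n , ≤-refl)) with pos σ (suc m) ≡ᵇ suc m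
... | true  = decompGo-++ m σ ys (≤-trans (n≤1+n m) m<) (λ v∈ → has-1…m (proj₁ v∈ , m≤n⇒m≤1+n (proj₂ v∈)))
... | false = cong ((p , suc m) ∷_) (begin
  decompGo m (swapPos p (suc m) (σ ++ ys))   ≡⟨ cong (decompGo m) (swapPos-++ p (suc m) σ ys p∈ (s≤s z≤n , m<)) ⟩
  decompGo m (swapPos p (suc m) σ ++ ys)     ≡⟨ decompGo-++ m (swapPos p (suc m) σ) ys
                                                  (subst (m ≤_) (sym (length-swapPos p (suc m) σ)) (≤-trans (n≤1+n m) m<))
                                                  (λ v∈ → swapPos-∈ p (suc m) σ p∈ (s≤s z≤n , m<) (has-1…m (proj₁ v∈ , m≤n⇒m≤1+n (proj₂ v∈)))) ⟩
  decompGo m (swapPos p (suc m) σ)           ∎)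
  where
  open ≡-Reasoning
  p = pos σ (suc m)
  p∈ : InRange (length σ) p
  p∈ = pos-InRange σ (has-1…m (s≤s z≤n , ≤-refl))

module SorOfCycleInsertion {n : ℕ} {τ′ : List ℕ} (P′ : IsPerm n τ′) {p : ℕ} (p∈ : InRange (suc n) p) where
  open CycleInsertion P′ p∈

  decompGo-τ′+N : decompGo n τ′+N ≡ decompGo n τ′
  decompGo-τ′+N = decompGo-++ n τ′ [ N ] (≤-reflexive (sym (perm-length P′))) (perm-∈⁺ P′)

  -- The last factor of τ is (p N) (none if p = N); removing it leaves τ′ extended by the fixed point N.
  sum-gaps-cycleInsert : sum (map gap (decompGo N τ)) ≡ (N ∸ p) + sum (map gap (decompGo n τ′))
  sum-gaps-cycleInsert rewrite τ⁻¹N≡p with p ≟ N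
  ... | yes refl rewrite ≡ᵇ-true {p} refl | n∸n≡0 p =
    cong (sum ∘ map gap) (trans (cong (decompGo n) (swapPos-refl p τ′+N (InRange-τ′+N p∈))) decompGo-τ′+N)
  ... | no p≢N rewrite ≡ᵇ-false p≢N =
    cong ((N ∸ p) +_) (cong (sum ∘ map gap) (trans (cong (decompGo n) (swapPos-involutive p N τ′+N (InRange-τ′+N p∈) (InRange-τ′+N N∈))) decompGo-τ′+N))

  sor-cycleInsert : sor τ ≡ (N ∸ p) + sor τ′
  sor-cycleInsert = begin
    sor τ                                             ≡⟨ sor≡sum-gaps τ ⟩
    sum (map gap (decompGo (length τ) τ))             ≡⟨ cong (λ L → sum (map gap (decompGo L τ))) |τ|≡N ⟩
    sum (map gap (decompGo N τ))                      ≡⟨ sum-gaps-cycleInsert ⟩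
    (N ∸ p) + sum (map gap (decompGo n τ′))           ≡⟨ cong (λ L → (N ∸ p) + sum (map gap (decompGo L τ′))) (sym (perm-length P′)) ⟩
    (N ∸ p) + sum (map gap (decompGo (length τ′) τ′)) ≡⟨ cong ((N ∸ p) +_) (sym (sor≡sum-gaps τ′)) ⟩
    (N ∸ p) + sor τ′                                  ∎
    where open ≡-Reasoning

below-max : ∀ {n σ′} → IsPerm n σ′ → ∀ {y} → y ∈ σ′ → y < suc n
below-max P′ y∈ = s≤s (proj₂ (perm-∈⁻ P′ y∈))

Rmil≡Fix∘Acode : ∀ n σ → IsPerm n σ → Rmil σ ≡ Fix (Acode σ)
Rmil≡Fix∘Acode zero    _ P rewrite perm-empty P = refl
Rmil≡Fix∘Acode (suc n) _ P with insertAt-decomposition n _ P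
... | p , σ′ , p∈ , P′ , refl = begin
  Rmil σ                                               ≡⟨ Rmil-insertAt N p σ′ (below-max P′) p∈′ ⟩
  Rmil σ′ ++ (if p ≡ᵇ suc (length σ′) then [ N ] else [])
                                                       ≡⟨ cong (λ L → Rmil σ′ ++ (if p ≡ᵇ suc L then [ N ] else [])) (perm-length P′) ⟩
  Rmil σ′ ++ (if p ≡ᵇ N then [ N ] else [])            ≡⟨ cong₂ (λ R L → R ++ (if p ≡ᵇ suc L then [ suc L ] else []))
                                                                (Rmil≡Fix∘Acode n σ′ P′) (sym (length-Acode P′)) ⟩
  Fix (Acode σ′) ++ (if p ≡ᵇ suc (length (Acode σ′)) then [ suc (length (Acode σ′)) ] else [])
                                                       ≡⟨ sym (Fix-∷ʳ (Acode σ′) p) ⟩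
  Fix (Acode σ′ ++ [ p ])                              ≡⟨ cong Fix (sym Acode-insertAt) ⟩
  Fix (Acode σ)                                        ∎
  where
  open ≡-Reasoning
  open ValueInsertion P′ p∈

Lmil≡reverse-O∘Acode : ∀ n σ → IsPerm n σ → Lmil σ ≡ reverse (O (Acode σ))
Lmil≡reverse-O∘Acode zero    _ P rewrite perm-empty P = refl
Lmil≡reverse-O∘Acode (suc n) _ P with insertAt-decomposition n _ P
... | p , σ′ , p∈ , P′ , refl = begin
  Lmil σ                                                ≡⟨ Lmil-insertAt N p σ′ (below-max P′) p∈′ ⟩
  (if p ≡ᵇ 1 then N ∷ Lmil σ′ else Lmil σ′)             ≡⟨ cong (λ w → if p ≡ᵇ 1 then N ∷ w else w) (Lmil≡reverse-O∘Acode n σ′ P′) ⟩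
  (if p ≡ᵇ 1 then N ∷ reverse O′ else reverse O′)       ≡⟨ reverse-if (p ≡ᵇ 1) ⟩
  reverse (O′ ++ (if p ≡ᵇ 1 then [ N ] else []))        ≡⟨ cong (λ L → reverse (O′ ++ (if p ≡ᵇ 1 then [ suc L ] else []))) (sym (length-Acode P′)) ⟩
  reverse (O′ ++ (if p ≡ᵇ 1 then [ suc (length (Acode σ′)) ] else []))
                                                        ≡⟨ cong reverse (sym (O-∷ʳ (Acode σ′) p)) ⟩
  reverse (O (Acode σ′ ++ [ p ]))                       ≡⟨ cong (reverse ∘ O) (sym Acode-insertAt) ⟩
  reverse (O (Acode σ))                                 ∎
  where
  open ≡-Reasoning
  open ValueInsertion P′ p∈
  O′ = O (Acode σ′)
  reverse-if : ∀ b → (if b then N ∷ reverse O′ else reverse O′) ≡ reverse (O′ ++ (if b then [ N ] else []))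
  reverse-if true  = sym (reverse-++ O′ [ N ])
  reverse-if false = cong reverse (sym (++-identityʳ O′))

Lmap≡Rmil∘Acode : ∀ n σ → IsPerm n σ → Lmap σ ≡ Rmil (Acode σ)
Lmap≡Rmil∘Acode zero    _ P rewrite perm-empty P = refl
Lmap≡Rmil∘Acode (suc n) _ P with insertAt-decomposition n _ P
... | p , σ′ , p∈ , P′ , refl = begin
  Lmap σ                                       ≡⟨ Lmap-max σ σ′ (perm-length Pσ) (perm-length P′) p∈ σk≡σ′k p-max ⟩
  filterᵇ (_<ᵇ p) (Lmap σ′) ++ [ p ]           ≡⟨ cong (λ w → filterᵇ (_<ᵇ p) w ++ [ p ]) (Lmap≡Rmil∘Acode n σ′ P′) ⟩
  filterᵇ (_<ᵇ p) (Rmil (Acode σ′)) ++ [ p ]   ≡⟨ sym (Rmil-∷ʳ (Acode σ′) p) ⟩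
  Rmil (Acode σ′ ++ [ p ])                     ≡⟨ cong Rmil (sym Acode-insertAt) ⟩
  Rmil (Acode σ)                               ∎
  where
  open ≡-Reasoning
  open ValueInsertion P′ p∈
  p-max : ∀ {k} → InRange N k → k ≢ p → at σ k < at σ p
  p-max {k} k∈ k≢p = subst (at σ k <_) (sym σp≡N) (at<max Pσ p∈ σp≡N k∈ k≢p)

Inv≐induced∘Acode : ∀ n σ → IsPerm n σ → Inv σ ≐ induced (Acode σ)
Inv≐induced∘Acode zero    _ P rewrite perm-empty P = ≐-refl
Inv≐induced∘Acode (suc n) _ P with insertAt-decomposition n _ P
... | p , σ′ , p∈ , P′ , refl =
  ≐-trans Inv-insertAt (≐-trans (≐-++ (≐-refl {xs = row}) (≐-map (mapPair (punchIn p)) (Inv≐induced∘Acode n σ′ P′)))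
                                (≐-reflexive (sym induced-Acode-insertAt)))
  where open InversionsOfInsertAt P′ p∈

inv≡length-induced∘Acode : ∀ n σ → IsPerm n σ → inv σ ≡ length (induced (Acode σ))
inv≡length-induced∘Acode zero    _ P rewrite perm-empty P = refl
inv≡length-induced∘Acode (suc n) _ P with insertAt-decomposition n _ P
... | p , σ′ , p∈ , P′ , refl = begin
  inv σ                                                        ≡⟨ inv-insertAt ⟩
  (N ∸ p) + inv σ′                                             ≡⟨ cong ((N ∸ p) +_) (inv≡length-induced∘Acode n σ′ P′) ⟩
  (N ∸ p) + length (induced (Acode σ′))                        ≡⟨ cong (λ L → (suc L ∸ p) + length (induced (Acode σ′))) (sym (length-Acode P′)) ⟩
  (suc (length (Acode σ′)) ∸ p) + length (induced (Acode σ′))  ≡⟨ sym (length-induced-∷ʳ (Acode σ′) p∈-Acode) ⟩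
  length (induced (Acode σ′ ++ [ p ]))                         ≡⟨ cong (length ∘ induced) (sym Acode-insertAt) ⟩
  length (induced (Acode σ))                                   ∎
  where
  open ≡-Reasoning
  open ValueInsertion P′ p∈
  open InversionsOfInsertAt P′ p∈

length-Bcode : ∀ τ → length (Bcode τ) ≡ length τ
length-Bcode τ = trans (length-map _ (range (length τ))) (length-range _)

Cyc≡Fix∘Bcode : ∀ n τ → IsPerm n τ → Cyc τ ≡ Fix (Bcode τ)
Cyc≡Fix∘Bcode zero    _ P rewrite perm-empty P = refl
Cyc≡Fix∘Bcode (suc n) _ P with cycleInsert-decomposition n _ P
... | p , τ′ , p∈ , P′ , refl = begin
  Cyc τ                                               ≡⟨ Cyc-cycleInsert ⟩
  Cyc τ′ ++ (if p ≡ᵇ N then [ N ] else [])            ≡⟨ cong₂ (λ C L → C ++ (if p ≡ᵇ suc L then [ suc L ] else [])) (Cyc≡Fix∘Bcode n τ′ P′) (sym |Bτ′|≡n) ⟩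
  Fix (Bcode τ′) ++ (if p ≡ᵇ suc (length (Bcode τ′)) then [ suc (length (Bcode τ′)) ] else [])
                                                      ≡⟨ sym (Fix-∷ʳ (Bcode τ′) p) ⟩
  Fix (Bcode τ′ ++ [ p ])                             ≡⟨ cong Fix (sym Bcode-cycleInsert) ⟩
  Fix (Bcode τ)                                       ∎
  where
  open ≡-Reasoning
  open CycleInsertion P′ p∈
  open BcodeOfCycleInsertion P′ p∈
  open CycOfCycleInsertion P′ p∈
  |Bτ′|≡n : length (Bcode τ′) ≡ n
  |Bτ′|≡n = trans (length-Bcode τ′) (perm-length P′)

Lmap≡Rmil∘Bcode : ∀ n τ → IsPerm n τ → Lmap τ ≡ Rmil (Bcode τ)
Lmap≡Rmil∘Bcode zero    _ P rewrite perm-empty P = refl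
Lmap≡Rmil∘Bcode (suc n) _ P with cycleInsert-decomposition n _ P
... | p , τ′ , p∈ , P′ , refl = begin
  Lmap τ                                       ≡⟨ Lmap-max τ τ′ |τ|≡N (perm-length P′) p∈ same-prefix p-max ⟩
  filterᵇ (_<ᵇ p) (Lmap τ′) ++ [ p ]           ≡⟨ cong (λ w → filterᵇ (_<ᵇ p) w ++ [ p ]) (Lmap≡Rmil∘Bcode n τ′ P′) ⟩
  filterᵇ (_<ᵇ p) (Rmil (Bcode τ′)) ++ [ p ]   ≡⟨ sym (Rmil-∷ʳ (Bcode τ′) p) ⟩
  Rmil (Bcode τ′ ++ [ p ])                     ≡⟨ cong Rmil (sym Bcode-cycleInsert) ⟩
  Rmil (Bcode τ)                               ∎
  where
  open ≡-Reasoning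
  open CycleInsertion P′ p∈
  open BcodeOfCycleInsertion P′ p∈
  same-prefix : ∀ {k} → 1 ≤ k → k < p → at τ k ≡ at τ′ k
  same-prefix 1≤k k<p = τk≡τ′k (1≤k , ≤-pred (≤-trans k<p (proj₂ p∈))) (<⇒≢ k<p)
  p-max : ∀ {k} → InRange N k → k ≢ p → at τ k < at τ p
  p-max {k} k∈ k≢p = subst (at τ k <_) (sym τp≡N) (at<max τ-perm p∈ τp≡N k∈ k≢p)

sor≡length-induced∘Bcode : ∀ n τ → IsPerm n τ → sor τ ≡ length (induced (Bcode τ))
sor≡length-induced∘Bcode zero    _ P rewrite perm-empty P = refl
sor≡length-induced∘Bcode (suc n) _ P with cycleInsert-decomposition n _ P
... | p , τ′ , p∈ , P′ , refl = begin
  sor τ                                                        ≡⟨ sor-cycleInsert ⟩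
  (N ∸ p) + sor τ′                                             ≡⟨ cong ((N ∸ p) +_) (sor≡length-induced∘Bcode n τ′ P′) ⟩
  (N ∸ p) + length (induced (Bcode τ′))                        ≡⟨ cong (λ L → (suc L ∸ p) + length (induced (Bcode τ′))) (sym |Bτ′|≡n) ⟩
  (suc (length (Bcode τ′)) ∸ p) + length (induced (Bcode τ′))  ≡⟨ sym (length-induced-∷ʳ (Bcode τ′) (subst (λ L → InRange (suc L) p) (sym |Bτ′|≡n) p∈)) ⟩
  length (induced (Bcode τ′ ++ [ p ]))                         ≡⟨ cong (length ∘ induced) (sym Bcode-cycleInsert) ⟩
  length (induced (Bcode τ))                                   ∎
  where
  open ≡-Reasoning
  open CycleInsertion P′ p∈
  open BcodeOfCycleInsertion P′ p∈
  open SorOfCycleInsertion P′ p∈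
  |Bτ′|≡n : length (Bcode τ′) ≡ n
  |Bτ′|≡n = trans (length-Bcode τ′) (perm-length P′)

appendEach : ℕ → List ℕ → List (List ℕ)
appendEach N c = map (λ p → c ++ [ p ]) (range N)

codes : ℕ → List (List ℕ)
codes zero    = [] ∷ []
codes (suc n) = concatMap (appendEach (suc n)) (codes n)

∈-codes⁻ : ∀ n {c} → c ∈ codes (suc n) → Σ[ c′ ∈ List ℕ ] Σ[ p ∈ ℕ ] c′ ∈ codes n × InRange (suc n) p × c ≡ c′ ++ [ p ]
∈-codes⁻ n c∈ with ∈-concat⁻′ (map (appendEach (suc n)) (codes n)) c∈
... | cs , c∈cs , cs∈ with ∈-map⁻ (appendEach (suc n)) cs∈
... | c′ , c′∈ , refl with ∈-map⁻ (λ p → c′ ++ [ p ]) c∈cs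
... | p , p∈ , refl = c′ , p , c′∈ , ∈-range⁻ (suc n) p∈ , refl

length-codes : ∀ n {c} → c ∈ codes n → length c ≡ n
length-codes zero    (here refl) = refl
length-codes (suc n) c∈ with ∈-codes⁻ n c∈
... | c′ , p , c′∈ , _ , refl = trans (length-∷ʳ c′ p) (cong suc (length-codes n c′∈))

Unique-codes : ∀ n → Unique (codes n)
Unique-codes zero    = All.[] ∷ []
Unique-codes (suc n) = Unique-concatMap-appendEach (codes n) (Unique-codes n)
  where
  Unique-concatMap-appendEach : ∀ cs → Unique cs → Unique (concatMap (appendEach (suc n)) cs)
  Unique-concatMap-appendEach []       _          = []
  Unique-concatMap-appendEach (c ∷ cs) (c∉cs ∷ u) =
    Unique.++⁺ (Unique.map⁺ (∷ʳ-injectiveʳ c c) (Unique-range (suc n))) (Unique-concatMap-appendEach cs u) disjoint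
    where
    disjoint : ∀ {v} → ¬ (v ∈ appendEach (suc n) c × v ∈ concatMap (appendEach (suc n)) cs)
    disjoint (v∈c , v∈cs) with ∈-map⁻ (λ p → c ++ [ p ]) v∈c
    ... | _ , _ , refl with ∈-concat⁻′ (map (appendEach (suc n)) cs) v∈cs
    ... | ds , v∈ds , ds∈ with ∈-map⁻ (appendEach (suc n)) ds∈
    ... | c′ , c′∈cs , refl with ∈-map⁻ (λ p → c′ ++ [ p ]) v∈ds
    ... | _ , _ , e = All.lookup c∉cs c′∈cs (∷ʳ-injectiveˡ c c′ e)

∈-insertAll⁻ : ∀ x ys {σ} → σ ∈ insertAll x ys → Σ[ p ∈ ℕ ] p ∈ range (suc (length ys)) × σ ≡ insertAt x p ys
∈-insertAll⁻ x ys {σ} σ∈ = ∈-map⁻ (λ p → insertAt x p ys) (subst (σ ∈_) (insertAll≡map-insertAt x ys) σ∈)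

perms-sound : ∀ n {σ} → σ ∈ perms n → IsPerm n σ
perms-sound zero    (here refl) = ↭-refl
perms-sound (suc n) σ∈ with ∈-concat⁻′ (map (insertAll (suc n)) (perms n)) σ∈
... | σs , σ∈σs , σs∈ with ∈-map⁻ (insertAll (suc n)) σs∈
... | σ′ , σ′∈ , refl with ∈-insertAll⁻ (suc n) σ′ σ∈σs
... | p , _ , refl = insertAt-perm n σ′ p (perms-sound n σ′∈)

perms-complete : ∀ n {σ} → IsPerm n σ → σ ∈ perms n
perms-complete zero    P rewrite perm-empty P = here refl
perms-complete (suc n) P with insertAt-decomposition n _ P
... | p , σ′ , p∈ , P′ , refl = ∈-concat⁺′
  (subst (insertAt (suc n) p σ′ ∈_) (sym (insertAll≡map-insertAt (suc n) σ′))
    (∈-map⁺ (λ x → insertAt (suc n) x σ′) {x = p} (∈-range⁺ (suc (length σ′)) (subst (λ L → InRange (suc L) p) (sym (perm-length P′)) p∈))))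
  (∈-map⁺ (insertAll (suc n)) (perms-complete n P′))

map-Acode-perms : ∀ n → map Acode (perms n) ≡ codes n
map-Acode-perms zero    = refl
map-Acode-perms (suc n) = begin
  map Acode (concatMap (insertAll N) (perms n))                 ≡⟨ map-concatMap Acode (insertAll N) (perms n) ⟩
  concatMap (map Acode ∘ insertAll N) (perms n)                 ≡⟨ cong concat (map-cong-∈ (perms n) (λ σ′∈ → insertions (perms-sound n σ′∈))) ⟩
  concatMap (appendEach N ∘ Acode) (perms n)                    ≡⟨ sym (concatMap-map (appendEach N) Acode (perms n)) ⟩
  concatMap (appendEach N) (map Acode (perms n))                ≡⟨ cong (concatMap (appendEach N)) (map-Acode-perms n) ⟩
  codes N                                                       ∎
  where
  open ≡-Reasoning
  N = suc n
  insertions : ∀ {σ′} → IsPerm n σ′ → map Acode (insertAll N σ′) ≡ appendEach N (Acode σ′)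
  insertions {σ′} P′ = begin
    map Acode (insertAll N σ′)                                    ≡⟨ cong (map Acode) (insertAll≡map-insertAt N σ′) ⟩
    map Acode (map (λ p → insertAt N p σ′) (range (suc (length σ′)))) ≡⟨ cong (λ L → map Acode (map (λ p → insertAt N p σ′) (range (suc L)))) (perm-length P′) ⟩
    map Acode (map (λ p → insertAt N p σ′) (range N))             ≡⟨ sym (map-∘ (range N)) ⟩
    map (λ p → Acode (insertAt N p σ′)) (range N)                 ≡⟨ map-cong-range N (λ p∈ → ValueInsertion.Acode-insertAt P′ p∈) ⟩
    appendEach N (Acode σ′)                                       ∎

Bcode-onto : ∀ n {c} → c ∈ codes n → Σ[ τ ∈ List ℕ ] IsPerm n τ × Bcode τ ≡ c
Bcode-onto zero    (here refl) = [] , ↭-refl , refl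
Bcode-onto (suc n) c∈ with ∈-codes⁻ n c∈
... | c′ , p , c′∈ , p∈ , refl with Bcode-onto n c′∈
... | τ′ , P′ , refl = cycleInsert n p τ′ , CycleInsertion.τ-perm P′ p∈ , BcodeOfCycleInsertion.Bcode-cycleInsert P′ p∈

-- B hits every code and, by the count through A, there are as many permutations as codes.
codes↭map-Bcode-perms : ∀ n → codes n ↭ map Bcode (perms n)
codes↭map-Bcode-perms n = ⊆∧length≤⇒↭ (codes n) (map Bcode (perms n)) (Unique-codes n) onto same-size
  where
  onto : codes n ⊆ map Bcode (perms n)
  onto c∈ with Bcode-onto n c∈
  ... | τ , P , refl = ∈-map⁺ Bcode (perms-complete n P)
  same-size : length (map Bcode (perms n)) ≤ length (codes n)
  same-size = ≤-reflexive (trans (length-map Bcode (perms n)) (trans (sym (length-map Acode (perms n))) (cong length (map-Acode-perms n))))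

sumℤ-↭ : ∀ {xs ys} → xs ↭ ys → sumℤ xs ≡ sumℤ ys
sumℤ-↭ xs↭ys = ↭ₛ.foldr-commMonoid ℤ+.setoid ℤ+.isCommutativeMonoid (↭⇒↭ₛ xs↭ys)
  where module ℤ+ = CommutativeMonoid ℤ.+-0-commutativeMonoid

sumℤ-++ : ∀ xs ys → sumℤ (xs ++ ys) ≡ sumℤ xs ℤ.+ sumℤ ys
sumℤ-++ []       ys = sym (ℤ.+-identityˡ (sumℤ ys))
sumℤ-++ (x ∷ xs) ys = trans (cong (ℤ._+_ x) (sumℤ-++ xs ys)) (sym (ℤ.+-assoc x (sumℤ xs) (sumℤ ys)))

prodℤ-++ : ∀ xs ys → prodℤ (xs ++ ys) ≡ prodℤ xs ℤ.* prodℤ ys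
prodℤ-++ []       ys = sym (ℤ.*-identityˡ (prodℤ ys))
prodℤ-++ (x ∷ xs) ys = trans (cong (x ℤ.*_) (prodℤ-++ xs ys)) (sym (ℤ.*-assoc x (prodℤ xs) (prodℤ ys)))

sumℤ-concatMap : ∀ {A : Set} (g : A → List ℤ) xs → sumℤ (concatMap g xs) ≡ sumℤ (map (sumℤ ∘ g) xs)
sumℤ-concatMap g []       = refl
sumℤ-concatMap g (x ∷ xs) = trans (sumℤ-++ (g x) (concatMap g xs)) (cong (ℤ._+_ (sumℤ (g x))) (sumℤ-concatMap g xs))

sumℤ-*ʳ : ∀ {A : Set} (f : A → ℤ) c xs → sumℤ (map (λ x → f x ℤ.* c) xs) ≡ sumℤ (map f xs) ℤ.* c
sumℤ-*ʳ f c []       = sym (ℤ.*-zeroˡ c)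
sumℤ-*ʳ f c (x ∷ xs) = trans (cong (ℤ._+_ (f x ℤ.* c)) (sumℤ-*ʳ f c xs)) (sym (ℤ.*-distribʳ-+ c (f x) _))

sumℤ-*ˡ : ∀ {A : Set} (f : A → ℤ) c xs → sumℤ (map (λ x → c ℤ.* f x) xs) ≡ c ℤ.* sumℤ (map f xs)
sumℤ-*ˡ f c []       = sym (ℤ.*-zeroʳ c)
sumℤ-*ˡ f c (x ∷ xs) = trans (cong (ℤ._+_ (c ℤ.* f x)) (sumℤ-*ˡ f c xs)) (sym (ℤ.*-distribˡ-+ c (f x) _))

^ℤ-+ : ∀ z a b → z ^ℤ (a + b) ≡ (z ^ℤ a) ℤ.* (z ^ℤ b)
^ℤ-+ z zero    b = sym (ℤ.*-identityˡ (z ^ℤ b))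
^ℤ-+ z (suc a) b = trans (cong (z ℤ.*_) (^ℤ-+ z a b)) (sym (ℤ.*-assoc z (z ^ℤ a) (z ^ℤ b)))

indicator : Bool → ℕ
indicator b = if b then 1 else 0

length-if : ∀ b (z : ℕ) → length (if b then [ z ] else []) ≡ indicator b
length-if true  z = refl
length-if false z = refl

module GeneratingFunction (q x y : ℤ) where

  weight : List ℕ → ℤ
  weight ℓ = (q ^ℤ length (induced ℓ)) ℤ.* ((x ^ℤ length (Fix ℓ)) ℤ.* (y ^ℤ length (O ℓ)))

  letterWeight : ℕ → ℕ → ℤ
  letterWeight N p = (q ^ℤ (N ∸ p)) ℤ.* ((x ^ℤ indicator (p ≡ᵇ N)) ℤ.* (y ^ℤ indicator (p ≡ᵇ 1)))

  weight-∷ʳ : ∀ c {p} → InRange (suc (length c)) p → weight (c ++ [ p ]) ≡ weight c ℤ.* letterWeight (suc (length c)) p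
  weight-∷ʳ c {p} p∈ = begin
    weight (c ++ [ p ])
      ≡⟨ cong₃ (λ i f o → (q ^ℤ i) ℤ.* ((x ^ℤ f) ℤ.* (y ^ℤ o))) (length-induced-∷ʳ c p∈) |Fix| |O| ⟩
    (q ^ℤ ((N ∸ p) + I)) ℤ.* ((x ^ℤ (F + indicator (p ≡ᵇ N))) ℤ.* (y ^ℤ (Oc + indicator (p ≡ᵇ 1))))
      ≡⟨ cong₂ ℤ._*_ (^ℤ-+ q (N ∸ p) I) (cong₂ ℤ._*_ (^ℤ-+ x F _) (^ℤ-+ y Oc _)) ⟩
    ((q ^ℤ (N ∸ p)) ℤ.* (q ^ℤ I)) ℤ.* (((x ^ℤ F) ℤ.* (x ^ℤ indicator (p ≡ᵇ N))) ℤ.* ((y ^ℤ Oc) ℤ.* (y ^ℤ indicator (p ≡ᵇ 1))))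
      ≡⟨ regroup (q ^ℤ (N ∸ p)) (q ^ℤ I) (x ^ℤ F) (x ^ℤ indicator (p ≡ᵇ N)) (y ^ℤ Oc) (y ^ℤ indicator (p ≡ᵇ 1)) ⟩
    weight c ℤ.* letterWeight N p ∎
    where
    open ≡-Reasoning
    N = suc (length c)
    I = length (induced c)
    F = length (Fix c)
    Oc = length (O c)
    |Fix| : length (Fix (c ++ [ p ])) ≡ F + indicator (p ≡ᵇ N)
    |Fix| = trans (cong length (Fix-∷ʳ c p)) (trans (length-++ (Fix c)) (cong (F +_) (length-if (p ≡ᵇ N) N)))
    |O| : length (O (c ++ [ p ])) ≡ Oc + indicator (p ≡ᵇ 1)
    |O| = trans (cong length (O-∷ʳ c p)) (trans (length-++ (O c)) (cong (Oc +_) (length-if (p ≡ᵇ 1) N)))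
    regroup : ∀ (qa qb xa xb ya yb : ℤ) → (qa ℤ.* qb) ℤ.* ((xa ℤ.* xb) ℤ.* (ya ℤ.* yb)) ≡ (qb ℤ.* (xa ℤ.* ya)) ℤ.* (qa ℤ.* (xb ℤ.* yb))
    regroup = solve-∀

  letterSum : ℕ → ℤ
  letterSum N = sumℤ (map (letterWeight N) (range N))

  total : ℕ → ℤ
  total n = sumℤ (map weight (codes n))

  total-suc : ∀ n → total (suc n) ≡ total n ℤ.* letterSum (suc n)
  total-suc n = begin
    sumℤ (map weight (concatMap (appendEach N) (codes n)))              ≡⟨ cong sumℤ (map-concatMap weight (appendEach N) (codes n)) ⟩
    sumℤ (concatMap (map weight ∘ appendEach N) (codes n))              ≡⟨ sumℤ-concatMap (map weight ∘ appendEach N) (codes n) ⟩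
    sumℤ (map (sumℤ ∘ map weight ∘ appendEach N) (codes n))             ≡⟨ cong sumℤ (map-cong-∈ (codes n) extensions) ⟩
    sumℤ (map (λ c → weight c ℤ.* letterSum N) (codes n))               ≡⟨ sumℤ-*ʳ weight (letterSum N) (codes n) ⟩
    total n ℤ.* letterSum N                                             ∎
    where
    open ≡-Reasoning
    N = suc n
    extensions : ∀ {c} → c ∈ codes n → sumℤ (map weight (appendEach N c)) ≡ weight c ℤ.* letterSum N
    extensions {c} c∈ = begin
      sumℤ (map weight (appendEach N c))                       ≡⟨ cong sumℤ (sym (map-∘ {g = weight} {f = λ p → c ++ [ p ]} (range N))) ⟩
      sumℤ (map (λ p → weight (c ++ [ p ])) (range N))         ≡⟨ cong sumℤ (map-cong-range N last-letter) ⟩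
      sumℤ (map (λ p → weight c ℤ.* letterWeight N p) (range N)) ≡⟨ sumℤ-*ˡ (letterWeight N) (weight c) (range N) ⟩
      weight c ℤ.* letterSum N                                 ∎
      where
      last-letter : ∀ {p} → InRange N p → weight (c ++ [ p ]) ≡ weight c ℤ.* letterWeight N p
      last-letter {p} p∈ = trans (weight-∷ʳ c (subst (λ L → InRange (suc L) p) (sym (length-codes n c∈)) p∈))
                                 (cong (λ L → weight c ℤ.* letterWeight (suc L) p) (length-codes n c∈))

  sum-range-reflect : ∀ m (f : ℕ → ℤ) → sumℤ (map (λ j → f (suc m ∸ j)) (range m)) ≡ sumℤ (map f (range m))
  sum-range-reflect zero    f = refl
  sum-range-reflect (suc m) f = begin
    sumℤ (map (λ j → f (2 + m ∸ j)) (range (suc m)))               ≡⟨ cong (sumℤ ∘ map (λ j → f (2 + m ∸ j))) (range-cons m) ⟩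
    f (suc m) ℤ.+ sumℤ (map (λ j → f (2 + m ∸ j)) (map suc (range m))) ≡⟨ cong (ℤ._+_ (f (suc m)) ∘ sumℤ) (sym (map-∘ (range m))) ⟩
    f (suc m) ℤ.+ sumℤ (map (λ j → f (suc m ∸ j)) (range m))       ≡⟨ cong (ℤ._+_ (f (suc m))) (sum-range-reflect m f) ⟩
    f (suc m) ℤ.+ sumℤ (map f (range m))                           ≡⟨ ℤ.+-comm (f (suc m)) _ ⟩
    sumℤ (map f (range m)) ℤ.+ f (suc m)                           ≡⟨ cong (ℤ._+_ (sumℤ (map f (range m)))) (sym (ℤ.+-identityʳ (f (suc m)))) ⟩
    sumℤ (map f (range m)) ℤ.+ sumℤ [ f (suc m) ]                  ≡⟨ sym (sumℤ-++ (map f (range m)) [ f (suc m) ]) ⟩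
    sumℤ (map f (range m) ++ map f [ suc m ])                      ≡⟨ cong sumℤ (sym (map-++ f (range m) [ suc m ])) ⟩
    sumℤ (map f (range m ++ [ suc m ]))                            ≡⟨ cong (sumℤ ∘ map f) (sym (range-suc m)) ⟩
    sumℤ (map f (range (suc m)))                                   ∎
    where open ≡-Reasoning

  factor : ℕ → ℤ
  factor r = x ℤ.+ qInt q r ℤ.+ y ℤ.* (q ^ℤ (r ∸ 1)) ℤ.- ℤ.+ 1 ℤ.- (q ^ℤ (r ∸ 1))

  -- For N ≥ 2 the last letter p = 1 contributes y q^{N-1}, p = N contributes x,
  -- and 1 < p < N contribute q^{N-p}, i.e. the interior q + … + q^{N-2} of [N]_q.
  letterSum≡factor : ∀ m → letterSum (2 + m) ≡ factor (2 + m)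
  letterSum≡factor m = begin
    sumℤ (map (letterWeight N) (range N))
      ≡⟨ cong (sumℤ ∘ map (letterWeight N)) (trans (range-cons (suc m)) (cong (λ r → 1 ∷ map suc r) (range-suc m))) ⟩
    letterWeight N 1 ℤ.+ sumℤ (map (letterWeight N) (map suc (range m ++ [ suc m ])))
      ≡⟨ cong (ℤ._+_ (letterWeight N 1) ∘ sumℤ) (trans (cong (map (letterWeight N)) (map-++ suc (range m) [ suc m ])) (map-++ (letterWeight N) (map suc (range m)) [ N ])) ⟩
    letterWeight N 1 ℤ.+ sumℤ (map (letterWeight N) (map suc (range m)) ++ [ letterWeight N N ])
      ≡⟨ cong (ℤ._+_ (letterWeight N 1)) (sumℤ-++ (map (letterWeight N) (map suc (range m))) [ letterWeight N N ]) ⟩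
    letterWeight N 1 ℤ.+ (sumℤ (map (letterWeight N) (map suc (range m))) ℤ.+ (letterWeight N N ℤ.+ ℤ.+ 0))
      ≡⟨ cong₂ (λ a b → letterWeight N 1 ℤ.+ (a ℤ.+ (b ℤ.+ ℤ.+ 0))) interior last ⟩
    letterWeight N 1 ℤ.+ (S ℤ.+ (ℤ.+ 1 ℤ.* ((x ℤ.* ℤ.+ 1) ℤ.* ℤ.+ 1) ℤ.+ ℤ.+ 0))
      ≡⟨ rearrange x y (q ^ℤ suc m) S ⟩
    x ℤ.+ (ℤ.+ 1 ℤ.+ (S ℤ.+ ((q ^ℤ suc m) ℤ.+ ℤ.+ 0))) ℤ.+ y ℤ.* (q ^ℤ suc m) ℤ.- ℤ.+ 1 ℤ.- (q ^ℤ suc m)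
      ≡⟨ cong (λ z → x ℤ.+ z ℤ.+ y ℤ.* (q ^ℤ suc m) ℤ.- ℤ.+ 1 ℤ.- (q ^ℤ suc m)) (sym qInt-N) ⟩
    factor N ∎
    where
    open ≡-Reasoning
    N = 2 + m
    S = sumℤ (map (q ^ℤ_) (range m))
    interior : sumℤ (map (letterWeight N) (map suc (range m))) ≡ S
    interior = trans (cong sumℤ (sym (map-∘ (range m)))) (trans (cong sumℤ (map-cong-range m inner)) (sum-range-reflect m (q ^ℤ_)))
      where
      inner : ∀ {j} → InRange m j → letterWeight N (suc j) ≡ q ^ℤ (suc m ∸ j)
      inner {suc j} (_ , j<m) rewrite ≡ᵇ-false {j} {m} (<⇒≢ j<m) = ℤ.*-identityʳ (q ^ℤ (m ∸ j))
    last : letterWeight N N ≡ ℤ.+ 1 ℤ.* ((x ℤ.* ℤ.+ 1) ℤ.* ℤ.+ 1)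
    last rewrite n∸n≡0 m | ≡ᵇ-true {m} refl = refl
    qInt-N : qInt q N ≡ ℤ.+ 1 ℤ.+ (S ℤ.+ ((q ^ℤ suc m) ℤ.+ ℤ.+ 0))
    qInt-N = trans (cong (λ r → ℤ.+ 1 ℤ.+ sumℤ (map (q ^ℤ_) r)) (sym (map-upTo suc (suc m)))) (cong (ℤ._+_ (ℤ.+ 1)) (begin
      sumℤ (map (q ^ℤ_) (range (suc m)))                   ≡⟨ cong (sumℤ ∘ map (q ^ℤ_)) (range-suc m) ⟩
      sumℤ (map (q ^ℤ_) (range m ++ [ suc m ]))            ≡⟨ cong sumℤ (map-++ (q ^ℤ_) (range m) [ suc m ]) ⟩
      sumℤ (map (q ^ℤ_) (range m) ++ [ q ^ℤ suc m ])       ≡⟨ sumℤ-++ (map (q ^ℤ_) (range m)) [ q ^ℤ suc m ] ⟩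
      S ℤ.+ ((q ^ℤ suc m) ℤ.+ ℤ.+ 0)                       ∎))
    rearrange : ∀ (x y Q S : ℤ) → Q ℤ.* (ℤ.+ 1 ℤ.* (y ℤ.* ℤ.+ 1)) ℤ.+ (S ℤ.+ (ℤ.+ 1 ℤ.* ((x ℤ.* ℤ.+ 1) ℤ.* ℤ.+ 1) ℤ.+ ℤ.+ 0))
                                        ≡ x ℤ.+ (ℤ.+ 1 ℤ.+ (S ℤ.+ (Q ℤ.+ ℤ.+ 0))) ℤ.+ y ℤ.* Q ℤ.- ℤ.+ 1 ℤ.- Q
    rearrange = solve-∀

  total≡rhsProduct : ∀ m → total (suc m) ≡ rhsProduct (suc m) q x y
  total≡rhsProduct zero    = one-code x y
    where
    one-code : ∀ (x y : ℤ) → ℤ.+ 1 ℤ.* ((x ℤ.* ℤ.+ 1) ℤ.* (y ℤ.* ℤ.+ 1)) ℤ.+ ℤ.+ 0 ≡ x ℤ.* (y ℤ.* ℤ.+ 1)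
    one-code = solve-∀
  total≡rhsProduct (suc m) = begin
    total (2 + m)                                           ≡⟨ total-suc (suc m) ⟩
    total (suc m) ℤ.* letterSum (2 + m)                     ≡⟨ cong₂ ℤ._*_ (total≡rhsProduct m) (letterSum≡factor m) ⟩
    rhsProduct (suc m) q x y ℤ.* factor (2 + m)             ≡⟨ append-factor x y (prodℤ (map factor rs)) (factor (2 + m)) ⟩
    x ℤ.* (y ℤ.* (prodℤ (map factor rs) ℤ.* prodℤ [ factor (2 + m) ]))
                                                            ≡⟨ cong (λ z → x ℤ.* (y ℤ.* z)) (sym (prodℤ-++ (map factor rs) [ factor (2 + m) ])) ⟩
    x ℤ.* (y ℤ.* prodℤ (map factor rs ++ map factor [ 2 + m ]))
                                                            ≡⟨ cong (λ z → x ℤ.* (y ℤ.* prodℤ z)) (sym (map-++ factor rs [ 2 + m ])) ⟩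
    x ℤ.* (y ℤ.* prodℤ (map factor (rs ++ [ 2 + m ])))      ≡⟨ cong (λ z → x ℤ.* (y ℤ.* prodℤ (map factor z))) (sym (filter-++ (T? ∘ (2 ≤ᵇ_)) (range (suc m)) [ 2 + m ])) ⟩
    x ℤ.* (y ℤ.* prodℤ (map factor (filterᵇ (2 ≤ᵇ_) (range (suc m) ++ [ 2 + m ]))))
                                                            ≡⟨ cong (λ z → x ℤ.* (y ℤ.* prodℤ (map factor (filterᵇ (2 ≤ᵇ_) z)))) (sym (range-suc (suc m))) ⟩
    rhsProduct (2 + m) q x y                                ∎
    where
    open ≡-Reasoning
    rs = filterᵇ (2 ≤ᵇ_) (range (suc m))
    append-factor : ∀ (x y P f : ℤ) → (x ℤ.* (y ℤ.* P)) ℤ.* f ≡ x ℤ.* (y ℤ.* (P ℤ.* (f ℤ.* ℤ.+ 1)))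
    append-factor = solve-∀

module _ {A B : Set} (code : B → A) {xs : List B} {ys : List A} (onto : map code xs ↭ ys) where

  count-via-code : ∀ (P : A → Bool) (Q : B → Bool) → (∀ {b} → b ∈ xs → Q b ≡ P (code b)) →
    length (filterᵇ Q xs) ≡ length (filterᵇ P ys)
  count-via-code P Q Q≗P∘code = begin
    length (filterᵇ Q xs)                       ≡⟨ cong length (filterᵇ-cong-∈ xs Q≗P∘code) ⟩
    length (filterᵇ (P ∘ code) xs)              ≡⟨ sym (length-map code (filterᵇ (P ∘ code) xs)) ⟩
    length (map code (filterᵇ (P ∘ code) xs))   ≡⟨ cong length (sym (filterᵇ-map P code xs)) ⟩
    length (filterᵇ P (map code xs))            ≡⟨ ↭.↭-length (↭.filter-↭ (T? ∘ P) onto) ⟩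
    length (filterᵇ P ys)                       ∎
    where open ≡-Reasoning

  sum-via-code : ∀ (F : A → ℤ) (G : B → ℤ) → (∀ {b} → b ∈ xs → G b ≡ F (code b)) →
    sumℤ (map G xs) ≡ sumℤ (map F ys)
  sum-via-code F G G≗F∘code = begin
    sumℤ (map G xs)               ≡⟨ cong sumℤ (map-cong-∈ xs G≗F∘code) ⟩
    sumℤ (map (F ∘ code) xs)      ≡⟨ cong sumℤ (map-∘ xs) ⟩
    sumℤ (map F (map code xs))    ≡⟨ sumℤ-↭ (↭.map⁺ F onto) ⟩
    sumℤ (map F ys)               ∎
    where open ≡-Reasoning

codeStatistics : List ℕ → ℕ × ℕ × ℕ × ℕ
codeStatistics ℓ = length (induced ℓ) , length (Fix ℓ) , length (Rmil ℓ) , length (O ℓ)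

statistics-Acode : ∀ n {σ} → IsPerm n σ → (inv σ , rmin σ , lmax σ , lmin σ) ≡ codeStatistics (Acode σ)
statistics-Acode n {σ} P = cong₂ _,_ (inv≡length-induced∘Acode n σ P) (cong₂ _,_ (cong length (Rmil≡Fix∘Acode n σ P))
  (cong₂ _,_ (cong length (Lmap≡Rmil∘Acode n σ P)) (trans (cong length (Lmil≡reverse-O∘Acode n σ P)) (length-reverse (O (Acode σ))))))

statistics-Bcode : ∀ n {τ} → IsPerm n τ → (sor τ , cyc τ , lmax τ , lmic₁ τ) ≡ codeStatistics (Bcode τ)
statistics-Bcode n {τ} P = cong₂ _,_ (sor≡length-induced∘Bcode n τ P)
  (cong₂ _,_ (cong length (Cyc≡Fix∘Bcode n τ P)) (cong (_, lmic₁ τ) (cong length (Lmap≡Rmil∘Bcode n τ P))))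

module _ (a b c d : ℕ) where

  matches : ℕ × ℕ × ℕ × ℕ → Bool
  matches (s₁ , s₂ , s₃ , s₄) = (s₁ ≡ᵇ a) ∧ (s₂ ≡ᵇ b) ∧ (s₃ ≡ᵇ c) ∧ (s₄ ≡ᵇ d)

  count-Acode : ∀ n → count4 n inv rmin lmax lmin a b c d ≡ length (filterᵇ (matches ∘ codeStatistics) (codes n))
  count-Acode n = count-via-code Acode (↭-reflexive (map-Acode-perms n)) (matches ∘ codeStatistics) _
    (cong matches ∘ statistics-Acode n ∘ perms-sound n)

  count-Bcode : ∀ n → count4 n sor cyc lmax lmic₁ a b c d ≡ length (filterᵇ (matches ∘ codeStatistics) (codes n))
  count-Bcode n = count-via-code Bcode (↭-sym (codes↭map-Bcode-perms n)) (matches ∘ codeStatistics) _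
    (cong matches ∘ statistics-Bcode n ∘ perms-sound n)

module _ (q x y : ℤ) where
  open GeneratingFunction q x y

  genfun-Acode : ∀ n → genfun n inv rmin lmin q x y ≡ total n
  genfun-Acode n = sum-via-code Acode (↭-reflexive (map-Acode-perms n)) weight _ (λ σ∈ → cong monomial (statistics-Acode n (perms-sound n σ∈)))
    where
    monomial : ℕ × ℕ × ℕ × ℕ → ℤ
    monomial (i , r , _ , l) = (q ^ℤ i) ℤ.* ((x ^ℤ r) ℤ.* (y ^ℤ l))

  genfun-Bcode : ∀ n → genfun n sor cyc lmic₁ q x y ≡ total n
  genfun-Bcode n = sum-via-code Bcode (↭-sym (codes↭map-Bcode-perms n)) weight _ (λ τ∈ → cong monomial (statistics-Bcode n (perms-sound n τ∈)))
    where
    monomial : ℕ × ℕ × ℕ × ℕ → ℤ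
    monomial (s , c , _ , l) = (q ^ℤ s) ℤ.* ((x ^ℤ c) ℤ.* (y ^ℤ l))

Acode-perm-∈-codes : ∀ n {σ} → IsPerm n σ → Acode σ ∈ codes n
Acode-perm-∈-codes n P = subst (_ ∈_) (map-Acode-perms n) (∈-map⁺ Acode (perms-complete n P))

φ-transports-statistics : ∀ n {σ τ} → IsPerm n σ → IsPerm n τ → Bcode τ ≡ Acode σ →
  (Inv σ ≐ Sor τ) × (Rmil σ ≐ Cyc τ) × (Lmap σ ≐ Lmap τ) × (Lmil σ ≐ Lmic₁ τ)
φ-transports-statistics n {σ} {τ} P Q Bτ≡Aσ =
  ≐-trans (Inv≐induced∘Acode n σ P) (≐-reflexive (cong induced (sym Bτ≡Aσ))) ,
  ≐-reflexive (trans (Rmil≡Fix∘Acode n σ P) (trans (cong Fix (sym Bτ≡Aσ)) (sym (Cyc≡Fix∘Bcode n τ Q)))) ,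
  ≐-reflexive (trans (Lmap≡Rmil∘Acode n σ P) (trans (cong Rmil (sym Bτ≡Aσ)) (sym (Lmap≡Rmil∘Bcode n τ Q)))) ,
  ≐-trans (≐-reflexive (Lmil≡reverse-O∘Acode n σ P)) (≐-trans (≐-reverse (O (Acode σ))) (≐-reflexive (cong O (sym Bτ≡Aσ))))

theorem1p3 : (n : ℕ) → n ≥ 1 →
    -- (1) for σ ∈ 𝔖ₙ, φ(σ) = B⁻¹(A(σ)) exists in 𝔖ₙ and every such τ satisfies the set identities
    ((σ : List ℕ) → IsPerm n σ →
      (Σ[ τ ∈ List ℕ ] (IsPerm n τ × Bcode τ ≡ Acode σ))
      × ((τ : List ℕ) → IsPerm n τ → Bcode τ ≡ Acode σ →
          (Inv σ ≐ Sor τ) × (Rmil σ ≐ Cyc τ) × (Lmap σ ≐ Lmap τ) × (Lmil σ ≐ Lmic₁ τ)))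
    × -- (2) equidistribution of the quadruples over 𝔖ₙ
    ((a b c d : ℕ) → count4 n inv rmin lmax lmin a b c d ≡ count4 n sor cyc lmax lmic₁ a b c d)
    × -- and the generating-function identities (as polynomial identities, evaluated at all integers)
    ((q x y : ℤ) → (genfun n inv rmin lmin q x y ≡ genfun n sor cyc lmic₁ q x y)
                 × (genfun n sor cyc lmic₁ q x y ≡ rhsProduct n q x y))
theorem1p3 n@(suc m) _ =
  (λ σ P → Bcode-onto n (Acode-perm-∈-codes n P) , λ τ Q → φ-transports-statistics n P Q) ,
  (λ a b c d → trans (count-Acode a b c d n) (sym (count-Bcode a b c d n))) ,
  λ q x y → trans (genfun-Acode q x y n) (sym (genfun-Bcode q x y n)) ,
            trans (genfun-Bcode q x y n) (GeneratingFunction.total≡rhsProduct q x y m)
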